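{- Let $F$ be a finite field of characteristic $p$ and order $q$ with $[F:\mathbb{F}_p]=2^s$ for some $s\ge1$. Let $d$ be a positive integer with $\gcd(d,q-1)=1$ such that $d$ is not degenerate over $F$ but is degenerate over $\mathbb{F}_p$. Then $V_{F,d}\le\frac12[F:\mathbb{F}_p]$, and this is an equality whenever $d$ is degenerate over the subfield of $F$ of order $\sqrt q$.
   Context: $\psi$ is the canonical additive character of $F$, $\psi(x)=e^{2\pi i\operatorname{Tr}(x)/p}$ with $\operatorname{Tr}$ the absolute trace $F\to\mathbb{F}_p$. For $a\in F$, $W_{F,d}(a)=\sum_{x\in F}\psi(x^d-ax)$, and $V_{F,d}=\min_{a\in F}\operatorname{val}_p(W_{F,d}(a))$, where $\operatorname{val}_p$ is the $p$-adic valuation extended to $\mathbb{Q}(e^{2\pi i/p})$ with $\operatorname{val}_p(1-e^{2\pi i/p})=1/(p-1)$ (so $\operatorname{val}_p(p)=1$). For a subfield $K$ of $F$, $d$ is degenerate over $K$ if $d$ is congruent to a power of $p$ modulo $|K|-1$. -}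

module Defs where

open import Data.Nat as ℕ using (ℕ; zero; suc; _^_)
open import Data.Integer as ℤ using (ℤ; +_)
open import Data.Fin as Fin using (Fin; toℕ)
open import Data.Product using (Σ; ∃; _×_; _,_)
open import Data.Bool using (if_then_else_)
open import Relation.Binary.PropositionalEquality using (_≡_)
open import Relation.Nullary using (¬_; Dec)
open import Relation.Nullary.Decidable using (⌊_⌋)
import Data.Integer.Divisibility as ℤDiv
open import Function.Bundles using (_↔_; Inverse)
import Algebra.Structures as AS

record FiniteField : Set₁ where
  field
    Carrier : Set
    _+_ _*_ : Carrier → Carrier → Carrier
    -_      : Carrier → Carrier
    0# 1#   : Carrier
    isCommutativeRing : AS.IsCommutativeRing {A = Carrier} _≡_ _+_ _*_ -_ 0# 1#
    1≢0     : ¬ (1# ≡ 0#)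
    inverse : ∀ x → ¬ (x ≡ 0#) → Σ Carrier (λ y → x * y ≡ 1#)
    _≟F_    : (x y : Carrier) → Dec (x ≡ y)
    size    : ℕ
    enum    : Fin size ↔ Carrier

  _•_ : ℕ → Carrier → Carrier
  zero  • x = 0#
  suc n • x = x + (n • x)

  _^F_ : Carrier → ℕ → Carrier
  x ^F zero  = 1#
  x ^F suc n = x * (x ^F n)

  sumF : (Carrier → ℤ) → ℤ
  sumF f = go size (Inverse.to enum)
    where
    go : (m : ℕ) → (Fin m → Carrier) → ℤ
    go zero    g = + 0
    go (suc m) g = f (g Fin.zero) ℤ.+ go m (λ i → g (Fin.suc i))

record HasCharDeg (F : FiniteField) (p n : ℕ) : Set where
  open FiniteField F
  field
    charp  : p • 1# ≡ 0#
    order  : size ≡ p ^ n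

module _ (F : FiniteField) where
  open FiniteField F

  traceF : (p n : ℕ) → Carrier → Carrier
  traceF p n x = go n
    where
    go : ℕ → Carrier
    go zero    = 0#
    go (suc i) = (x ^F (p ^ i)) + go i

  -- The Weil sum W_{F,d}(a) = Σ_x ψ(x^d - a x) as an element of ℤ[ζ_p],
  -- represented in ℤ[C_p] = ℤ[X]/(X^p - 1) (coefficient of ζ^j is the
  -- number of x with Tr(x^d - a x) = j·1, j < p).
  weil : (p n d : ℕ) → Carrier → (Fin p → ℤ)
  weil p n d a j =
    sumF (λ x → if ⌊ (toℕ j • 1#) ≟F traceF p n ((x ^F d) + (- (a * x))) ⌋
                then + 1 else + 0)

-- ℤ[ζ_p] ≅ ℤ[C_p] / (1 + X + ... + X^(p-1)); two elements of ℤ[C_p]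
-- have the same image iff they differ by a constant vector.

prevFin : ∀ {p} → Fin p → Fin p
prevFin {suc m} Fin.zero    = Fin.fromℕ m
prevFin {suc m} (Fin.suc i) = Fin.inject₁ i

-- multiplication by π = 1 - ζ_p
mulπ : ∀ {p} → (Fin p → ℤ) → (Fin p → ℤ)
mulπ u j = u j ℤ.- u (prevFin j)

mulπ^ : ∀ {p} → ℕ → (Fin p → ℤ) → (Fin p → ℤ)
mulπ^ zero    u = u
mulπ^ (suc k) u = mulπ (mulπ^ k u)

-- (1 - ζ_p)^k divides w in ℤ[ζ_p]
πDivides : ∀ {p} → ℕ → (Fin p → ℤ) → Set
πDivides {p} k w = Σ (Fin p → ℤ) λ u → Σ ℤ λ c → ∀ j → w j ≡ mulπ^ k u j ℤ.+ c

-- val_p(w) ≥ r/(p-1)  (val_p(1 - ζ_p) = 1/(p-1); (1 - ζ_p) is the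
-- unique prime of ℤ[ζ_p] above p, so this is (1 - ζ_p)^r ∣ w)
valAtLeast : ∀ {p} → (Fin p → ℤ) → ℕ → Set
valAtLeast w r = πDivides r w

CongPowMod : (d p M : ℕ) → Set
CongPowMod d p M = ∃ λ j → (+ M) ℤDiv.∣ ((+ d) ℤ.- (+ (p ^ j)))

DegenerateOver : (d p k : ℕ) → Set
DegenerateOver d p k = CongPowMod d p (p ^ k ℕ.∸ 1)

-- Climb the tower of quadratic extensions from 𝔽_p to F, and let E/K be one of its
-- steps, with |K| = Q.
--
-- If d is nondegenerate over K, use a form of the Hasse-Davenport relation: for v ≠ 0,
-- the sum of W_E(a) over N(a) = v is the sum of W_K(b) W_K(c) over b c = v. It holds
-- because every monic quadratic polynomial over K has two roots, counted in E and K
-- together. The group algebra of K^× over 𝔽_p is reduced, so the right-hand side is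
-- for some v divisible by π = 1 - ζ no more often than the square of the least
-- divisible W_K(b); hence V_E ≤ 2 V_K.
--
-- If d is degenerate over K, one may take d ≡ 1 modulo Q - 1. Let tr be the trace from
-- E to K and Z(a) the number of x in E with tr(x^d) = tr(a x). Summing over the
-- multiples of x by K gives W(a) = Q (W(a) + Q - Z(a)), so Q divides W(a). If π Q
-- divides every W(a), then p divides every Z(a), and a blocking set argument yields
-- an a with tr(x^d) = tr(a x) for all x, which makes d degenerate over E.
module Submission where

open import Level using (0ℓ)
open import Algebra.Bundles using (CommutativeRing; CommutativeMonoid; CommutativeSemiring)
import Algebra.Solver.Ring
import Algebra.Solver.Ring.AlmostCommutativeRing as ACR
import Algebra.Properties.Semiring.Mult
import Algebra.Properties.Semiring.Exp
import Algebra.Properties.Monoid.Mult.TCOptimised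
import Algebra.Properties.Semiring.Sum
import Algebra.Properties.CommutativeSemiring.Exp
import Algebra.Properties.CommutativeSemiring.Binomial
import Algebra.Properties.Ring
import Algebra.Properties.AbelianGroup
import Relation.Binary.Reasoning.Setoid
open import Data.Nat as ℕ using (ℕ; zero; suc; z≤n; s≤s; NonZero)
import Data.Nat.Properties as ℕₚ
open import Data.Nat.Divisibility using (_∣_; divides; ∣⇒≤; ∣-trans; n∣m*n; ∣m+n∣m⇒∣n; _∣?_; ∣1⇒≡1)
open import Data.Nat.Primality using (Prime; euclidsLemma; prime⇒nonZero; prime⇒nonTrivial)
open import Data.Nat.Combinatorics using (_C_; nCn≡1; nC1≡n; nCk+nC[k+1]≡[n+1]C[k+1])
open import Data.Integer as ℤ using (ℤ; +_; -[1+_]; 0ℤ; 1ℤ; -1ℤ)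
import Data.Integer.Properties as ℤₚ
open import Data.Fin as Fin using (Fin; toℕ; inject₁; fromℕ)
open import Data.Fin.Properties as Finₚ using (toℕ<n; toℕ-fromℕ; toℕ-inject₁)
open import Data.Maybe as Maybe using (Maybe)
open import Data.Product using (Σ; _×_; _,_; proj₁; proj₂)
open import Data.Sum using (_⊎_; inj₁; inj₂)
open import Data.Empty using (⊥; ⊥-elim)
open import Relation.Nullary using (¬_; Dec; yes; no; _×-dec_; ¬?)
open import Relation.Nullary.Decidable as Dec using (dec⇒maybe; ⌊_⌋)
open import Relation.Binary.PropositionalEquality as ≡ using (_≡_; _≢_)
open import Function using (_∘_; id)
import Algebra.Properties.CommutativeMonoid.Sum
import Algebra.Properties.Monoid.Mult
open import Function.Bundles using (_↔_; Inverse; mk↔ₛ′)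
open import Defs
open import Axiom.UniquenessOfIdentityProofs using (module Decidable⇒UIP)
open import Data.Nat.Coprimality using (prime⇒coprime; coprime-Bézout; gcd≡1⇒coprime)
open import Data.Nat.DivMod using (_/_; _%_; m≡m%n+[m/n]*n; m%n<n)
open import Data.Nat.GCD using (module Bézout; gcd; gcd[m,n]∣m; gcd[m,n]∣n; gcd-greatest)
open import Data.Sum as Sum using (_⊎_; inj₁; inj₂; [_,_]′)
open import Algebra.Structures using (IsCommutativeRing)
open import Data.Bool using (if_then_else_)
import Data.Nat.Solver

-- Valuations enter only as divisibility by powers of `π`: V ≤ r/(p-1) says that some Weil sum is
-- not divisible by the power r + 1 of `π`. Factors p and Q can be traded for such powers because p
-- and π^(p-1) divide each other.
--
-- The identity between the Weil sums of E and K comes from inverting the exponent. If e is the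
-- inverse of d modulo |E| - 1, the substitution x = y^e moves the exponent out of the additive
-- character, and both sides become Σ f(μ) f(v μ^e) + Q, summed over μ in K. For E, f(v) is the sum
-- of ψ(tr x) over N(x) = v; for K, it is the sum of ψ(y + z) over y z = v. The count of roots makes
-- these two functions negatives of each other, as ψ sums to 0 over K, and the sign disappears in
-- the product.
--
-- The bound 2^(s-1) originates at the step where d ceases to be degenerate: there V is m = [K:F_p],
-- half the degree of E. Each later step doubles both the bound and the degree.

-- Commutative rings: integers in a ring and a ring solver.

module RingProperties (R : CommutativeRing 0ℓ 0ℓ) where
  open CommutativeRing R public renaming (Carrier to ∣R∣)
  open Algebra.Properties.Semiring.Mult semiring public
    using (×-congʳ; ×-homo-+; ×-assoc-*; ×1-homo-*; ×-assocˡ)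
    renaming (_×_ to _·_)
  open Algebra.Properties.Semiring.Exp semiring public
    using (_^_; ^-congˡ; ^-homo-*; ^-assocʳ)
  open Algebra.Properties.CommutativeSemiring.Exp commutativeSemiring public
    using (^-distrib-*)
  open Algebra.Properties.Ring ring public using (-‿distribˡ-*; -‿distribʳ-*)
  open Algebra.Properties.AbelianGroup +-abelianGroup public
    using () renaming (⁻¹-∙-comm to -‿+-comm; ⁻¹-involutive to -‿involutive; ε⁻¹≈ε to -0#≈0#; inverseˡ-unique to +-inverseˡ-unique)
  open Algebra.Properties.Semiring.Sum semiring public
    using (sum; sum-cong-≋; sum-init-last; *-distribˡ-sum; sum-replicate-zero)
  open Algebra.Properties.Monoid.Mult.TCOptimised +-monoid
    using (×ᵤ≈×) renaming (_×_ to _·′_)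
  module ≈R = Relation.Binary.Reasoning.Setoid setoid

  fromℕ· : ℕ → ∣R∣
  fromℕ· n = n · 1#

  fromℤ : ℤ → ∣R∣
  fromℤ (+ n)      = fromℕ· n
  fromℤ (-[1+ n ]) = - fromℕ· (suc n)

  fromℤ-neg : ∀ i → fromℤ (ℤ.- i) ≈ - fromℤ i
  fromℤ-neg (+ zero)    = sym -0#≈0#
  fromℤ-neg (+ (suc n)) = refl
  fromℤ-neg -[1+ n ]    = sym (-‿involutive _)

  private
    cancel : ∀ a b → 1# + a - (1# + b) ≈ a - b
    cancel a b = begin
      1# + a - (1# + b)       ≈⟨ +-cong (+-comm _ _) (sym (-‿+-comm _ _)) ⟩
      a + 1# + (- 1# + - b)   ≈⟨ +-assoc _ _ _ ⟩
      a + (1# + (- 1# + - b)) ≈⟨ +-congˡ (sym (+-assoc _ _ _)) ⟩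
      a + (1# + - 1# + - b)   ≈⟨ +-congˡ (+-congʳ (-‿inverseʳ _)) ⟩
      a + (0# + - b)          ≈⟨ +-congˡ (+-identityˡ _) ⟩
      a - b                   ∎
      where open ≈R

    fromℤ-⊖ : ∀ m n → fromℤ (m ℤ.⊖ n) ≈ fromℕ· m - fromℕ· n
    fromℤ-⊖ m       zero    = sym (trans (+-congˡ -0#≈0#) (+-identityʳ _))
    fromℤ-⊖ zero    (suc n) = sym (+-identityˡ _)
    fromℤ-⊖ (suc m) (suc n) = begin
      fromℤ (suc m ℤ.⊖ suc n)         ≡⟨ ≡.cong fromℤ (ℤₚ.[1+m]⊖[1+n]≡m⊖n m n) ⟩
      fromℤ (m ℤ.⊖ n)                 ≈⟨ fromℤ-⊖ m n ⟩
      fromℕ· m - fromℕ· n             ≈⟨ sym (cancel _ _) ⟩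
      fromℕ· (suc m) - fromℕ· (suc n) ∎
      where open ≈R

  fromℤ-+ : ∀ i j → fromℤ (i ℤ.+ j) ≈ fromℤ i + fromℤ j
  fromℤ-+ (+ m)    (+ n)    = ×-homo-+ 1# m n
  fromℤ-+ (+ m)    -[1+ n ] = fromℤ-⊖ m (suc n)
  fromℤ-+ -[1+ m ] (+ n)    = trans (fromℤ-⊖ n (suc m)) (+-comm _ _)
  fromℤ-+ -[1+ m ] -[1+ n ] = begin
    - fromℕ· (suc (suc (m ℕ.+ n)))        ≡⟨ ≡.cong (λ k → - fromℕ· (suc k)) (≡.sym (ℕₚ.+-suc m n)) ⟩
    - fromℕ· (suc m ℕ.+ suc n)            ≈⟨ -‿cong (×-homo-+ 1# (suc m) (suc n)) ⟩
    - (fromℕ· (suc m) + fromℕ· (suc n))   ≈⟨ sym (-‿+-comm _ _) ⟩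
    - fromℕ· (suc m) + - fromℕ· (suc n)   ∎
    where open ≈R

  fromℤ-* : ∀ i j → fromℤ (i ℤ.* j) ≈ fromℤ i * fromℤ j
  fromℤ-* (+ m) (+ n) = trans (reflexive (≡.cong fromℤ (≡.sym (ℤₚ.pos-* m n)))) (×1-homo-* m n)
  fromℤ-* (+ m) -[1+ n ] = begin
    fromℤ (+ m ℤ.* -[1+ n ])           ≡⟨ ≡.cong fromℤ (≡.sym (ℤₚ.neg-distribʳ-* (+ m) (+ suc n))) ⟩
    fromℤ (ℤ.- (+ m ℤ.* + suc n))      ≈⟨ fromℤ-neg (+ m ℤ.* + suc n) ⟩
    - fromℤ (+ m ℤ.* + suc n)          ≈⟨ -‿cong (fromℤ-* (+ m) (+ suc n)) ⟩
    - (fromℕ· m * fromℕ· (suc n))      ≈⟨ -‿distribʳ-* _ _ ⟩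
    fromℕ· m * - fromℕ· (suc n)        ∎
    where open ≈R
  fromℤ-* -[1+ m ] (+ n) = begin
    fromℤ (-[1+ m ] ℤ.* + n)           ≡⟨ ≡.cong fromℤ (≡.sym (ℤₚ.neg-distribˡ-* (+ suc m) (+ n))) ⟩
    fromℤ (ℤ.- (+ suc m ℤ.* + n))      ≈⟨ fromℤ-neg (+ suc m ℤ.* + n) ⟩
    - fromℤ (+ suc m ℤ.* + n)          ≈⟨ -‿cong (fromℤ-* (+ suc m) (+ n)) ⟩
    - (fromℕ· (suc m) * fromℕ· n)      ≈⟨ -‿distribˡ-* _ _ ⟩
    - fromℕ· (suc m) * fromℕ· n        ∎
    where open ≈R
  fromℤ-* -[1+ m ] -[1+ n ] = begin
    fromℕ· (suc m ℕ.* suc n)               ≈⟨ ×1-homo-* (suc m) (suc n) ⟩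
    fromℕ· (suc m) * fromℕ· (suc n)        ≈⟨ sym (-‿involutive _) ⟩
    - - (fromℕ· (suc m) * fromℕ· (suc n))  ≈⟨ -‿cong (-‿distribˡ-* _ _) ⟩
    - (- fromℕ· (suc m) * fromℕ· (suc n))  ≈⟨ -‿distribʳ-* _ _ ⟩
    - fromℕ· (suc m) * - fromℕ· (suc n)    ∎
    where open ≈R

  private
    acr = ACR.fromCommutativeRing R

    -- fromℤ with coeff (+ 1) = 1# definitionally, as the solver's goals require.
    coeff : ℤ → ∣R∣
    coeff (+ n)    = n ·′ 1#
    coeff -[1+ n ] = - (suc n ·′ 1#)

    coeff≈fromℤ : ∀ i → coeff i ≈ fromℤ i
    coeff≈fromℤ (+ n)    = sym (×ᵤ≈× n 1#)
    coeff≈fromℤ -[1+ n ] = -‿cong (sym (×ᵤ≈× (suc n) 1#))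

    ℤ⟶R : ℤ.+-*-rawRing ACR.-Raw-AlmostCommutative⟶ acr
    ℤ⟶R = record
      { ⟦_⟧    = coeff
      ; +-homo = λ i j → trans (coeff≈fromℤ (i ℤ.+ j)) (trans (fromℤ-+ i j)
                   (sym (+-cong (coeff≈fromℤ i) (coeff≈fromℤ j))))
      ; *-homo = λ i j → trans (coeff≈fromℤ (i ℤ.* j)) (trans (fromℤ-* i j)
                   (sym (*-cong (coeff≈fromℤ i) (coeff≈fromℤ j))))
      ; -‿homo = λ i → trans (coeff≈fromℤ (ℤ.- i)) (trans (fromℤ-neg i)
                   (sym (-‿cong (coeff≈fromℤ i))))
      ; 0-homo = refl
      ; 1-homo = refl
      }

  -- The coefficients are integers because their equality is decidable, which lets opposite terms
  -- cancel in any commutative ring.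
  module Solver = Algebra.Solver.Ring ℤ.+-*-rawRing acr ℤ⟶R
    (λ i j → Maybe.map (λ eq → reflexive (≡.cong coeff eq)) (dec⇒maybe (i ℤ.≟ j)))

  ·≈*  : ∀ n x → n · x ≈ fromℕ· n * x
  ·≈* n x = trans (×-congʳ n (sym (*-identityˡ x))) (sym (×-assoc-* n 1# x))

  x-y≈0⇒x≈y : ∀ {x y} → x - y ≈ 0# → x ≈ y
  x-y≈0⇒x≈y {x} {y} eq = begin
    x           ≈⟨ solve 2 (λ x y → x := (x :- y) :+ y) refl x y ⟩
    (x - y) + y ≈⟨ +-congʳ eq ⟩
    0# + y      ≈⟨ +-identityˡ y ⟩
    y           ∎
    where open ≈R
          open Solver

  x≈y⇒x-y≈0 : ∀ {x y} → x ≈ y → x - y ≈ 0#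
  x≈y⇒x-y≈0 {x} {y} eq = trans (+-congʳ eq) (-‿inverseʳ y)

  1^n≈1 : ∀ n → 1# ^ n ≈ 1#
  1^n≈1 zero    = refl
  1^n≈1 (suc n) = trans (*-identityˡ _) (1^n≈1 n)

-- Binomial coefficients and p-th powers.

-- Pascal's rule on both sides. For n + 1 = p it exhibits the factor p, which Euclid's lemma moves
-- to the binomial coefficient as long as k + 1 < p.
absorption : ∀ n k → suc k ℕ.* (suc n C suc k) ≡ suc n ℕ.* (n C k)
absorption zero zero = ≡.refl
absorption zero (suc k) = ℕₚ.*-zeroʳ (suc (suc k))
absorption (suc n) zero = begin
  1 ℕ.* (suc (suc n) C 1) ≡⟨ ℕₚ.*-identityˡ _ ⟩
  suc (suc n) C 1         ≡⟨ nC1≡n (suc (suc n)) ⟩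
  suc (suc n)             ≡⟨ ≡.sym (ℕₚ.*-identityʳ _) ⟩
  suc (suc n) ℕ.* 1       ∎
  where open ≡.≡-Reasoning
absorption (suc n) (suc k) = begin
  suc (suc k) ℕ.* (suc (suc n) C suc (suc k))
    ≡⟨ ≡.cong (suc (suc k) ℕ.*_) (≡.sym (nCk+nC[k+1]≡[n+1]C[k+1] (suc n) (suc k))) ⟩
  suc (suc k) ℕ.* (c ℕ.+ suc n C suc (suc k))
    ≡⟨ ℕₚ.*-distribˡ-+ (suc (suc k)) c _ ⟩
  (c ℕ.+ suc k ℕ.* c) ℕ.+ suc (suc k) ℕ.* (suc n C suc (suc k))
    ≡⟨ ≡.cong₂ (λ a b → (c ℕ.+ a) ℕ.+ b) (absorption n k) (absorption n (suc k)) ⟩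
  (c ℕ.+ suc n ℕ.* (n C k)) ℕ.+ suc n ℕ.* (n C suc k)
    ≡⟨ ℕₚ.+-assoc c _ _ ⟩
  c ℕ.+ (suc n ℕ.* (n C k) ℕ.+ suc n ℕ.* (n C suc k))
    ≡⟨ ≡.cong (c ℕ.+_) (≡.sym (ℕₚ.*-distribˡ-+ (suc n) (n C k) _)) ⟩
  c ℕ.+ suc n ℕ.* (n C k ℕ.+ n C suc k)
    ≡⟨ ≡.cong (λ a → c ℕ.+ suc n ℕ.* a) (nCk+nC[k+1]≡[n+1]C[k+1] n k) ⟩
  suc (suc n) ℕ.* c ∎
  where open ≡.≡-Reasoning
        c = suc n C suc k

prime∣binomial : ∀ {p} → Prime p → ∀ {k} → 0 ℕ.< k → k ℕ.< p → p ∣ p C k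
prime∣binomial {suc p} pr {suc k} _ k<p
  with euclidsLemma (suc k) (suc p C suc k) pr
         (divides (p C k) (≡.trans (absorption p k) (ℕₚ.*-comm (suc p) (p C k))))
... | inj₂ d = d
... | inj₁ d = ⊥-elim (ℕₚ.<⇒≱ k<p (∣⇒≤ d))

module Binomial (R : CommutativeRing 0ℓ 0ℓ) where
  open RingProperties R
  open Algebra.Properties.CommutativeSemiring.Binomial commutativeSemiring
    using (theorem; binomialTerm)

  private
    sum-multiple : ∀ {n} P (f : Fin n → ∣R∣) → (∀ i → Σ ∣R∣ λ g → f i ≈ P * g) →
                   Σ ∣R∣ λ g → sum f ≈ P * g
    sum-multiple {n} P f h = sum (proj₁ ∘ h) ,
      trans (sum-cong-≋ (proj₂ ∘ h)) (sym (*-distribˡ-sum P (proj₁ ∘ h)))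

  -- The two outer terms are set apart because the n terms between them are the ones that a prime
  -- exponent divides.
  binomial-split : ∀ n x y →
    (x + y) ^ suc n ≈ y ^ suc n + (sum (λ (i : Fin n) →
      binomialTerm x y (suc n) (Fin.suc (inject₁ i))) + x ^ suc n)
  binomial-split n x y = begin
    (x + y) ^ suc n ≈⟨ theorem (suc n) x y ⟩
    t Fin.zero + sum (λ i → t (Fin.suc i))
      ≈⟨ +-cong first (trans (sum-init-last (λ i → t (Fin.suc i))) (+-congˡ last)) ⟩
    y ^ suc n + (sum (λ i → t (Fin.suc (inject₁ i))) + x ^ suc n) ∎
    where
    open ≈R
    t = binomialTerm x y (suc n)
    first : t Fin.zero ≈ y ^ suc n
    first = trans (+-identityʳ _) (*-identityˡ _)
    last : t (Fin.suc (fromℕ n)) ≈ x ^ suc n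
    last rewrite toℕ-fromℕ n | nCn≡1 (suc n) | ℕₚ.n∸n≡0 n = trans (+-identityʳ _) (*-identityʳ _)

  frobenius-+ : ∀ {p} → Prime p → fromℕ· p ≈ 0# → ∀ x y → (x + y) ^ p ≈ x ^ p + y ^ p
  frobenius-+ {zero} pr _ = ⊥-elim (ℕ.≢-nonZero⁻¹ _ {{prime⇒nonZero pr}} ≡.refl)
  frobenius-+ {suc n} pr p≈0 x y = begin
    (x + y) ^ suc n                     ≈⟨ binomial-split n x y ⟩
    y ^ suc n + (_ + x ^ suc n)         ≈⟨ +-congˡ (+-congʳ (trans (proj₂ mid) (trans (*-congʳ p≈0) (zeroˡ _)))) ⟩
    y ^ suc n + (0# + x ^ suc n)        ≈⟨ +-congˡ (+-identityˡ _) ⟩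
    y ^ suc n + x ^ suc n               ≈⟨ +-comm _ _ ⟩
    x ^ suc n + y ^ suc n               ∎
    where
    open ≈R
    mid = sum-multiple (fromℕ· (suc n))
      (λ (i : Fin n) → binomialTerm x y (suc n) (Fin.suc (inject₁ i))) λ i →
      let k<p : suc (toℕ (inject₁ i)) ℕ.< suc n
          k<p = s≤s (≡.subst (ℕ._< n) (≡.sym (toℕ-inject₁ i)) (toℕ<n i))
      in multiple (prime∣binomial pr (s≤s z≤n) k<p) _
      where
      multiple : ∀ {c} → suc n ∣ c → ∀ z → Σ ∣R∣ λ g → c · z ≈ fromℕ· (suc n) * g
      multiple (divides q ≡.refl) z = q · z , (begin
        (q ℕ.* suc n) · z ≡⟨ ≡.cong (_· z) (ℕₚ.*-comm q (suc n)) ⟩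
        (suc n ℕ.* q) · z ≈⟨ sym (×-assocˡ z (suc n) q) ⟩
        suc n · (q · z)   ≈⟨ ·≈* (suc n) (q · z) ⟩
        fromℕ· (suc n) * (q · z) ∎)

  -- Meant for t = ζ - 1, where the left side is 1: it then reads t^p = - p t (1 + t s), the exact
  -- relation between p and powers of `π`. The linear term is singled out because all further middle
  -- terms are divisible by p t^2.
  prime-expansion : ∀ {p} → Prime p → ∀ t → Σ ∣R∣ λ s →
    (t + 1#) ^ p ≈ 1# + fromℕ· p * (t * (1# + t * s)) + t ^ p
  prime-expansion {zero} pr = ⊥-elim (ℕ.≢-nonZero⁻¹ _ {{prime⇒nonZero pr}} ≡.refl)
  prime-expansion {suc zero} pr = ⊥-elim (ℕ.nonTrivial⇒≢1 {{prime⇒nonTrivial pr}} ≡.refl)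
  prime-expansion {p@(suc (suc r))} pr t = proj₁ rest , (begin
    (t + 1#) ^ p ≈⟨ binomial-split (suc r) t 1# ⟩
    1# ^ p + ((b Fin.zero + sum (b ∘ Fin.suc)) + t ^ p)
      ≈⟨ +-cong (1^n≈1 p) (+-congʳ (+-cong b₀ (proj₂ rest))) ⟩
    1# + ((fromℕ· p * t + fromℕ· p * (t * t) * proj₁ rest) + t ^ p)
      ≈⟨ solve 4 (λ P t s u → con (+ 1) :+ ((P :* t :+ P :* (t :* t) :* s) :+ u)
           := con (+ 1) :+ P :* (t :* (con (+ 1) :+ t :* s)) :+ u) refl (fromℕ· p) t (proj₁ rest) (t ^ p) ⟩
    1# + fromℕ· p * (t * (1# + t * proj₁ rest)) + t ^ p ∎)
    where
    open ≈R
    open Solver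
    b : Fin (suc r) → ∣R∣
    b i = binomialTerm t 1# p (Fin.suc (inject₁ i))
    b₀ : b Fin.zero ≈ fromℕ· p * t
    b₀ = begin
      (p C 1) · (t ^ 1 * 1# ^ suc r) ≡⟨ ≡.cong (_· (t ^ 1 * 1# ^ suc r)) (nC1≡n p) ⟩
      p · (t ^ 1 * 1# ^ suc r)       ≈⟨ ·≈* p _ ⟩
      fromℕ· p * (t ^ 1 * 1# ^ suc r) ≈⟨ *-congˡ (*-cong (*-identityʳ t) (1^n≈1 (suc r))) ⟩
      fromℕ· p * (t * 1#)            ≈⟨ *-congˡ (*-identityʳ t) ⟩
      fromℕ· p * t ∎
    rest = sum-multiple (fromℕ· p * (t * t)) (b ∘ Fin.suc) λ i →
      let k<p : suc (suc (toℕ (inject₁ i))) ℕ.< p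
          k<p = s≤s (s≤s (≡.subst (ℕ._< r) (≡.sym (toℕ-inject₁ i)) (toℕ<n i)))
      in multiple (prime∣binomial pr (s≤s z≤n) k<p) (t ^ toℕ (inject₁ i)) _
      where
      multiple : ∀ {c} → p ∣ c → ∀ y z → Σ ∣R∣ λ g → c · (t * (t * y) * z) ≈ fromℕ· p * (t * t) * g
      multiple (divides q ≡.refl) y z = fromℕ· q * (y * z) , (begin
        (q ℕ.* p) · (t * (t * y) * z) ≈⟨ ·≈* (q ℕ.* p) _ ⟩
        fromℕ· (q ℕ.* p) * (t * (t * y) * z) ≈⟨ *-congʳ (×1-homo-* q p) ⟩
        fromℕ· q * fromℕ· p * (t * (t * y) * z)
          ≈⟨ solve 5 (λ Q P t y z → Q :* P :* (t :* (t :* y) :* z) := P :* (t :* t) :* (Q :* (y :* z)))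
               refl (fromℕ· q) (fromℕ· p) t y z ⟩
        fromℕ· p * (t * t) * (fromℕ· q * (y * z)) ∎)

-- Finite types, sums over them and counting.

record Finite (A : Set) : Set where
  field
    size : ℕ
    enum : Fin size ↔ A
    _≟_  : (x y : A) → Dec (x ≡ y)

  element : Fin size → A
  element = Inverse.to enum

  index : A → Fin size
  index = Inverse.from enum

  element-index : ∀ x → element (index x) ≡ x
  element-index = Inverse.strictlyInverseˡ enum

  index-element : ∀ i → index (element i) ≡ i
  index-element = Inverse.strictlyInverseʳ enum

  module _ {P : A → Set} (P? : ∀ x → Dec (P x)) where
    search : Dec (Σ A P)
    search with Finₚ.any? (λ i → P? (element i))
    ... | yes (i , p) = yes (element i , p)
    ... | no ¬p       = no λ (x , p) → ¬p (index x , ≡.subst P (≡.sym (element-index x)) p)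

    search-all : (∀ x → P x) ⊎ Σ A (λ x → ¬ P x)
    search-all with Finₚ.all? (λ i → P? (element i))
    ... | yes p = inj₁ λ x → ≡.subst P (element-index x) (p (index x))
    ... | no ¬p with Finₚ.¬∀⟶∃¬ _ _ (λ i → P? (element i)) ¬p
    ...   | i , ¬q = inj₂ (element i , ¬q)

module FiniteSum (M : CommutativeMonoid 0ℓ 0ℓ) where
  open CommutativeMonoid M
  open Algebra.Properties.CommutativeMonoid.Sum M
  open Algebra.Properties.Monoid.Mult monoid using () renaming (_×_ to _·_)
  open Finite

  opaque
    ∑ : ∀ {A} → Finite A → (A → Carrier) → Carrier
    ∑ A f = sum (λ i → f (element A i))

    ∑-unfold : ∀ {A} (FA : Finite A) f → ∑ FA f ≡ sum (λ i → f (element FA i))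
    ∑-unfold FA f = ≡.refl

  module _ {A : Set} (FA : Finite A) where
   opaque
    unfolding ∑

    ∑-cong : {f g : A → Carrier} → (∀ x → f x ≈ g x) → ∑ FA f ≈ ∑ FA g
    ∑-cong eq = sum-cong-≋ (λ i → eq (element FA i))

    ∑-∙ : ∀ (f g : A → Carrier) → ∑ FA (λ x → f x ∙ g x) ≈ ∑ FA f ∙ ∑ FA g
    ∑-∙ f g = ∑-distrib-+ (λ i → f (element FA i)) (λ i → g (element FA i))

    ∑-const : ∀ c → ∑ FA (λ _ → c) ≈ size FA · c
    ∑-const c = sum-replicate (size FA)

    ∑-ε : {f : A → Carrier} → (∀ x → f x ≈ ε) → ∑ FA f ≈ ε
    ∑-ε eq = trans (∑-cong eq) (sum-replicate-zero (size FA))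

    ∑-swap : ∀ {B} (FB : Finite B) (f : A → B → Carrier) →
             ∑ FA (λ x → ∑ FB (f x)) ≈ ∑ FB (λ y → ∑ FA (λ x → f x y))
    ∑-swap FB f = ∑-comm (λ i j → f (element FA i) (element FB j))

    ∑-bijection : ∀ {B} (FB : Finite B) (φ : A → B) (φ⁻¹ : B → A) →
                  (∀ y → φ (φ⁻¹ y) ≡ y) → (∀ x → φ⁻¹ (φ x) ≡ x) →
                  ∀ f → ∑ FB f ≈ ∑ FA (f ∘ φ)
    ∑-bijection FB φ φ⁻¹ inv₁ inv₂ f = trans (sum-permute (f ∘ element FB) π)
      (sum-cong-≋ {size FA} (λ i → reflexive (≡.cong f (element-index FB (φ (element FA i))))))
      where
      π : Fin (size FA) ↔ Fin (size FB)
      π = mk↔ₛ′ (λ i → index FB (φ (element FA i))) (λ j → index FA (φ⁻¹ (element FB j)))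
        (λ j → ≡.trans (≡.cong (index FB) (≡.trans (≡.cong φ (element-index FA _)) (inv₁ _))) (index-element FB j))
        (λ i → ≡.trans (≡.cong (index FA) (≡.trans (≡.cong φ⁻¹ (element-index FB _)) (inv₂ _))) (index-element FA i))

    private
      sum-single : ∀ {n} (f : Fin n → Carrier) i → (∀ j → j ≢ i → f j ≈ ε) → sum f ≈ f i
      sum-single {suc n} f Fin.zero h =
        trans (∙-congˡ (trans (sum-cong-≋ (λ j → h (Fin.suc j) λ ())) (sum-replicate-zero n))) (identityʳ _)
      sum-single {suc n} f (Fin.suc i) h =
        trans (∙-cong (h Fin.zero λ ()) (sum-single (f ∘ Fin.suc) i (λ j ne → h (Fin.suc j) (ne ∘ Finₚ.suc-injective)))) (identityˡ _)

    ∑-single : ∀ {f : A → Carrier} a → (∀ x → x ≢ a → f x ≈ ε) → ∑ FA f ≈ f a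
    ∑-single {f} a h = trans (sum-single (f ∘ element FA) (index FA a) λ j ne → h _ λ eq →
        ne (≡.trans (≡.sym (index-element FA j)) (≡.cong (index FA) eq)))
      (reflexive (≡.cong f (element-index FA a)))

module SemiringSum (S : CommutativeSemiring 0ℓ 0ℓ) where
  open CommutativeSemiring S
  open FiniteSum +-commutativeMonoid public renaming (∑-∙ to ∑-+; ∑-ε to ∑-zero)
  open Finite
  open Relation.Binary.Reasoning.Setoid setoid

  𝟙 : ∀ {P : Set} → Dec P → Carrier
  𝟙 (yes _) = 1#
  𝟙 (no _)  = 0#

  𝟙-true : ∀ {P : Set} (P? : Dec P) → P → 𝟙 P? ≈ 1#
  𝟙-true (yes _) _ = refl
  𝟙-true (no ¬p) p = ⊥-elim (¬p p)

  𝟙-false : ∀ {P : Set} (P? : Dec P) → ¬ P → 𝟙 P? ≈ 0#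
  𝟙-false (yes p) ¬p = ⊥-elim (¬p p)
  𝟙-false (no _)  _  = refl

  𝟙-⇔ : ∀ {P Q : Set} (P? : Dec P) (Q? : Dec Q) → (P → Q) → (Q → P) → 𝟙 P? ≈ 𝟙 Q?
  𝟙-⇔ (yes p) Q? f g = sym (𝟙-true Q? (f p))
  𝟙-⇔ (no ¬p) Q? f g = sym (𝟙-false Q? (¬p ∘ g))

  module _ {A : Set} (FA : Finite A) where
    open Algebra.Properties.Semiring.Sum semiring using (*-distribˡ-sum; *-distribʳ-sum)

    opaque
      unfolding ∑

      ∑-*ˡ : ∀ c (f : A → Carrier) → c * ∑ FA f ≈ ∑ FA (λ x → c * f x)
      ∑-*ˡ c f = *-distribˡ-sum c (f ∘ element FA)

      ∑-*ʳ : ∀ c (f : A → Carrier) → ∑ FA f * c ≈ ∑ FA (λ x → f x * c)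
      ∑-*ʳ c f = *-distribʳ-sum c (f ∘ element FA)

    ∑-select : ∀ a (f : A → Carrier) → ∑ FA (λ x → 𝟙 (_≟_ FA a x) * f x) ≈ f a
    ∑-select a f = trans (∑-single FA a λ x ne →
        trans (*-congʳ (𝟙-false (_≟_ FA a x) (ne ∘ ≡.sym))) (zeroˡ _))
      (trans (*-congʳ (𝟙-true (_≟_ FA a a) ≡.refl)) (*-identityˡ _))

    ∑-𝟙 : ∀ a → ∑ FA (λ x → 𝟙 (_≟_ FA a x)) ≈ 1#
    ∑-𝟙 a = trans (∑-cong FA (λ x → sym (*-identityʳ _))) (∑-select a (λ _ → 1#))

  ∑-*∑ : ∀ {A B} (FA : Finite A) (FB : Finite B) (f : A → Carrier) (g : B → Carrier) →
         ∑ FA f * ∑ FB g ≈ ∑ FA (λ x → ∑ FB (λ y → f x * g y))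
  ∑-*∑ FA FB f g = trans (∑-*ʳ FA (∑ FB g) f) (∑-cong FA (λ x → ∑-*ˡ FB (f x) g))

  -- This is the passage from E to K, with φ the trace or the norm; with φ a multiplication it
  -- groups a double sum by the value of the product.
  ∑-fibres : ∀ {A B} (FA : Finite A) (FB : Finite B) (φ : A → B) (f : A → Carrier) (g : B → Carrier) →
    ∑ FA (λ x → f x * g (φ x)) ≈ ∑ FB (λ y → ∑ FA (λ x → 𝟙 (_≟_ FB (φ x) y) * f x) * g y)
  ∑-fibres FA FB φ f g = begin
    ∑ FA (λ x → f x * g (φ x))
      ≈⟨ ∑-cong FA (λ x → *-congˡ (sym (∑-select FB (φ x) g))) ⟩
    ∑ FA (λ x → f x * ∑ FB (λ y → 𝟙 (_≟_ FB (φ x) y) * g y))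
      ≈⟨ ∑-cong FA (λ x → trans (∑-*ˡ FB (f x) _) (∑-cong FB (λ y → rearrange x y))) ⟩
    ∑ FA (λ x → ∑ FB (λ y → 𝟙 (_≟_ FB (φ x) y) * f x * g y))
      ≈⟨ ∑-swap FA FB _ ⟩
    ∑ FB (λ y → ∑ FA (λ x → 𝟙 (_≟_ FB (φ x) y) * f x * g y))
      ≈⟨ ∑-cong FB (λ y → sym (∑-*ʳ FA (g y) _)) ⟩
    ∑ FB (λ y → ∑ FA (λ x → 𝟙 (_≟_ FB (φ x) y) * f x) * g y) ∎
    where
    rearrange : ∀ x y → f x * (𝟙 (_≟_ FB (φ x) y) * g y) ≈ 𝟙 (_≟_ FB (φ x) y) * f x * g y
    rearrange x y = trans (sym (*-assoc _ _ _)) (*-congʳ (*-comm _ _))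

module ℕ-Sum where
  open SemiringSum ℕₚ.+-*-commutativeSemiring public
  open Finite

  count : ∀ {A} (FA : Finite A) {P : A → Set} → (∀ x → Dec (P x)) → ℕ
  count FA P? = ∑ FA (λ x → 𝟙 (P? x))

  private
    n·1 : ∀ n c → Algebra.Properties.Monoid.Mult._×_ ℕₚ.+-0-monoid n c ≡ n ℕ.* c
    n·1 zero    c = ≡.refl
    n·1 (suc n) c = ≡.cong (c ℕ.+_) (n·1 n c)

    sum : ∀ {n} → (Fin n → ℕ) → ℕ
    sum = Algebra.Properties.CommutativeMonoid.Sum.sum ℕₚ.+-0-commutativeMonoid

    sum-mono : ∀ {n} {f g : Fin n → ℕ} → (∀ i → f i ℕ.≤ g i) → sum f ℕ.≤ sum g
    sum-mono {zero}  h = z≤n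
    sum-mono {suc n} h = ℕₚ.+-mono-≤ (h Fin.zero) (sum-mono (h ∘ Fin.suc))

    sum-squeeze : ∀ {n} {f g : Fin n → ℕ} → (∀ i → f i ℕ.≤ g i) → sum g ℕ.≤ sum f → ∀ i → f i ≡ g i
    sum-squeeze {suc n} {f} {g} h le i with ℕₚ.m≤n⇒m<n∨m≡n (h Fin.zero)
    ... | inj₁ lt = ⊥-elim (ℕₚ.<⇒≱ (ℕₚ.+-mono-<-≤ lt (sum-mono (h ∘ Fin.suc))) le)
    sum-squeeze {suc n} {f} {g} h le Fin.zero    | inj₂ eq = eq
    sum-squeeze {suc n} {f} {g} h le (Fin.suc i) | inj₂ eq = sum-squeeze (h ∘ Fin.suc)
      (ℕₚ.+-cancelˡ-≤ (f Fin.zero) _ _ (≡.subst (λ k → k ℕ.+ _ ℕ.≤ _) (≡.sym eq) le)) i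

  module _ {A : Set} (FA : Finite A) where

    ∑-constant : ∀ c → ∑ FA (λ _ → c) ≡ size FA ℕ.* c
    ∑-constant c = ≡.trans (∑-const FA c) (n·1 (size FA) c)

    opaque
      unfolding ∑

      ∑-mono : {f g : A → ℕ} → (∀ x → f x ℕ.≤ g x) → ∑ FA f ℕ.≤ ∑ FA g
      ∑-mono h = sum-mono (h ∘ element FA)

      -- A strict inequality at one place could not be made up elsewhere. Exact counts are obtained
      -- in this way from a one-sided bound and a total: fibres of the trace, roots of quadratics,
      -- lines through a point.
      ∑-squeeze : {f g : A → ℕ} → (∀ x → f x ℕ.≤ g x) → ∑ FA g ℕ.≤ ∑ FA f → ∀ x → f x ≡ g x
      ∑-squeeze {f} {g} h le x = ≡.subst (λ x → f x ≡ g x) (element-index FA x)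
        (sum-squeeze (h ∘ element FA) le (index FA x))

    module _ {P : A → Set} (P? : ∀ x → Dec (P x)) where

      count-none : (∀ x → ¬ P x) → count FA P? ≡ 0
      count-none h = ∑-zero FA (λ x → 𝟙-false (P? x) (h x))

      count-one : ∀ a → P a → (∀ x → P x → x ≡ a) → count FA P? ≡ 1
      count-one a pa h = ≡.trans (∑-single FA a (λ x ne → 𝟙-false (P? x) (ne ∘ h x))) (𝟙-true (P? a) pa)

      count-≤1 : (∀ x y → P x → P y → x ≡ y) → count FA P? ℕ.≤ 1
      count-≤1 h with search FA P?
      ... | yes (a , pa) = ℕₚ.≤-reflexive (count-one a pa (λ x px → h x a px pa))
      ... | no none      = ≡.subst (ℕ._≤ 1) (≡.sym (count-none (λ x p → none (x , p)))) z≤n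

      count-≤2 : ∀ u v → (∀ x → P x → u ≡ x ⊎ v ≡ x) → count FA P? ℕ.≤ 2
      count-≤2 u v h = ℕₚ.≤-trans (∑-mono pointwise)
        (ℕₚ.≤-reflexive (≡.trans (∑-+ FA _ _) (≡.cong₂ ℕ._+_ (∑-𝟙 FA u) (∑-𝟙 FA v))))
        where
        pointwise : ∀ x → 𝟙 (P? x) ℕ.≤ 𝟙 (_≟_ FA u x) ℕ.+ 𝟙 (_≟_ FA v x)
        pointwise x with P? x
        ... | no _ = z≤n
        ... | yes p with h x p
        ...   | inj₁ eq = ℕₚ.≤-trans (ℕₚ.≤-reflexive (≡.sym (𝟙-true (_≟_ FA u x) eq))) (ℕₚ.m≤m+n _ _)
        ...   | inj₂ eq = ℕₚ.≤-trans (ℕₚ.≤-reflexive (≡.sym (𝟙-true (_≟_ FA v x) eq))) (ℕₚ.m≤n+m _ _)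

      -- The pairs (b, a) with g b = a are counted by b and then by a: an element a has at most one
      -- b, and none unless P a holds.
      count-injection : ∀ {B} (FB : Finite B) (g : B → A) → (∀ x y → g x ≡ g y → x ≡ y) →
                        (∀ b → P (g b)) → size FB ℕ.≤ count FA P?
      count-injection FB g inj pg = begin
        size FB                                             ≡⟨ ≡.sym (ℕₚ.*-identityʳ _) ⟩
        size FB ℕ.* 1                                       ≡⟨ ≡.sym (≡.trans (∑-const FB 1) (n·1 (size FB) 1)) ⟩
        ∑ FB (λ b → 1)                                      ≡⟨ ∑-cong FB (λ b → ≡.sym (∑-𝟙 FA (g b))) ⟩
        ∑ FB (λ b → ∑ FA (λ a → 𝟙 (_≟_ FA (g b) a)))        ≡⟨ ∑-swap FB FA _ ⟩
        ∑ FA (λ a → ∑ FB (λ b → 𝟙 (_≟_ FA (g b) a)))        ≤⟨ ∑-mono pointwise ⟩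
        count FA P?                                         ∎
        where
        open ℕₚ.≤-Reasoning
        pointwise : ∀ a → ∑ FB (λ b → 𝟙 (_≟_ FA (g b) a)) ℕ.≤ 𝟙 (P? a)
        pointwise a with P? a
        ... | no ¬p = ℕₚ.≤-reflexive (∑-zero FB (λ b → 𝟙-false (_≟_ FA (g b) a) λ eq → ¬p (≡.subst P eq (pg b))))
        ... | yes p with search FB (λ b → _≟_ FA (g b) a)
        ...   | no none = ≡.subst (ℕ._≤ 1) (≡.sym (∑-zero FB (λ b → 𝟙-false (_≟_ FA (g b) a) λ eq → none (b , eq)))) z≤n
        ...   | yes (b₀ , eq₀) = ℕₚ.≤-reflexive (≡.trans
                  (∑-single FB b₀ (λ b ne → 𝟙-false (_≟_ FA (g b) a) λ eq → ne (inj _ _ (≡.trans eq (≡.sym eq₀)))))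
                  (𝟙-true (_≟_ FA (g b₀) a) eq₀))

    count-mono : {P Q : A → Set} (P? : ∀ x → Dec (P x)) (Q? : ∀ x → Dec (Q x)) →
                 (∀ x → P x → Q x) → count FA P? ℕ.≤ count FA Q?
    count-mono P? Q? h = ∑-mono pointwise
      where
      pointwise : ∀ x → 𝟙 (P? x) ℕ.≤ 𝟙 (Q? x)
      pointwise x with P? x
      ... | no _  = z≤n
      ... | yes p = ℕₚ.≤-reflexive (≡.sym (𝟙-true (Q? x) (h x p)))

  private
    countFin : ∀ {n} {P : Fin n → Set} → (∀ i → Dec (P i)) → ℕ
    countFin P? = sum (λ i → 𝟙 (P? i))

    -- The assumption of proof irrelevance makes a pair determined by its first component; several
    -- proofs of one P i would give more pairs than the count.
    enumSubset : ∀ n (P : Fin n → Set) (P? : ∀ i → Dec (P i)) → (∀ i (p q : P i) → p ≡ q) →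
                 Fin (countFin P?) ↔ Σ (Fin n) P
    enumSubset zero P P? irr = mk↔ₛ′ (λ ()) (λ ()) (λ ()) (λ ())
    enumSubset (suc n) P P? irr with P? Fin.zero | enumSubset n (P ∘ Fin.suc) (P? ∘ Fin.suc) (irr ∘ Fin.suc)
    ... | no ¬p | e = mk↔ₛ′ (λ i → shift (to i)) unshift shift-unshift (λ i → strictlyInverseʳ i)
      where
      open Inverse e
      shift : Σ (Fin n) (P ∘ Fin.suc) → Σ (Fin (suc n)) P
      shift (i , p) = Fin.suc i , p
      unshift : Σ (Fin (suc n)) P → Fin (countFin (P? ∘ Fin.suc))
      unshift (Fin.zero  , p) = ⊥-elim (¬p p)
      unshift (Fin.suc i , p) = from (i , p)
      shift-unshift : ∀ x → shift (to (unshift x)) ≡ x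
      shift-unshift (Fin.zero  , p) = ⊥-elim (¬p p)
      shift-unshift (Fin.suc i , p) = ≡.cong shift (strictlyInverseˡ (i , p))
    ... | yes p₀ | e = mk↔ₛ′ shift unshift shift-unshift unshift-shift
      where
      open Inverse e
      suc′ : Σ (Fin n) (P ∘ Fin.suc) → Σ (Fin (suc n)) P
      suc′ (i , p) = Fin.suc i , p
      shift : Fin (suc (countFin (P? ∘ Fin.suc))) → Σ (Fin (suc n)) P
      shift Fin.zero    = Fin.zero , p₀
      shift (Fin.suc i) = suc′ (to i)
      unshift : Σ (Fin (suc n)) P → Fin (suc (countFin (P? ∘ Fin.suc)))
      unshift (Fin.zero  , p) = Fin.zero
      unshift (Fin.suc i , p) = Fin.suc (from (i , p))
      shift-unshift : ∀ x → shift (unshift x) ≡ x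
      shift-unshift (Fin.zero  , p) = ≡.cong (Fin.zero ,_) (irr Fin.zero p₀ p)
      shift-unshift (Fin.suc i , p) = ≡.cong suc′ (strictlyInverseˡ (i , p))
      unshift-shift : ∀ i → unshift (shift i) ≡ i
      unshift-shift Fin.zero    = ≡.refl
      unshift-shift (Fin.suc i) = ≡.cong Fin.suc (strictlyInverseʳ i)

  module _ {A : Set} (FA : Finite A) {P : A → Set} (P? : ∀ x → Dec (P x))
           (irr : ∀ x (p q : P x) → p ≡ q) where

    subset : Finite (Σ A P)
    subset = record
      { size = count FA P?
      ; enum = ≡.subst (λ k → Fin k ↔ Σ A P) (≡.sym (∑-unfold FA (λ x → 𝟙 (P? x))))
          (mk↔ₛ′ (λ i → unindexed (to i)) (λ x → from (indexed x))
            (λ x → ≡.trans (≡.cong unindexed (strictlyInverseˡ (indexed x))) (unindexed-indexed x))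
            (λ i → ≡.trans (≡.cong from (indexed-unindexed (to i))) (strictlyInverseʳ i)))
      ; _≟_ = λ x y → Dec.map′ subset-≡ (≡.cong proj₁) (_≟_ FA (proj₁ x) (proj₁ y))
      }
      where
      open Inverse (enumSubset (size FA) (P ∘ element FA) (P? ∘ element FA) (irr ∘ element FA))
      subset-≡ : {x y : Σ A P} → proj₁ x ≡ proj₁ y → x ≡ y
      subset-≡ {x , p} {_ , q} ≡.refl = ≡.cong (x ,_) (irr x p q)
      subset-≡′ : {x y : Σ (Fin (size FA)) (P ∘ element FA)} → proj₁ x ≡ proj₁ y → x ≡ y
      subset-≡′ {x , p} {_ , q} ≡.refl = ≡.cong (x ,_) (irr _ p q)
      unindexed : Σ (Fin (size FA)) (P ∘ element FA) → Σ A P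
      unindexed (i , p) = element FA i , p
      indexed : Σ A P → Σ (Fin (size FA)) (P ∘ element FA)
      indexed (x , p) = index FA x , ≡.subst P (≡.sym (element-index FA x)) p
      unindexed-indexed : ∀ x → unindexed (indexed x) ≡ x
      unindexed-indexed (x , p) = subset-≡ (element-index FA x)
      indexed-unindexed : ∀ x → indexed (unindexed x) ≡ x
      indexed-unindexed (i , p) = subset-≡′ (index-element FA i)

    count-choose : ∀ {k} → k ℕ.≤ count FA P? →
      Σ (Fin k → A) λ g → (∀ i j → g i ≡ g j → i ≡ j) × (∀ i → P (g i))
    count-choose {k} k≤ = (λ i → proj₁ (h i)) , inj , (λ i → proj₂ (h i))
      where
      h : Fin k → Σ A P
      h i = element subset (Fin.inject≤ i k≤)
      h-injective : ∀ i j → h i ≡ h j → i ≡ j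
      h-injective i j eq = Finₚ.inject≤-injective k≤ k≤ i j
        (≡.trans (≡.sym (index-element subset _)) (≡.trans (≡.cong (index subset) eq) (index-element subset _)))
      inj : ∀ i j → proj₁ (h i) ≡ proj₁ (h j) → i ≡ j
      inj i j eq = h-injective i j (lift (h i) (h j) eq)
        where
        lift : (x y : Σ A P) → proj₁ x ≡ proj₁ y → x ≡ y
        lift (x , p) (_ , q) ≡.refl = ≡.cong (x ,_) (irr x p q)

module FiniteSumHomomorphism (R : CommutativeRing 0ℓ 0ℓ) where
  open RingProperties R
  private
    module S = SemiringSum commutativeSemiring
    module N = ℕ-Sum
  open Finite

  fromℕ·-𝟙 : ∀ {P : Set} (P? : Dec P) → fromℕ· (N.𝟙 P?) ≈ S.𝟙 P?
  fromℕ·-𝟙 (yes _) = +-identityʳ 1#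
  fromℕ·-𝟙 (no _)  = refl

  fromℕ·-∑ : ∀ {A} (FA : Finite A) f → fromℕ· (N.∑ FA f) ≈ S.∑ FA (fromℕ· ∘ f)
  fromℕ·-∑ FA f rewrite N.∑-unfold FA f | S.∑-unfold FA (fromℕ· ∘ f) = go (f ∘ element FA)
    where
    go : ∀ {n} (g : Fin n → ℕ) →
      fromℕ· (Algebra.Properties.CommutativeMonoid.Sum.sum ℕₚ.+-0-commutativeMonoid g) ≈ sum (fromℕ· ∘ g)
    go {zero}  g = refl
    go {suc n} g = trans (×-homo-+ 1# (g Fin.zero) _) (+-congˡ (go (g ∘ Fin.suc)))

-- Finite fields: Fermat's theorem and polynomial functions.

fieldRing : FiniteField → CommutativeRing 0ℓ 0ℓ
fieldRing F = record { isCommutativeRing = FiniteField.isCommutativeRing F }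

module FieldProperties (F : FiniteField) where
  open RingProperties (fieldRing F) public
    hiding (refl; sym; trans; reflexive; _≈_; setoid; isEquivalence)
  open FiniteField F public using (Carrier; size; _^F_; _•_; 1≢0; _≟F_) renaming (inverse to inverse-of)
  open ≡ using (refl; sym; trans; cong; cong₂; subst)

  finite : Finite Carrier
  finite = record { size = size ; enum = FiniteField.enum F ; _≟_ = _≟F_ }

  open SemiringSum commutativeSemiring public

  irrelevant : {x y : Carrier} (p q : x ≡ y) → p ≡ q
  irrelevant = Decidable⇒UIP.≡-irrelevant _≟F_

  ^F≡^ : ∀ x n → x ^F n ≡ x ^ n
  ^F≡^ x zero    = refl
  ^F≡^ x (suc n) = cong (x *_) (^F≡^ x n)

  •≡· : ∀ n x → n • x ≡ n · x
  •≡· zero    x = refl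
  •≡· (suc n) x = cong (λ z → x + z) (•≡· n x)

  _⁻¹⟨_⟩ : ∀ x → x ≢ 0# → Carrier
  x ⁻¹⟨ ne ⟩ = proj₁ (inverse-of x ne)

  x*x⁻¹ : ∀ {x} (ne : x ≢ 0#) → x * x ⁻¹⟨ ne ⟩ ≡ 1#
  x*x⁻¹ ne = proj₂ (inverse-of _ ne)

  x⁻¹*x : ∀ {x} (ne : x ≢ 0#) → x ⁻¹⟨ ne ⟩ * x ≡ 1#
  x⁻¹*x ne = trans (*-comm _ _) (x*x⁻¹ ne)

  x*[x⁻¹*y] : ∀ {x} (ne : x ≢ 0#) y → x * (x ⁻¹⟨ ne ⟩ * y) ≡ y
  x*[x⁻¹*y] ne y = trans (sym (*-assoc _ _ y)) (trans (cong (_* y) (x*x⁻¹ ne)) (*-identityˡ y))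

  x⁻¹*[x*y] : ∀ {x} (ne : x ≢ 0#) y → x ⁻¹⟨ ne ⟩ * (x * y) ≡ y
  x⁻¹*[x*y] ne y = trans (sym (*-assoc _ _ y)) (trans (cong (_* y) (x⁻¹*x ne)) (*-identityˡ y))

  [y*x⁻¹]*x : ∀ {x} (ne : x ≢ 0#) y → y * x ⁻¹⟨ ne ⟩ * x ≡ y
  [y*x⁻¹]*x ne y = trans (*-assoc y _ _) (trans (cong (y *_) (x⁻¹*x ne)) (*-identityʳ y))

  [y*x]*x⁻¹ : ∀ {x} (ne : x ≢ 0#) y → y * x * x ⁻¹⟨ ne ⟩ ≡ y
  [y*x]*x⁻¹ ne y = trans (*-assoc y _ _) (trans (cong (y *_) (x*x⁻¹ ne)) (*-identityʳ y))

  *-cancelˡ : ∀ {x y z} → x ≢ 0# → x * y ≡ x * z → y ≡ z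
  *-cancelˡ {x} {y} {z} ne eq =
    trans (sym (x⁻¹*[x*y] ne y)) (trans (cong (x ⁻¹⟨ ne ⟩ *_) eq) (x⁻¹*[x*y] ne z))

  *-cancelʳ : ∀ {x y z} → x ≢ 0# → y * x ≡ z * x → y ≡ z
  *-cancelʳ ne eq = *-cancelˡ ne (trans (*-comm _ _) (trans eq (*-comm _ _)))

  x*y≡0 : ∀ {x y} → x * y ≡ 0# → x ≡ 0# ⊎ y ≡ 0#
  x*y≡0 {x} {y} eq with x ≟F 0#
  ... | yes x≡0 = inj₁ x≡0
  ... | no  x≢0 = inj₂ (*-cancelˡ x≢0 (trans eq (sym (zeroʳ x))))

  x*x≡0⇒x≡0 : ∀ {x} → x * x ≡ 0# → x ≡ 0#
  x*x≡0⇒x≡0 eq with x*y≡0 eq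
  ... | inj₁ x≡0 = x≡0
  ... | inj₂ x≡0 = x≡0

  -- Both x and y are roots of one polynomial X^2 - t X + c, and (y - x)(t - y - x) is the
  -- difference of the two sides.
  quadratic-roots : ∀ {t x y} → x * (t - x) ≡ y * (t - y) → y ≡ x ⊎ t - y ≡ x
  quadratic-roots {t} {x} {y} eq = Sum.map x-y≈0⇒x≈y x-y≈0⇒x≈y (x*y≡0 (trans
    (solve 3 (λ t x y → (y :- x) :* (t :- y :- x) := y :* (t :- y) :- x :* (t :- x)) refl t x y)
    (x≈y⇒x-y≈0 (sym eq))))
    where open Solver

  *-nonzero : ∀ {x y} → x ≢ 0# → y ≢ 0# → x * y ≢ 0#
  *-nonzero x≢0 y≢0 eq with x*y≡0 eq
  ... | inj₁ x≡0 = x≢0 x≡0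
  ... | inj₂ y≡0 = y≢0 y≡0

  ⁻¹-nonzero : ∀ {x} (ne : x ≢ 0#) → x ⁻¹⟨ ne ⟩ ≢ 0#
  ⁻¹-nonzero {x} ne eq = 1≢0 (trans (sym (x*x⁻¹ ne)) (trans (cong (x *_) eq) (zeroʳ x)))

  ^-nonzero : ∀ {x} n → x ≢ 0# → x ^ n ≢ 0#
  ^-nonzero zero    ne = 1≢0
  ^-nonzero (suc n) ne = *-nonzero ne (^-nonzero n ne)

  x^n≡0⇒x≡0 : ∀ {x} n → x ^ n ≡ 0# → x ≡ 0#
  x^n≡0⇒x≡0 {x} n eq with x ≟F 0#
  ... | yes x≡0 = x≡0
  ... | no x≢0  = ⊥-elim (^-nonzero n x≢0 eq)

  0^ : ∀ n .{{_ : NonZero n}} → 0# ^ n ≡ 0#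
  0^ (suc n) = zeroˡ _

  x-y≢0 : ∀ {x y} → x ≢ y → x - y ≢ 0#
  x-y≢0 ne eq = ne (x-y≈0⇒x≈y eq)

  size-pred : Σ ℕ λ n → size ≡ suc n
  size-pred with size | Finite.index finite 0#
  ... | suc n | _ = n , refl

  private
    module Π = FiniteSum *-commutativeMonoid

  -- The product of the nonzero elements is invariant under multiplication by a. To run it over the
  -- whole field, `h` replaces 0 by 1; `k x` is the factor between `h x` and `h (a * x)`, and `m`
  -- completes `k` to the constant a, so that it differs from 1 only at 0. Then the product of all
  -- `k` is 1 and that of all `m` is a.
  x^size≡x : ∀ x → x ^ size ≡ x
  x^size≡x a with a ≟F 0#
  ... | yes refl = subst (λ n → 0# ^ n ≡ 0#) (sym (proj₂ size-pred)) (zeroˡ _)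
  ... | no  a≢0  = begin
    a ^ size                         ≡⟨ Π.∑-const finite a ⟨
    Π.∑ finite (λ _ → a)             ≡⟨ Π.∑-cong finite k*m ⟨
    Π.∑ finite (λ x → k x * m x)     ≡⟨ Π.∑-∙ finite k m ⟩
    Π.∑ finite k * Π.∑ finite m      ≡⟨ cong₂ _*_ Πk≡1 Πm≡a ⟩
    1# * a                           ≡⟨ *-identityˡ a ⟩
    a                                ∎
    where
    open ≡.≡-Reasoning
    k m h : Carrier → Carrier
    k x with x ≟F 0#
    ... | yes _ = 1#
    ... | no  _ = a
    m x with x ≟F 0#
    ... | yes _ = a
    ... | no  _ = 1#
    h x with x ≟F 0#
    ... | yes _ = 1#
    ... | no  _ = x
    h≢0 : ∀ x → h x ≢ 0#
    h≢0 x with x ≟F 0#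
    ... | yes _  = 1≢0
    ... | no x≢0 = x≢0
    k*m : ∀ x → k x * m x ≡ a
    k*m x with x ≟F 0#
    ... | yes _ = *-identityˡ a
    ... | no  _ = *-identityʳ a
    h∘a : ∀ x → h (a * x) ≡ k x * h x
    h∘a x with x ≟F 0# | (a * x) ≟F 0#
    ... | yes _    | yes _    = sym (*-identityˡ 1#)
    ... | yes refl | no ne    = ⊥-elim (ne (zeroʳ a))
    ... | no x≢0   | yes ax≡0 = ⊥-elim (*-nonzero a≢0 x≢0 ax≡0)
    ... | no _     | no _     = refl
    Πm≡a : Π.∑ finite m ≡ a
    Πm≡a = trans (Π.∑-single finite 0# m≡1) m0
      where
      m≡1 : ∀ x → x ≢ 0# → m x ≡ 1#
      m≡1 x ne with x ≟F 0#
      ... | yes eq = ⊥-elim (ne eq)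
      ... | no _   = refl
      m0 : m 0# ≡ a
      m0 with 0# ≟F 0#
      ... | yes _ = refl
      ... | no ne = ⊥-elim (ne refl)
    P P⁻¹ : Carrier
    P   = Π.∑ finite h
    P⁻¹ = Π.∑ finite (λ x → h x ⁻¹⟨ h≢0 x ⟩)
    P*P⁻¹ : P * P⁻¹ ≡ 1#
    P*P⁻¹ = trans (sym (Π.∑-∙ finite h _)) (Π.∑-ε finite (λ x → x*x⁻¹ (h≢0 x)))
    P≢0 : P ≢ 0#
    P≢0 eq = 1≢0 (trans (sym P*P⁻¹) (trans (cong (_* P⁻¹) eq) (zeroˡ _)))
    kP≡P : Π.∑ finite k * P ≡ P
    kP≡P = begin
      Π.∑ finite k * P              ≡⟨ Π.∑-∙ finite k h ⟨
      Π.∑ finite (λ x → k x * h x)  ≡⟨ Π.∑-cong finite h∘a ⟨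
      Π.∑ finite (λ x → h (a * x))  ≡⟨ Π.∑-bijection finite finite (a *_) (a ⁻¹⟨ a≢0 ⟩ *_)
           (x*[x⁻¹*y] a≢0) (x⁻¹*[x*y] a≢0) h ⟨
      P                             ∎
    Πk≡1 : Π.∑ finite k ≡ 1#
    Πk≡1 = *-cancelʳ P≢0 (trans kP≡P (sym (*-identityˡ P)))

  x^[size-1]≡1 : ∀ {x} → x ≢ 0# → x ^ (size ℕ.∸ 1) ≡ 1#
  x^[size-1]≡1 {x} ne with size | size-pred | x^size≡x x
  ... | _ | n , refl | eq = *-cancelˡ ne (trans eq (sym (*-identityʳ x)))

  eval : ℕ → (ℕ → Carrier) → Carrier → Carrier
  eval zero    c x = 0#
  eval (suc n) c x = c 0 + x * eval n (c ∘ suc) x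

  private
    -- Synthetic division by X - r: the coefficient at i is the value at r of the tail c (i + 1), c
    -- (i + 2), and so on.
    quotient : ℕ → (ℕ → Carrier) → Carrier → ℕ → Carrier
    quotient zero    c r i       = 0#
    quotient (suc n) c r zero    = eval (suc n) (c ∘ suc) r
    quotient (suc n) c r (suc i) = quotient n (c ∘ suc) r i

    division : ∀ n c r x → eval (suc n) c x ≡ eval (suc n) c r + (x - r) * eval n (quotient n c r) x
    division zero c r x =
      solve 3 (λ c r x → c :+ x :* con ℤ.0ℤ := c :+ r :* con ℤ.0ℤ :+ (x :- r) :* con ℤ.0ℤ) refl (c 0) r x
      where open Solver
            import Data.Integer as ℤ
    division (suc n) c r x = trans (cong (λ e → c 0 + x * e) (division n (c ∘ suc) r x))
      (solve 5 (λ c r x p q → c :+ x :* (p :+ (x :- r) :* q) := (c :+ r :* p) :+ (x :- r) :* (p :+ x :* q)) refl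
        (c 0) r x (eval (suc n) (c ∘ suc) r) (eval n (quotient n (c ∘ suc) r) x))
      where open Solver

    quotient≡0 : ∀ n c r → (∀ {i} → i ℕ.< n → quotient n c r i ≡ 0#) → eval (suc n) c r ≡ 0# →
                 ∀ {i} → i ℕ.< suc n → c i ≡ 0#
    quotient≡0 zero    c r q e {zero}  _       = trans (sym (trans (cong (λ z → c 0 + z) (zeroʳ r)) (+-identityʳ _))) e
    quotient≡0 zero    c r q e {suc i} (s≤s ())
    quotient≡0 (suc n) c r q e {zero}  _       =
      trans (sym (trans (cong (λ z → c 0 + z) (trans (cong (r *_) (q (s≤s z≤n))) (zeroʳ r))) (+-identityʳ _))) e
    quotient≡0 (suc n) c r q e {suc i} (s≤s l) = quotient≡0 n (c ∘ suc) r (q ∘ s≤s) (q (s≤s z≤n)) l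

  -- Dividing by X - r at the first root r leaves a quotient with one coefficient fewer, which still
  -- vanishes at the other roots because they differ from r.
  eval-vanishes : ∀ n c (x : Fin n → Carrier) → (∀ i j → x i ≡ x j → i ≡ j) →
                  (∀ i → eval n c (x i) ≡ 0#) → ∀ {i} → i ℕ.< n → c i ≡ 0#
  eval-vanishes (suc n) c x inj e = quotient≡0 n c r (eval-vanishes n (quotient n c r) (x ∘ Fin.suc)
      (λ i j eq → Finₚ.suc-injective (inj _ _ eq)) root) (e Fin.zero)
    where
    r = x Fin.zero
    root : ∀ i → eval n (quotient n c r) (x (Fin.suc i)) ≡ 0#
    root i with x*y≡0 (begin
        (x (Fin.suc i) - r) * Q          ≡⟨ +-identityˡ _ ⟨
        0# + (x (Fin.suc i) - r) * Q     ≡⟨ cong (_+ (x (Fin.suc i) - r) * Q) (e Fin.zero) ⟨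
        eval (suc n) c r + (x (Fin.suc i) - r) * Q ≡⟨ division n c r (x (Fin.suc i)) ⟨
        eval (suc n) c (x (Fin.suc i))   ≡⟨ e (Fin.suc i) ⟩
        0#                               ∎)
      where
      open ≡.≡-Reasoning
      Q = eval n (quotient n c r) (x (Fin.suc i))
    ... | inj₂ eq = eq
    ... | inj₁ eq with () ← inj (Fin.suc i) Fin.zero (x-y≈0⇒x≈y eq)

  -- Coefficients are kept next to the function they define, so that a sparse polynomial with
  -- variable exponents can be evaluated as a function and also inspected at a single coefficient.
  record Polynomial (n : ℕ) : Set where
    field
      coefficient : ℕ → Carrier
      function    : Carrier → Carrier
      evaluation  : ∀ x → eval n coefficient x ≡ function x
  open Polynomial public

  δ : ℕ → ℕ → Carrier
  δ k i = 𝟙 (k ℕ.≟ i)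

  private
    eval-0 : ∀ n c x → (∀ i → c i ≡ 0#) → eval n c x ≡ 0#
    eval-0 zero    c x h = refl
    eval-0 (suc n) c x h = trans (cong₂ (λ a b → a + x * b) (h 0) (eval-0 n (c ∘ suc) x (h ∘ suc)))
      (trans (+-identityˡ _) (zeroʳ x))

    eval-cong : ∀ n {c d} x → (∀ i → c i ≡ d i) → eval n c x ≡ eval n d x
    eval-cong zero    x h = refl
    eval-cong (suc n) x h = cong₂ (λ a b → a + x * b) (h 0) (eval-cong n x (h ∘ suc))

    eval-+ : ∀ n c d x → eval n (λ i → c i + d i) x ≡ eval n c x + eval n d x
    eval-+ zero    c d x = sym (+-identityˡ _)
    eval-+ (suc n) c d x = trans (cong (λ e → c 0 + d 0 + x * e) (eval-+ n (c ∘ suc) (d ∘ suc) x))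
      (solve 5 (λ a b x e f → a :+ b :+ x :* (e :+ f) := (a :+ x :* e) :+ (b :+ x :* f)) refl
        (c 0) (d 0) x (eval n (c ∘ suc) x) (eval n (d ∘ suc) x))
      where open Solver

    eval-* : ∀ n a c x → eval n (λ i → a * c i) x ≡ a * eval n c x
    eval-* zero    a c x = sym (zeroʳ a)
    eval-* (suc n) a c x = trans (cong (λ e → a * c 0 + x * e) (eval-* n a (c ∘ suc) x))
      (solve 4 (λ a c x e → a :* c :+ x :* (a :* e) := a :* (c :+ x :* e)) refl a (c 0) x (eval n (c ∘ suc) x))
      where open Solver

    eval-δ : ∀ n k x → k ℕ.< n → eval n (δ k) x ≡ x ^ k
    eval-δ (suc n) zero    x _       = trans (cong (λ e → 1# + x * e) (eval-0 n (δ 0 ∘ suc) x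
        (λ i → 𝟙-false (0 ℕ.≟ suc i) λ ()))) (trans (cong (λ z → 1# + z) (zeroʳ x)) (+-identityʳ _))
    eval-δ (suc n) (suc k) x (s≤s l) = trans (cong₂ (λ a e → a + x * e) (𝟙-false (suc k ℕ.≟ 0) λ ())
        (trans (eval-cong n x (λ i → 𝟙-⇔ (suc k ℕ.≟ suc i) (k ℕ.≟ i) ℕₚ.suc-injective (cong suc))) (eval-δ n k x l)))
      (+-identityˡ _)

  X^ : ∀ {n} k → k ℕ.< n → Polynomial n
  X^ {n} k k<n = record { coefficient = δ k ; function = _^ k ; evaluation = λ x → eval-δ n k x k<n }

  infixl 6 _⊕_
  infixl 7 _⊛_

  _⊕_ : ∀ {n} → Polynomial n → Polynomial n → Polynomial n
  _⊕_ {n} P Q = record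
    { coefficient = λ i → coefficient P i + coefficient Q i
    ; function    = λ x → function P x + function Q x
    ; evaluation  = λ x → trans (eval-+ n (coefficient P) (coefficient Q) x) (cong₂ _+_ (evaluation P x) (evaluation Q x))
    }

  _⊛_ : ∀ {n} → Carrier → Polynomial n → Polynomial n
  _⊛_ {n} a P = record
    { coefficient = λ i → a * coefficient P i
    ; function    = λ x → a * function P x
    ; evaluation  = λ x → trans (eval-* n a (coefficient P) x) (cong (a *_) (evaluation P x))
    }

  polynomial-identity : (P : Polynomial size) → (∀ x → function P x ≡ 0#) →
                        ∀ {i} → i ℕ.< size → coefficient P i ≡ 0#
  polynomial-identity P h = eval-vanishes size (coefficient P) (Finite.element finite)
    (λ i j eq → trans (sym (Finite.index-element finite i)) (trans (cong (Finite.index finite) eq) (Finite.index-element finite j)))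
    (λ i → trans (evaluation P _) (h _))

  roots-≤ : ∀ {n} (P : Polynomial (suc n)) → coefficient P n ≢ 0# →
            ℕ-Sum.count finite (λ x → function P x ≟F 0#) ℕ.≤ n
  roots-≤ {n} P ne = ℕₚ.≮⇒≥ λ n<count →
    let g , inj , root = ℕ-Sum.count-choose finite (λ x → function P x ≟F 0#) (λ _ → irrelevant) n<count
    in ne (eval-vanishes (suc n) (coefficient P) g inj (λ i → trans (evaluation P _) (root i)) ℕₚ.≤-refl)

  -- A root count for X^Q + s X - t. With s = 1 it bounds the fibres of the trace, with s = -1 and t
  -- = 0 the fixed points of a Frobenius map.
  frobenius-fibre-≤ : ∀ Q → 1 ℕ.< Q → ∀ s t →
    ℕ-Sum.count finite (λ x → (x ^ Q + s * x) ≟F t) ℕ.≤ Q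
  frobenius-fibre-≤ Q 1<Q s t = ℕₚ.≤-trans
    (ℕ-Sum.count-mono finite (λ x → (x ^ Q + s * x) ≟F t) (λ x → function P x ≟F 0#) λ x eq →
      trans (cong (λ b → x ^ Q + s * b + (- t) * 1#) (*-identityʳ x))
        (trans (cong (_+ (- t) * 1#) eq) (trans (cong (λ z → t + z) (*-identityʳ (- t))) (-‿inverseʳ t))))
    (roots-≤ P λ eq → 1≢0 (trans (sym leading) eq))
    where
    P : Polynomial (suc Q)
    P = X^ Q ℕₚ.≤-refl ⊕ s ⊛ X^ 1 (ℕₚ.m≤n⇒m≤1+n 1<Q) ⊕ (- t) ⊛ X^ 0 (s≤s z≤n)
    leading : coefficient P Q ≡ 1#
    leading = begin
      δ Q Q + s * δ 1 Q + (- t) * δ 0 Q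
        ≡⟨ cong₂ (λ a b → a + s * b + (- t) * δ 0 Q) (𝟙-true (Q ℕ.≟ Q) refl) (𝟙-false (1 ℕ.≟ Q) (ℕₚ.<⇒≢ 1<Q)) ⟩
      1# + s * 0# + (- t) * δ 0 Q
        ≡⟨ cong (λ b → 1# + s * 0# + (- t) * b) (𝟙-false (0 ℕ.≟ Q) (ℕₚ.<⇒≢ (ℕₚ.<-trans (s≤s z≤n) 1<Q))) ⟩
      1# + s * 0# + (- t) * 0#
        ≡⟨ cong₂ (λ a b → 1# + a + b) (zeroʳ s) (zeroʳ (- t)) ⟩
      1# + 0# + 0#
        ≡⟨ trans (+-identityʳ _) (+-identityʳ _) ⟩
      1# ∎
      where open ≡.≡-Reasoning

-- Characteristic p and the Frobenius map.

module Characteristic (F : FiniteField) {p : ℕ} (pr : Prime p)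
                      (charp : FiniteField._•_ F p (FiniteField.1# F) ≡ FiniteField.0# F) where
  open FieldProperties F
  open ≡ using (refl; sym; trans; cong; cong₂; subst)

  p·1≡0 : fromℕ· p ≡ 0#
  p·1≡0 = trans (sym (•≡· p 1#)) charp

  multiple·1≡0 : ∀ k → fromℕ· (k ℕ.* p) ≡ 0#
  multiple·1≡0 k = trans (×1-homo-* k p) (trans (cong (fromℕ· k *_) p·1≡0) (zeroʳ _))

  -- The remainder of n modulo p also vanishes in F. Were it positive, it would be coprime to p, and
  -- Bézout would write 1 as a combination of two numbers that vanish in F.
  fromℕ·≡0⇒∣ : ∀ n → fromℕ· n ≡ 0# → p ∣ n
  fromℕ·≡0⇒∣ n n·1≡0 = go (n % p) refl
    where
    instance p≢0 = prime⇒nonZero pr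
    r·1≡0 : fromℕ· (n % p) ≡ 0#
    r·1≡0 = begin
      fromℕ· (n % p)                              ≡⟨ +-identityʳ _ ⟨
      fromℕ· (n % p) + 0#                         ≡⟨ cong (λ z → fromℕ· (n % p) + z) (multiple·1≡0 (n / p)) ⟨
      fromℕ· (n % p) + fromℕ· ((n / p) ℕ.* p)     ≡⟨ ×-homo-+ 1# (n % p) _ ⟨
      fromℕ· (n % p ℕ.+ (n / p) ℕ.* p)            ≡⟨ cong fromℕ· (m≡m%n+[m/n]*n n p) ⟨
      fromℕ· n                                    ≡⟨ n·1≡0 ⟩
      0#                                          ∎
      where open ≡.≡-Reasoning
    kill : ∀ {a} k → fromℕ· a ≡ 0# → fromℕ· (k ℕ.* a) ≡ 0#
    kill {a} k eq = trans (×1-homo-* k a) (trans (cong (fromℕ· k *_) eq) (zeroʳ _))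
    one : ∀ {a b} → 1 ℕ.+ a ≡ b → fromℕ· a ≡ 0# → fromℕ· b ≡ 0# → ⊥
    one {a} eq a≡0 b≡0 = 1≢0 (trans (sym (+-identityʳ 1#)) (trans (cong (λ z → 1# + z) (sym a≡0)) (trans (cong fromℕ· eq) b≡0)))
    go : ∀ r → n % p ≡ r → p ∣ n
    go zero    eq = divides (n / p) (trans (m≡m%n+[m/n]*n n p) (cong (ℕ._+ (n / p) ℕ.* p) eq))
    go (suc r) eq with coprime-Bézout (prime⇒coprime pr {{_}} (subst (ℕ._< p) eq (m%n<n n p)))
    ... | Bézout.+- x y e = ⊥-elim (one e (kill y (subst (λ k → fromℕ· k ≡ 0#) eq r·1≡0)) (kill x p·1≡0))
    ... | Bézout.-+ x y e = ⊥-elim (one e (kill x p·1≡0) (kill y (subst (λ k → fromℕ· k ≡ 0#) eq r·1≡0)))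

  frobenius : ∀ k x y → (x + y) ^ (p ℕ.^ k) ≡ x ^ (p ℕ.^ k) + y ^ (p ℕ.^ k)
  frobenius zero    x y = trans (*-identityʳ _) (sym (cong₂ _+_ (*-identityʳ x) (*-identityʳ y)))
  frobenius (suc k) x y = begin
    (x + y) ^ (p ℕ.* p ℕ.^ k)                      ≡⟨ ^-assocʳ (x + y) p (p ℕ.^ k) ⟨
    ((x + y) ^ p) ^ (p ℕ.^ k)                      ≡⟨ cong (_^ (p ℕ.^ k)) (Binomial.frobenius-+ (fieldRing F) pr p·1≡0 x y) ⟩
    (x ^ p + y ^ p) ^ (p ℕ.^ k)                    ≡⟨ frobenius k (x ^ p) (y ^ p) ⟩
    (x ^ p) ^ (p ℕ.^ k) + (y ^ p) ^ (p ℕ.^ k)      ≡⟨ cong₂ _+_ (^-assocʳ x p (p ℕ.^ k)) (^-assocʳ y p (p ℕ.^ k)) ⟩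
    x ^ (p ℕ.* p ℕ.^ k) + y ^ (p ℕ.* p ℕ.^ k)      ∎
    where open ≡.≡-Reasoning

  p^k-nonZero : ∀ k → NonZero (p ℕ.^ k)
  p^k-nonZero k = ℕₚ.m^n≢0 p k {{prime⇒nonZero pr}}

  frobenius-neg : ∀ k x → (- x) ^ (p ℕ.^ k) ≡ - (x ^ (p ℕ.^ k))
  frobenius-neg k x = +-inverseˡ-unique _ _ (begin
    (- x) ^ (p ℕ.^ k) + x ^ (p ℕ.^ k) ≡⟨ frobenius k (- x) x ⟨
    (- x + x) ^ (p ℕ.^ k)             ≡⟨ cong (_^ (p ℕ.^ k)) (-‿inverseˡ x) ⟩
    0# ^ (p ℕ.^ k)                    ≡⟨ 0^ (p ℕ.^ k) {{p^k-nonZero k}} ⟩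
    0#                                ∎)
    where open ≡.≡-Reasoning

-- The cyclotomic ring ℤ[ζ].

-- ℤ[ζ_p], through the properties of π = 1 - ζ that the argument needs.
record CyclotomicRing (p : ℕ) : Set₁ where
  field
    ring : CommutativeRing 0ℓ 0ℓ
  open RingProperties ring
  field
    ζ : ∣R∣
  π : ∣R∣
  π = 1# - ζ
  fromVector : (Fin p → ℤ) → ∣R∣
  fromVector u = sum (λ j → fromℤ (u j) * ζ ^ toℕ j)
  field
    ζ^p≈1    : ζ ^ p ≈ 1#
    ∑ζ^i≈0   : sum {p} (λ i → ζ ^ toℕ i) ≈ 0#
    π-cancel : ∀ {x} → π * x ≈ 0# → x ≈ 0#
    residue  : ∀ x → Σ ℤ λ i → Σ ∣R∣ λ y → x ≈ fromℤ i + π * y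
    π∣ℤ⇒p∣   : ∀ {i y} → fromℤ i ≈ π * y → p ∣ ℤ.∣ i ∣
    valAtLeast⇒π^∣ : ∀ u r → valAtLeast u r → Σ ∣R∣ λ y → fromVector u ≈ π ^ r * y
    π^∣⇒valAtLeast : ∀ u r y → fromVector u ≈ π ^ r * y → valAtLeast u r

-- A polynomial in ζ is represented by its action on ℤ[X]/(X^p - 1), X acting
-- by the cyclic shift; two polynomials are equal in ℤ[ζ] when their actions
-- agree modulo constant vectors, the multiples of 1 + X + ... + X^(p-1).
-- Commutativity is then the fact that polynomials in one operator commute.
module CyclotomicConstruction (m : ℕ) where

  private
    Vector : Set
    Vector = Fin (suc m) → ℤ

    module ℤ-Sum = Algebra.Properties.Semiring.Sum (CommutativeRing.semiring ℤₚ.+-*-commutativeRing)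
    open ℤ-Sum using () renaming (sum to ∑)

  infixl 6 _⊕_
  infixl 7 _⊗_

  data Expr : Set where
    con     : ℤ → Expr
    X       : Expr
    _⊕_ _⊗_ : Expr → Expr → Expr

  act : Expr → Vector → Vector
  act (con n) v j = n ℤ.* v j
  act X       v j = v (prevFin j)
  act (e ⊕ f) v j = act e v j ℤ.+ act f v j
  act (e ⊗ f) v j = act e (act f v) j

  infix 4 _≈ᴱ_
  record _≈ᴱ_ (e f : Expr) : Set where
    constructor equal
    field agree : ∀ v → Σ ℤ λ c → ∀ j → act e v j ≡ act f v j ℤ.+ c
  open _≈ᴱ_

  private
    open ≡ using (refl; sym; trans; cong; cong₂; subst)
    module ℤR = RingProperties ℤₚ.+-*-commutativeRing
    open ℤR.Solver using (solve; _:=_; _:+_; _:*_; :-_; _:-_) renaming (con to :con)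

    act-cong : ∀ e {v w} → (∀ j → v j ≡ w j) → ∀ j → act e v j ≡ act e w j
    act-cong (con n) eq j = cong (n ℤ.*_) (eq j)
    act-cong X       eq j = eq (prevFin j)
    act-cong (e ⊕ f) eq j = cong₂ ℤ._+_ (act-cong e eq j) (act-cong f eq j)
    act-cong (e ⊗ f) eq j = act-cong e (act-cong f eq) j

    act-+ : ∀ e v w j → act e (λ k → v k ℤ.+ w k) j ≡ act e v j ℤ.+ act e w j
    act-+ (con n) v w j = ℤₚ.*-distribˡ-+ n (v j) (w j)
    act-+ X       v w j = refl
    act-+ (e ⊕ f) v w j = trans (cong₂ ℤ._+_ (act-+ e v w j) (act-+ f v w j))
      (solve 4 (λ a b c d → (a :+ b) :+ (c :+ d) := (a :+ c) :+ (b :+ d)) refl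
        (act e v j) (act e w j) (act f v j) (act f w j))
    act-+ (e ⊗ f) v w j = trans (act-cong e (act-+ f v w) j) (act-+ e _ _ j)

    act-scale : ∀ e n v j → act e (λ k → n ℤ.* v k) j ≡ n ℤ.* act e v j
    act-scale (con k) n v j = solve 3 (λ k n x → k :* (n :* x) := n :* (k :* x)) refl k n (v j)
    act-scale X       n v j = refl
    act-scale (e ⊕ f) n v j = trans (cong₂ ℤ._+_ (act-scale e n v j) (act-scale f n v j))
      (sym (ℤₚ.*-distribˡ-+ n (act e v j) (act f v j)))
    act-scale (e ⊗ f) n v j = trans (act-cong e (act-scale f n v) j) (act-scale e n _ j)

    act-shift : ∀ e v j → act e (λ k → v (prevFin k)) j ≡ act e v (prevFin j)
    act-shift (con n) v j = refl
    act-shift X       v j = refl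
    act-shift (e ⊕ f) v j = cong₂ ℤ._+_ (act-shift e v j) (act-shift f v j)
    act-shift (e ⊗ f) v j = trans (act-cong e (act-shift f v) j) (act-shift e _ j)

    -- The multiples of 1 + X + ... + X^(p-1) form an ideal. `⊗-cong` uses this to carry the
    -- constant error of the right factor through the left one.
    act-constant : ∀ e c → Σ ℤ λ c′ → ∀ j → act e (λ _ → c) j ≡ c′
    act-constant (con n) c = n ℤ.* c , λ _ → refl
    act-constant X       c = c , λ _ → refl
    act-constant (e ⊕ f) c with act-constant e c | act-constant f c
    ... | a , h | b , k = a ℤ.+ b , λ j → cong₂ ℤ._+_ (h j) (k j)
    act-constant (e ⊗ f) c with act-constant f c
    ... | b , k with act-constant e b
    ...   | a , h = a , λ j → trans (act-cong e k j) (h j)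

    act-comm : ∀ e f v j → act e (act f v) j ≡ act f (act e v) j
    act-comm (con n) f v j = sym (act-scale f n v j)
    act-comm X       f v j = sym (act-shift f v j)
    act-comm (e ⊕ g) f v j = trans (cong₂ ℤ._+_ (act-comm e f v j) (act-comm g f v j))
      (sym (act-+ f (act e v) (act g v) j))
    act-comm (e ⊗ g) f v j = trans (act-cong e (act-comm g f v) j) (act-comm e f (act g v) j)

    pointwise : ∀ {e f} → (∀ v j → act e v j ≡ act f v j) → e ≈ᴱ f
    pointwise h = equal λ v → 0ℤ , λ j → trans (h v j) (sym (ℤₚ.+-identityʳ _))

    ⊕-cong : ∀ {e e′ f f′} → e ≈ᴱ e′ → f ≈ᴱ f′ → e ⊕ f ≈ᴱ e′ ⊕ f′
    ⊕-cong {e} {e′} {f} {f′} h k = equal λ v →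
      let c , p = agree h v ; d , q = agree k v in c ℤ.+ d , λ j →
        trans (cong₂ ℤ._+_ (p j) (q j))
          (solve 4 (λ a b c d → (a :+ c) :+ (b :+ d) := (a :+ b) :+ (c :+ d)) refl
            (act e′ v j) (act f′ v j) c d)

    ⊗-cong : ∀ {e e′ f f′} → e ≈ᴱ e′ → f ≈ᴱ f′ → e ⊗ f ≈ᴱ e′ ⊗ f′
    ⊗-cong {e} {e′} {f} {f′} h k = equal λ v →
      let d , q = agree k v
          c , p = agree h (act f′ v)
          d′ , q′ = act-constant e d
      in c ℤ.+ d′ , λ j → trans (act-cong e q j) (trans (act-+ e (act f′ v) (λ _ → d) j)
           (trans (cong₂ ℤ._+_ (p j) (q′ j)) (ℤₚ.+-assoc (act e′ (act f′ v) j) c d′)))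

    isCommutativeRing : IsCommutativeRing _≈ᴱ_ _⊕_ _⊗_ (con -1ℤ ⊗_) (con 0ℤ) (con 1ℤ)
    isCommutativeRing = record
      { isRing = record
        { +-isAbelianGroup = record
          { isGroup = record
            { isMonoid = record
              { isSemigroup = record
                { isMagma = record
                  { isEquivalence = record
                    { refl  = pointwise λ v j → refl
                    ; sym   = λ {e} {f} h → equal λ v → let c , p = agree h v in ℤ.- c , λ j →
                        trans (solve 2 (λ b c → b := b :+ c :+ (:- c)) refl (act f v j) c)
                          (cong (ℤ._+ (ℤ.- c)) (sym (p j)))
                    ; trans = λ {e} {f} {g} h k → equal λ v →
                        let c , p = agree h v ; d , q = agree k v in d ℤ.+ c , λ j →
                          trans (p j) (trans (cong (ℤ._+ c) (q j)) (ℤₚ.+-assoc (act g v j) d c))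
                    }
                  ; ∙-cong = ⊕-cong
                  }
                ; assoc = λ e f g → pointwise λ v j → ℤₚ.+-assoc (act e v j) (act f v j) (act g v j)
                }
              ; identity = (λ e → pointwise λ v j → trans (cong (ℤ._+ act e v j) (ℤₚ.*-zeroˡ (v j))) (ℤₚ.+-identityˡ _))
                         , (λ e → pointwise λ v j → trans (cong (λ z → act e v j ℤ.+ z) (ℤₚ.*-zeroˡ (v j))) (ℤₚ.+-identityʳ _))
              }
            ; inverse = (λ e → pointwise λ v j → solve 2 (λ x y → (:con -1ℤ :* x) :+ x := :con 0ℤ :* y) refl (act e v j) (v j))
                      , (λ e → pointwise λ v j → solve 2 (λ x y → x :+ (:con -1ℤ :* x) := :con 0ℤ :* y) refl (act e v j) (v j))
            ; ⁻¹-cong = ⊗-cong {con -1ℤ} (pointwise λ v j → refl)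
            }
          ; comm = λ e f → pointwise λ v j → ℤₚ.+-comm (act e v j) (act f v j)
          }
        ; *-cong = ⊗-cong
        ; *-assoc = λ e f g → pointwise λ v j → refl
        ; *-identity = (λ e → pointwise λ v j → ℤₚ.*-identityˡ _)
                     , (λ e → pointwise λ v j → act-cong e (λ k → ℤₚ.*-identityˡ (v k)) j)
        ; distrib = (λ e f g → pointwise λ v j → act-+ e (act f v) (act g v) j)
                  , (λ e f g → pointwise λ v j → refl)
        }
      ; *-comm = λ e f → pointwise λ v j → act-comm e f v j
      }

  ring : CommutativeRing 0ℓ 0ℓ
  ring = record { isCommutativeRing = isCommutativeRing }

  private
    open RingProperties ring
      using (∣R∣; fromℤ; fromℕ·; sum; sum-cong-≋; *-distribˡ-sum; sum-init-last)
      renaming (_^_ to _^ᴱ_; _*_ to _*ᴱ_; _+_ to _+ᴱ_; _-_ to _-ᴱ_; _≈_ to _≈ᴿ_)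
    module R = RingProperties ring
    open R.Solver using () renaming (solve to solveᴿ; con to conᴿ; _:=_ to _:=ᴿ_; _:+_ to _:+ᴿ_; _:*_ to _:*ᴿ_; _:-_ to _:-ᴿ_; :-_ to -:ᴿ_)

    prev : Fin (suc m) → Fin (suc m)
    prev = prevFin

    prev^ : ℕ → Fin (suc m) → Fin (suc m)
    prev^ zero    j = j
    prev^ (suc k) j = prev^ k (prev j)

    prev^-+ : ∀ a b j → prev^ (a ℕ.+ b) j ≡ prev^ b (prev^ a j)
    prev^-+ zero    b j = refl
    prev^-+ (suc a) b j = prev^-+ a b (prev j)

    toℕ-prev^ : ∀ k t j → toℕ j ≡ k ℕ.+ t → toℕ (prev^ k j) ≡ t
    toℕ-prev^ zero    t j           eq = eq
    toℕ-prev^ (suc k) t (Fin.suc i) eq = toℕ-prev^ k t (inject₁ i) (trans (toℕ-inject₁ i) (ℕₚ.suc-injective eq))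

    -- From j = t it takes t steps down to 0, one step around to m, and m - t steps down to t again.
    prev^-period : ∀ j → prev^ (suc m) j ≡ j
    prev^-period j = begin
      prev^ (suc m) j                         ≡⟨ cong (λ k → prev^ k j) (sym split) ⟩
      prev^ (t ℕ.+ suc (m ℕ.∸ t)) j           ≡⟨ prev^-+ t (suc (m ℕ.∸ t)) j ⟩
      prev^ (m ℕ.∸ t) (prev (prev^ t j))      ≡⟨ cong (λ k → prev^ (m ℕ.∸ t) (prev k)) at-zero ⟩
      prev^ (m ℕ.∸ t) (fromℕ m)               ≡⟨ Finₚ.toℕ-injective (toℕ-prev^ (m ℕ.∸ t) t (fromℕ m)
                                                   (trans (toℕ-fromℕ m) (sym (ℕₚ.m∸n+n≡m t≤m)))) ⟩
      j                                       ∎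
      where
      open ≡.≡-Reasoning
      t = toℕ j
      t≤m : t ℕ.≤ m
      t≤m = ℕₚ.≤-pred (toℕ<n j)
      split : t ℕ.+ suc (m ℕ.∸ t) ≡ suc m
      split = trans (ℕₚ.+-suc t _) (cong suc (ℕₚ.m+[n∸m]≡n t≤m))
      at-zero : prev^ t j ≡ Fin.zero
      at-zero = Finₚ.toℕ-injective (toℕ-prev^ t 0 j (sym (ℕₚ.+-identityʳ t)))

    prev^-injective : ∀ k → k ℕ.≤ suc m → ∀ i j → prev^ k i ≡ prev^ k j → i ≡ j
    prev^-injective k k≤p i j eq = trans (sym (back i)) (trans (cong (prev^ (suc m ℕ.∸ k)) eq) (back j))
      where
      back : ∀ i → prev^ (suc m ℕ.∸ k) (prev^ k i) ≡ i
      back i = trans (sym (prev^-+ k _ i)) (trans (cong (λ n → prev^ n i) (ℕₚ.m+[n∸m]≡n k≤p)) (prev^-period i))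

    act-X^ : ∀ k v j → act (X ^ᴱ k) v j ≡ v (prev^ k j)
    act-X^ zero    v j = ℤₚ.*-identityˡ (v j)
    act-X^ (suc k) v j = act-X^ k v (prev j)

    act-sum : ∀ {n} (e : Fin n → Expr) v j → act (sum e) v j ≡ ∑ (λ i → act (e i) v j)
    act-sum {zero}  e v j = ℤₚ.*-zeroˡ (v j)
    act-sum {suc n} e v j = cong (λ z → act (e Fin.zero) v j ℤ.+ z) (act-sum (e ∘ Fin.suc) v j)

    ∑-shift : ∀ (u : Vector) → ∑ (u ∘ prev) ≡ ∑ u
    ∑-shift u = trans (ℤₚ.+-comm (u (fromℕ m)) _) (sym (ℤ-Sum.sum-init-last u))

    ∑-distrib : ∀ {n} (f : Fin n → ℤ) c → ∑ (λ i → f i ℤ.+ c) ≡ ∑ f ℤ.+ + n ℤ.* c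
    ∑-distrib {zero}  f c = sym (ℤₚ.*-zeroˡ c)
    ∑-distrib {suc n} f c = trans (cong (λ z → f Fin.zero ℤ.+ c ℤ.+ z) (∑-distrib (f ∘ Fin.suc) c))
      (solve 4 (λ a c s n → a :+ c :+ (s :+ n :* c) := (a :+ s) :+ (:con 1ℤ :+ n) :* c) refl
        (f Fin.zero) c (∑ (f ∘ Fin.suc)) (+ n))

    act-π : ∀ (u : Vector) j → act (con 1ℤ -ᴱ X) u j ≡ u j ℤ.- u (prev j)
    act-π u j = solve 2 (λ a b → :con 1ℤ :* a :+ :con -1ℤ :* b := a :- b) refl (u j) (u (prev j))

    ∑-differences : ∀ (u : Vector) → ∑ (λ j → u j ℤ.- u (prev j)) ≡ 0ℤ
    ∑-differences u = begin
      ∑ (λ j → u j ℤ.- u (prev j))              ≡⟨ ℤ-Sum.∑-distrib-+ u (λ j → ℤ.- u (prev j)) ⟩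
      ∑ u ℤ.+ ∑ (λ j → ℤ.- u (prev j))          ≡⟨ cong (λ z → ∑ u ℤ.+ z) (∑-neg (u ∘ prev)) ⟩
      ∑ u ℤ.+ ℤ.- ∑ (u ∘ prev)                  ≡⟨ cong (λ z → ∑ u ℤ.+ ℤ.- z) (∑-shift u) ⟩
      ∑ u ℤ.+ ℤ.- ∑ u                           ≡⟨ ℤₚ.+-inverseʳ (∑ u) ⟩
      0ℤ                                        ∎
      where
      open ≡.≡-Reasoning
      ∑-neg : ∀ {n} (f : Fin n → ℤ) → ∑ (λ i → ℤ.- f i) ≡ ℤ.- ∑ f
      ∑-neg {zero}  f = refl
      ∑-neg {suc n} f = trans (cong (λ z → ℤ.- f Fin.zero ℤ.+ z) (∑-neg (f ∘ Fin.suc))) (sym (ℤₚ.neg-distrib-+ (f Fin.zero) _))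

    constant : ∀ {n} (u : Fin (suc n) → ℤ) → (∀ i → u (Fin.suc i) ≡ u (inject₁ i)) → ∀ j → u j ≡ u Fin.zero
    constant u h Fin.zero = refl
    constant {suc n} u h (Fin.suc i) = trans (constant (u ∘ Fin.suc) (h ∘ Fin.suc) i) (h Fin.zero)

    -- If all differences u j - u (j - 1) equal one constant c, their sum around the cycle gives p c
    -- = 0. Hence c = 0 and u is itself constant, that is, zero in the quotient.
    π-cancel : ∀ {x} → (con 1ℤ -ᴱ X) *ᴱ x ≈ᴿ con 0ℤ → x ≈ᴿ con 0ℤ
    π-cancel {x} eq = equal λ v →
      let u = act x v
          c , h = agree eq v
          u-prev≡c : ∀ j → u j ℤ.- u (prev j) ≡ c
          u-prev≡c j = trans (sym (act-π u j)) (trans (h j) (trans (cong (ℤ._+ c) (ℤₚ.*-zeroˡ (v j))) (ℤₚ.+-identityˡ c)))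
          pc≡0 : + suc m ℤ.* c ≡ 0ℤ
          pc≡0 = trans (sym (trans (cong (ℤ._+ + suc m ℤ.* c) (ℤ-Sum.sum-replicate-zero (suc m))) (ℤₚ.+-identityˡ _)))
            (trans (sym (∑-distrib {suc m} (λ _ → 0ℤ) c))
              (trans (ℤ-Sum.sum-cong-≗ (λ j → trans (ℤₚ.+-identityˡ c) (sym (u-prev≡c j)))) (∑-differences u)))
          c≡0 : c ≡ 0ℤ
          c≡0 = ℤₚ.*-cancelˡ-≡ (+ suc m) c 0ℤ (trans pc≡0 (sym (ℤₚ.*-zeroʳ (+ suc m))))
          stationary : ∀ i → u (Fin.suc i) ≡ u (inject₁ i)
          stationary i = ℤₚ.i-j≡0⇒i≡j _ _ (trans (u-prev≡c (Fin.suc i)) c≡0)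
      in u Fin.zero , λ j → trans (constant u stationary j)
           (sym (trans (cong (ℤ._+ u Fin.zero) (ℤₚ.*-zeroˡ (v j))) (ℤₚ.+-identityˡ _)))

    ζ^p≈1 : X ^ᴱ suc m ≈ᴿ con 1ℤ
    ζ^p≈1 = pointwise λ v j → trans (act-X^ (suc m) v j) (trans (cong v (prev^-period j)) (sym (ℤₚ.*-identityˡ (v j))))

    geometric : ∀ n x → (con 1ℤ -ᴱ x) *ᴱ sum {n} (λ i → x ^ᴱ toℕ i) ≈ᴿ con 1ℤ -ᴱ x ^ᴱ n
    geometric zero    x = R.trans (R.zeroʳ _) (R.sym (R.-‿inverseʳ (con 1ℤ)))
    geometric (suc n) x = begin
      (con 1ℤ -ᴱ x) *ᴱ (con 1ℤ +ᴱ sum {n} (λ i → x *ᴱ x ^ᴱ toℕ i))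
        ≈⟨ R.*-congˡ {con 1ℤ -ᴱ x} (R.+-congˡ {con 1ℤ} (R.sym (*-distribˡ-sum x (λ (i : Fin n) → x ^ᴱ toℕ i)))) ⟩
      (con 1ℤ -ᴱ x) *ᴱ (con 1ℤ +ᴱ x *ᴱ S)
        ≈⟨ solveᴿ 2 (λ x s → (conᴿ 1ℤ :-ᴿ x) :*ᴿ (conᴿ 1ℤ :+ᴿ x :*ᴿ s)
              :=ᴿ (conᴿ 1ℤ :-ᴿ x) :+ᴿ x :*ᴿ ((conᴿ 1ℤ :-ᴿ x) :*ᴿ s)) R.refl x S ⟩
      (con 1ℤ -ᴱ x) +ᴱ x *ᴱ ((con 1ℤ -ᴱ x) *ᴱ S)
        ≈⟨ R.+-congˡ {con 1ℤ -ᴱ x} (R.*-congˡ {x} (geometric n x)) ⟩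
      (con 1ℤ -ᴱ x) +ᴱ x *ᴱ (con 1ℤ -ᴱ x ^ᴱ n)
        ≈⟨ solveᴿ 2 (λ x y → (conᴿ 1ℤ :-ᴿ x) :+ᴿ x :*ᴿ (conᴿ 1ℤ :-ᴿ y)
              :=ᴿ conᴿ 1ℤ :-ᴿ x :*ᴿ y) R.refl x (x ^ᴱ n) ⟩
      con 1ℤ -ᴱ x *ᴱ x ^ᴱ n ∎
      where
      open R.≈R
      S = sum {n} (λ i → x ^ᴱ toℕ i)

    -- The geometric series times 1 - X is 1 - X^p = 0, and 1 - X can be cancelled.
    ∑ζ^i≈0 : sum {suc m} (λ i → X ^ᴱ toℕ i) ≈ᴿ con 0ℤ
    ∑ζ^i≈0 = π-cancel (R.trans (geometric (suc m) X) (R.x≈y⇒x-y≈0 (R.sym ζ^p≈1)))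

    act-fromℕ· : ∀ n v j → act (fromℕ· n) v j ≡ + n ℤ.* v j
    act-fromℕ· zero    v j = refl
    act-fromℕ· (suc n) v j = trans (cong (λ z → 1ℤ ℤ.* v j ℤ.+ z) (act-fromℕ· n v j))
      (sym (ℤₚ.*-distribʳ-+ (v j) 1ℤ (+ n)))

    act-fromℤ : ∀ i v j → act (fromℤ i) v j ≡ i ℤ.* v j
    act-fromℤ (+ n)    v j = act-fromℕ· n v j
    act-fromℤ -[1+ n ] v j = trans (cong (-1ℤ ℤ.*_) (act-fromℕ· (suc n) v j))
      (trans (sym (ℤₚ.*-assoc -1ℤ (+ suc n) (v j))) (cong (ℤ._* v j) (ℤₚ.-1*i≡-i (+ suc n))))

    -- The integer is the value of the expression at X = 1, where `π` vanishes.
    residue : ∀ x → Σ ℤ λ i → Σ Expr λ y → x ≈ᴿ fromℤ i +ᴱ (con 1ℤ -ᴱ X) *ᴱ y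
    residue (con i) = i , con 0ℤ , R.trans (pointwise λ v j → sym (act-fromℤ i v j))
      (R.sym (R.trans (R.+-congˡ (R.zeroʳ (con 1ℤ -ᴱ X))) (R.+-identityʳ (fromℤ i))))
    residue X = 1ℤ , con -1ℤ , R.trans (solveᴿ 1 (λ x → x :=ᴿ conᴿ 1ℤ :+ᴿ (conᴿ 1ℤ :-ᴿ x) :*ᴿ (conᴿ -1ℤ)) R.refl X)
        (R.+-cong (R.sym (R.+-identityʳ (con 1ℤ))) (R.*-congˡ {con 1ℤ -ᴱ X} (pointwise λ v j → cong (-1ℤ ℤ.*_) (ℤₚ.*-identityˡ (v j)))))
    residue (e ⊕ f) with residue e | residue f
    ... | i , y , h | k , z , g = i ℤ.+ k , y ⊕ z , R.trans (⊕-cong h g)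
        (R.trans (solveᴿ 5 (λ i k π y z → (i :+ᴿ π :*ᴿ y) :+ᴿ (k :+ᴿ π :*ᴿ z)
            :=ᴿ (i :+ᴿ k) :+ᴿ π :*ᴿ (y :+ᴿ z)) R.refl (fromℤ i) (fromℤ k) (con 1ℤ -ᴱ X) y z)
          (R.+-congʳ (R.sym (R.fromℤ-+ i k))))
    residue (e ⊗ f) with residue e | residue f
    ... | i , y , h | k , z , g = i ℤ.* k , (fromℤ i ⊗ z ⊕ (y ⊗ f)) , R.trans (⊗-cong h (R.refl {f}))
        (R.trans (R.distribʳ f (fromℤ i) _) (R.trans (R.+-congʳ (⊗-cong (R.refl {fromℤ i}) g))
          (R.trans (solveᴿ 6 (λ i k π y z f → i :*ᴿ (k :+ᴿ π :*ᴿ z) :+ᴿ π :*ᴿ y :*ᴿ f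
              :=ᴿ i :*ᴿ k :+ᴿ π :*ᴿ (i :*ᴿ z :+ᴿ y :*ᴿ f)) R.refl (fromℤ i) (fromℤ k) (con 1ℤ -ᴱ X) y z f)
            (R.+-congʳ (R.sym (R.fromℤ-* i k))))))

    -- The coefficient vector of 1, so that acting on it reads off the coefficients of an
    -- expression.
    e₀ : Vector
    e₀ Fin.zero    = 1ℤ
    e₀ (Fin.suc _) = 0ℤ

    e₀-nonzero : ∀ {j} → j ≢ Fin.zero → e₀ j ≡ 0ℤ
    e₀-nonzero {Fin.zero}  ne = ⊥-elim (ne refl)
    e₀-nonzero {Fin.suc _} ne = refl

    -- Compare the sums of all coordinates at `e₀`: the left side gives i, a multiple of `π` gives
    -- 0, and the constant c by which the sides may differ gives p c.
    π∣ℤ⇒p∣ : ∀ {i y} → fromℤ i ≈ᴿ (con 1ℤ -ᴱ X) *ᴱ y → suc m ∣ ℤ.∣ i ∣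
    π∣ℤ⇒p∣ {i} {y} eq with agree eq e₀
    ... | c , h = divides ℤ.∣ c ∣ (trans (cong ℤ.∣_∣ i≡c*p) (ℤₚ.abs-* c (+ suc m)))
      where
      u : Vector
      u = act y e₀
      left : ∑ (λ j → i ℤ.* e₀ j) ≡ i
      left = trans (cong₂ ℤ._+_ (ℤₚ.*-identityʳ i) (trans (ℤ-Sum.sum-cong-≗ {m} (λ _ → ℤₚ.*-zeroʳ i)) (ℤ-Sum.sum-replicate-zero m)))
        (ℤₚ.+-identityʳ i)
      i≡c*p : i ≡ c ℤ.* + suc m
      i≡c*p = begin
        i                                           ≡⟨ left ⟨
        ∑ (λ j → i ℤ.* e₀ j)                        ≡⟨ ℤ-Sum.sum-cong-≗ (λ j → trans (sym (act-fromℤ i e₀ j))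
                                                         (trans (h j) (cong (ℤ._+ c) (act-π u j)))) ⟩
        ∑ (λ j → u j ℤ.- u (prev j) ℤ.+ c)          ≡⟨ ∑-distrib (λ j → u j ℤ.- u (prev j)) c ⟩
        ∑ (λ j → u j ℤ.- u (prev j)) ℤ.+ + suc m ℤ.* c ≡⟨ cong (ℤ._+ + suc m ℤ.* c) (∑-differences u) ⟩
        0ℤ ℤ.+ + suc m ℤ.* c                        ≡⟨ ℤₚ.+-identityˡ _ ⟩
        + suc m ℤ.* c                               ≡⟨ ℤₚ.*-comm (+ suc m) c ⟩
        c ℤ.* + suc m                               ∎
        where open ≡.≡-Reasoning

    fromVector : Vector → Expr
    fromVector u = sum (λ j → fromℤ (u j) *ᴱ X ^ᴱ toℕ j)

    ∑-select : ∀ {n} (f : Fin n → ℤ) i → (∀ j → j ≢ i → f j ≡ 0ℤ) → ∑ f ≡ f i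
    ∑-select {suc n} f Fin.zero    h = trans (cong (λ z → f Fin.zero ℤ.+ z) (trans (ℤ-Sum.sum-cong-≗ (λ j → h (Fin.suc j) λ ()))
      (ℤ-Sum.sum-replicate-zero n))) (ℤₚ.+-identityʳ _)
    ∑-select {suc n} f (Fin.suc i) h = trans (cong₂ ℤ._+_ (h Fin.zero λ ()) (∑-select (f ∘ Fin.suc) i
      (λ j ne → h (Fin.suc j) (ne ∘ Finₚ.suc-injective)))) (ℤₚ.+-identityˡ _)

    act-fromVector : ∀ u k → act (fromVector u) e₀ k ≡ u k
    act-fromVector u k = begin
      act (fromVector u) e₀ k                            ≡⟨ act-sum (λ j → fromℤ (u j) *ᴱ X ^ᴱ toℕ j) e₀ k ⟩
      ∑ (λ j → act (fromℤ (u j)) (act (X ^ᴱ toℕ j) e₀) k) ≡⟨ ℤ-Sum.sum-cong-≗ (λ j → trans (act-fromℤ (u j) (act (X ^ᴱ toℕ j) e₀) k)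
                                                               (cong (u j ℤ.*_) (act-X^ (toℕ j) e₀ k))) ⟩
      ∑ (λ j → u j ℤ.* e₀ (prev^ (toℕ j) k))             ≡⟨ ∑-select (λ j → u j ℤ.* e₀ (prev^ (toℕ j) k)) k off ⟩
      u k ℤ.* e₀ (prev^ (toℕ k) k)                       ≡⟨ cong (λ i → u k ℤ.* e₀ i) (to-zero k) ⟩
      u k ℤ.* 1ℤ                                         ≡⟨ ℤₚ.*-identityʳ (u k) ⟩
      u k                                                ∎
      where
      open ≡.≡-Reasoning
      to-zero : ∀ j → prev^ (toℕ j) j ≡ Fin.zero
      to-zero j = Finₚ.toℕ-injective (toℕ-prev^ (toℕ j) 0 j (sym (ℕₚ.+-identityʳ _)))
      off : ∀ j → j ≢ k → u j ℤ.* e₀ (prev^ (toℕ j) k) ≡ 0ℤ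
      off j ne = trans (cong (u j ℤ.*_) (e₀-nonzero λ eq → ne (sym (prev^-injective (toℕ j)
        (ℕₚ.<⇒≤ (toℕ<n j)) k j (trans eq (sym (to-zero j))))))) (ℤₚ.*-zeroʳ (u j))

    act-π^ : ∀ r w j → act ((con 1ℤ -ᴱ X) ^ᴱ r) w j ≡ mulπ^ r w j
    act-π^ zero    w j = ℤₚ.*-identityˡ (w j)
    act-π^ (suc r) w j = trans (act-π (act ((con 1ℤ -ᴱ X) ^ᴱ r) w) j)
      (cong₂ ℤ._-_ (act-π^ r w j) (act-π^ r w (prev j)))

    π^∣⇒valAtLeast : ∀ u r y → fromVector u ≈ᴿ (con 1ℤ -ᴱ X) ^ᴱ r *ᴱ y → valAtLeast u r
    π^∣⇒valAtLeast u r y eq with agree eq e₀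
    ... | c , h = act y e₀ , c , λ j → trans (sym (act-fromVector u j))
          (trans (h j) (cong (ℤ._+ c) (act-π^ r (act y e₀) j)))

    fromVector-+ : ∀ u w → fromVector (λ j → u j ℤ.+ w j) ≈ᴿ fromVector u +ᴱ fromVector w
    fromVector-+ u w = R.trans (sum-cong-≋ (λ j → R.trans (R.*-congʳ {X ^ᴱ toℕ j} (R.fromℤ-+ (u j) (w j)))
        (R.distribʳ (X ^ᴱ toℕ j) (fromℤ (u j)) (fromℤ (w j)))))
      (RSum.∑-distrib-+ (λ j → fromℤ (u j) *ᴱ X ^ᴱ toℕ j) (λ j → fromℤ (w j) *ᴱ X ^ᴱ toℕ j))
      where module RSum = Algebra.Properties.Semiring.Sum (CommutativeRing.semiring ring)

    fromVector-neg : ∀ u → fromVector (λ j → ℤ.- u j) ≈ᴿ (con 1ℤ -ᴱ con 1ℤ) -ᴱ fromVector u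
    fromVector-neg u = R.x-y≈0⇒x≈y (R.trans (solveᴿ 2 (λ a b → a :-ᴿ ((conᴿ 1ℤ :-ᴿ conᴿ 1ℤ) :-ᴿ b) :=ᴿ b :+ᴿ a)
          R.refl (fromVector (λ j → ℤ.- u j)) (fromVector u))
        (R.trans (R.sym (fromVector-+ u (λ j → ℤ.- u j))) (R.trans (sum-cong-≋ (λ j → R.trans (R.*-congʳ {X ^ᴱ toℕ j}
          (R.reflexive (cong fromℤ (ℤₚ.+-inverseʳ (u j))))) (R.zeroˡ (X ^ᴱ toℕ j)))) (R.sum-replicate-zero (suc m)))))

    fromVector-constant : ∀ c → fromVector (λ _ → c) ≈ᴿ con 0ℤ
    fromVector-constant c = R.trans (R.sym (*-distribˡ-sum (fromℤ c) (λ (j : Fin (suc m)) → X ^ᴱ toℕ j)))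
      (R.trans (R.*-congˡ {fromℤ c} ∑ζ^i≈0) (R.zeroʳ (fromℤ c)))

    -- The last coefficient wraps around to the constant term, as it should because X^p = 1.
    fromVector-shift : ∀ u → fromVector (u ∘ prev) ≈ᴿ X *ᴱ fromVector u
    fromVector-shift u = begin
      a *ᴱ con 1ℤ +ᴱ sum (λ (i : Fin m) → fromℤ (u (inject₁ i)) *ᴱ (X *ᴱ X ^ᴱ toℕ i))
        ≈⟨ R.+-cong (R.*-congˡ {a} (R.sym (R.trans (R.reflexive (cong (λ k → X *ᴱ X ^ᴱ k) (toℕ-fromℕ m))) ζ^p≈1)))
             (sum-cong-≋ (λ (i : Fin m) → R.*-congˡ {fromℤ (u (inject₁ i))} (R.*-congˡ {X} (R.reflexive (cong (X ^ᴱ_) (sym (toℕ-inject₁ i))))))) ⟩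
      t (fromℕ m) +ᴱ sum (λ (i : Fin m) → t (inject₁ i))
        ≈⟨ R.+-comm (t (fromℕ m)) _ ⟩
      sum (λ (i : Fin m) → t (inject₁ i)) +ᴱ t (fromℕ m)
        ≈⟨ R.sym (sum-init-last t) ⟩
      sum t
        ≈⟨ sum-cong-≋ (λ j → solveᴿ 3 (λ a x y → a :*ᴿ (x :*ᴿ y) :=ᴿ x :*ᴿ (a :*ᴿ y)) R.refl (fromℤ (u j)) X (X ^ᴱ toℕ j)) ⟩
      sum (λ j → X *ᴱ (fromℤ (u j) *ᴱ X ^ᴱ toℕ j))
        ≈⟨ R.sym (*-distribˡ-sum X (λ j → fromℤ (u j) *ᴱ X ^ᴱ toℕ j)) ⟩
      X *ᴱ fromVector u ∎
      where
      open R.≈R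
      a = fromℤ (u (fromℕ m))
      t : Fin (suc m) → Expr
      t j = fromℤ (u j) *ᴱ (X *ᴱ X ^ᴱ toℕ j)

    fromVector-mulπ^ : ∀ r u → fromVector (mulπ^ r u) ≈ᴿ (con 1ℤ -ᴱ X) ^ᴱ r *ᴱ fromVector u
    fromVector-mulπ^ zero    u = R.sym (R.*-identityˡ (fromVector u))
    fromVector-mulπ^ (suc r) u = begin
      fromVector (mulπ w)                        ≈⟨ fromVector-+ w (λ j → ℤ.- w (prev j)) ⟩
      W +ᴱ fromVector (λ j → ℤ.- w (prev j))     ≈⟨ R.+-congˡ {W} (fromVector-neg (w ∘ prev)) ⟩
      W +ᴱ ((con 1ℤ -ᴱ con 1ℤ) -ᴱ fromVector (w ∘ prev))
        ≈⟨ R.+-congˡ {W} (R.+-congˡ {con 1ℤ -ᴱ con 1ℤ} (R.-‿cong (fromVector-shift w))) ⟩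
      W +ᴱ ((con 1ℤ -ᴱ con 1ℤ) -ᴱ X *ᴱ W)
        ≈⟨ solveᴿ 2 (λ w x → w :+ᴿ ((conᴿ 1ℤ :-ᴿ conᴿ 1ℤ) :-ᴿ x :*ᴿ w) :=ᴿ (conᴿ 1ℤ :-ᴿ x) :*ᴿ w) R.refl W X ⟩
      (con 1ℤ -ᴱ X) *ᴱ W                         ≈⟨ R.*-congˡ {con 1ℤ -ᴱ X} (fromVector-mulπ^ r u) ⟩
      (con 1ℤ -ᴱ X) *ᴱ ((con 1ℤ -ᴱ X) ^ᴱ r *ᴱ fromVector u) ≈⟨ R.sym (R.*-assoc (con 1ℤ -ᴱ X) _ (fromVector u)) ⟩
      (con 1ℤ -ᴱ X) ^ᴱ suc r *ᴱ fromVector u     ∎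
      where
      open R.≈R
      w : Vector
      w = mulπ^ r u
      W = fromVector w

    valAtLeast⇒π^∣ : ∀ u r → valAtLeast u r → Σ Expr λ y → fromVector u ≈ᴿ (con 1ℤ -ᴱ X) ^ᴱ r *ᴱ y
    valAtLeast⇒π^∣ u r (w , c , h) = fromVector w , (begin
      fromVector u                                  ≈⟨ sum-cong-≋ (λ j → R.*-congʳ {X ^ᴱ toℕ j} (R.reflexive (cong fromℤ (h j)))) ⟩
      fromVector (λ j → mulπ^ r w j ℤ.+ c)          ≈⟨ fromVector-+ (mulπ^ r w) (λ _ → c) ⟩
      fromVector (mulπ^ r w) +ᴱ fromVector (λ _ → c) ≈⟨ R.+-cong (fromVector-mulπ^ r w) (fromVector-constant c) ⟩
      (con 1ℤ -ᴱ X) ^ᴱ r *ᴱ fromVector w +ᴱ con 0ℤ  ≈⟨ R.+-identityʳ _ ⟩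
      (con 1ℤ -ᴱ X) ^ᴱ r *ᴱ fromVector w            ∎)
      where open R.≈R

  cyclotomicRing : CyclotomicRing (suc m)
  cyclotomicRing = record
    { ring = ring
    ; ζ = X
    ; ζ^p≈1 = ζ^p≈1
    ; ∑ζ^i≈0 = ∑ζ^i≈0
    ; π-cancel = π-cancel
    ; residue = residue
    ; π∣ℤ⇒p∣ = λ {i} {y} → π∣ℤ⇒p∣ {i} {y}
    ; valAtLeast⇒π^∣ = valAtLeast⇒π^∣
    ; π^∣⇒valAtLeast = π^∣⇒valAtLeast
    }

-- Divisibility by powers of π.

finiteFin : ∀ k → Finite (Fin k)
finiteFin k = record { size = k ; enum = mk↔ₛ′ id id (λ _ → ≡.refl) (λ _ → ≡.refl) ; _≟_ = Fin._≟_ }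

prime⇒1< : ∀ {p} → Prime p → 1 ℕ.< p
prime⇒1< {p} pr = ℕ.nonTrivial⇒n>1 p {{prime⇒nonTrivial pr}}

module Valuation {p : ℕ} (pr : Prime p) (𝒪 : CyclotomicRing p) where
  open CyclotomicRing 𝒪
  open RingProperties (CyclotomicRing.ring 𝒪) hiding (ring)
  open ≈R

  p-1 : ℕ
  p-1 = p ℕ.∸ 1

  1≤p-1 : 1 ℕ.≤ p-1
  1≤p-1 = ℕₚ.m<n⇒0<n∸m (prime⇒1< pr)

  suc-p-1 : suc p-1 ≡ p
  suc-p-1 = ℕₚ.suc-pred p {{prime⇒nonZero pr}}

  private
    -- This is ζ - 1, so that (t + 1)^p = 1.
    t : ∣R∣
    t = - π

    s : ∣R∣
    s = proj₁ (Binomial.prime-expansion ring pr t)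

    P : ∣R∣
    P = fromℕ· p

    -- Expand 1 = ζ^p = (t + 1)^p by `prime-expansion` and cancel one factor `π`.
    t^p-1 : t ^ p-1 ≈ - (P * (1# + t * s))
    t^p-1 = +-inverseˡ-unique _ _ (π-cancel (begin
      π * (t ^ p-1 + P * (1# + t * s))
        ≈⟨ solve 4 (λ π u P a → π :* (u :+ P :* a) := :- ((:- π) :* u :+ P :* ((:- π) :* a))) refl π (t ^ p-1) P (1# + t * s) ⟩
      - (t ^ suc p-1 + P * (t * (1# + t * s)))
        ≡⟨ ≡.cong (λ k → - (t ^ k + P * (t * (1# + t * s)))) suc-p-1 ⟩
      - (t ^ p + P * (t * (1# + t * s)))
        ≈⟨ solve 2 (λ u v → :- (u :+ v) := con (+ 1) :- (con (+ 1) :+ v :+ u)) refl (t ^ p) (P * (t * (1# + t * s))) ⟩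
      1# - (1# + P * (t * (1# + t * s)) + t ^ p)
        ≈⟨ +-congˡ (-‿cong (sym (proj₂ (Binomial.prime-expansion ring pr t)))) ⟩
      1# - (t + 1#) ^ p
        ≈⟨ +-congˡ (-‿cong (^-congˡ p (solve 1 (λ z → :- (con (+ 1) :- z) :+ con (+ 1) := z) refl ζ))) ⟩
      1# - ζ ^ p
        ≈⟨ x≈y⇒x-y≈0 (sym ζ^p≈1) ⟩
      0# ∎))
      where open Solver

    ε : ∣R∣
    ε = (- 1#) ^ p-1

    t^-π^ : t ^ p-1 ≈ ε * π ^ p-1
    t^-π^ = trans (^-congˡ p-1 (solve 1 (λ x → :- x := :- con (+ 1) :* x) refl π)) (^-distrib-* (- 1#) π p-1)
      where open Solver

    ε*ε : ε * ε ≈ 1#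
    ε*ε = trans (sym (^-distrib-* (- 1#) (- 1#) p-1))
      (trans (^-congˡ p-1 (solve 0 (:- con (+ 1) :* :- con (+ 1) := con (+ 1)) refl)) (1^n≈1 p-1))
      where open Solver

  π^p-1≈p* : Σ ∣R∣ λ e → π ^ p-1 ≈ P * e
  π^p-1≈p* = - (ε * (1# + t * s)) , (begin
    π ^ p-1                        ≈⟨ sym (*-identityˡ _) ⟩
    1# * π ^ p-1                   ≈⟨ *-congʳ (sym ε*ε) ⟩
    ε * ε * π ^ p-1                ≈⟨ *-assoc ε ε _ ⟩
    ε * (ε * π ^ p-1)              ≈⟨ *-congˡ (trans (sym t^-π^) t^p-1) ⟩
    ε * (- (P * (1# + t * s)))     ≈⟨ solve 3 (λ ε P a → ε :* (:- (P :* a)) := P :* (:- (ε :* a))) refl ε P (1# + t * s) ⟩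
    P * (- (ε * (1# + t * s)))     ∎)
    where open Solver

  private
    -- p = - t^(p-1) - p t s, substituted into itself k times.
    iterate : ∀ k → Σ ∣R∣ λ a → Σ ∣R∣ λ b → P ≈ t ^ p-1 * a + P * (t ^ k * b)
    iterate zero = 0# , 1# , solve 2 (λ P u → P := u :* con (+ 0) :+ P :* (con (+ 1) :* con (+ 1))) refl P (t ^ p-1)
      where open Solver
    iterate (suc k) with iterate k
    ... | a , b , h = a - t ^ k * b , - (s * b) , trans h (begin
      t ^ p-1 * a + P * (t ^ k * b)
        ≈⟨ solve 6 (λ u a P v b w → u :* a :+ P :* (v :* b)
             := u :* a :+ (P :* (con (+ 1) :+ w)) :* (v :* b) :- P :* (w :* (v :* b))) refl
             (t ^ p-1) a P (t ^ k) b (t * s) ⟩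
      t ^ p-1 * a + P * (1# + t * s) * (t ^ k * b) - P * (t * s * (t ^ k * b))
        ≈⟨ +-congʳ (+-congˡ (*-congʳ (trans (sym (-‿involutive _)) (-‿cong (sym t^p-1))))) ⟩
      t ^ p-1 * a + (- (t ^ p-1)) * (t ^ k * b) - P * (t * s * (t ^ k * b))
        ≈⟨ solve 7 (λ u a P v b s t → u :* a :+ (:- u) :* (v :* b) :- P :* (t :* s :* (v :* b))
             := u :* (a :- v :* b) :+ P :* (t :* v :* (:- (s :* b)))) refl (t ^ p-1) a P (t ^ k) b s t ⟩
      t ^ p-1 * (a - t ^ k * b) + P * (t ^ suc k * (- (s * b))) ∎)
      where open Solver

  record Divides (k : ℕ) (x : ∣R∣) : Set where
    constructor _,_
    field
      quotient      : ∣R∣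
      factorisation : x ≈ π ^ k * quotient
  open Divides

  -- In place of an inverse of 1 + t s: after p - 1 rounds of `iterate` the remaining term carries
  -- t^(p-1) too, which then factors out of p.
  p≈π^p-1* : Divides p-1 P
  p≈π^p-1* with iterate p-1
  ... | a , b , h = ε * (a + P * b) , (begin
    P                                   ≈⟨ h ⟩
    t ^ p-1 * a + P * (t ^ p-1 * b)     ≈⟨ solve 4 (λ u a P b → u :* a :+ P :* (u :* b) := u :* (a :+ P :* b)) refl (t ^ p-1) a P b ⟩
    t ^ p-1 * (a + P * b)               ≈⟨ *-congʳ (trans t^-π^ (*-comm ε _)) ⟩
    π ^ p-1 * ε * (a + P * b)           ≈⟨ *-assoc _ ε _ ⟩
    π ^ p-1 * (ε * (a + P * b))         ∎)
    where open Solver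

  fromℕ·-^ : ∀ k m → fromℕ· (k ℕ.^ m) ≈ fromℕ· k ^ m
  fromℕ·-^ k zero    = +-identityʳ 1#
  fromℕ·-^ k (suc m) = trans (×1-homo-* k (k ℕ.^ m)) (*-congˡ (fromℕ·-^ k m))

  -- The converse of `Divides-Q`. It turns a factor Q into a power of `π`, which can be cancelled.
  Q*≈π^ : ∀ m → Σ ∣R∣ λ e → fromℕ· (p ℕ.^ m) * e ≈ π ^ (p-1 ℕ.* m)
  Q*≈π^ m = e ^ m , (begin
    fromℕ· (p ℕ.^ m) * e ^ m  ≈⟨ *-congʳ (fromℕ·-^ p m) ⟩
    P ^ m * e ^ m             ≈⟨ sym (^-distrib-* P e m) ⟩
    (P * e) ^ m               ≈⟨ ^-congˡ m (sym (proj₂ π^p-1≈p*)) ⟩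
    (π ^ p-1) ^ m             ≈⟨ ^-assocʳ π p-1 m ⟩
    π ^ (p-1 ℕ.* m)           ∎)
    where e = proj₁ π^p-1≈p*

  Divides-resp : ∀ {k x y} → x ≈ y → Divides k x → Divides k y
  Divides-resp eq (z , h) = z , trans (sym eq) h

  Divides-* : ∀ {k x} y → Divides k x → Divides k (x * y)
  Divides-* y (z , h) = z * y , trans (*-congʳ h) (*-assoc _ _ _)

  Divides-+ : ∀ {k x y} → Divides k x → Divides k y → Divides k (x + y)
  Divides-+ (z , h) (w , g) = z + w , trans (+-cong h g) (sym (distribˡ _ _ _))

  Divides-neg : ∀ {k x} → Divides k x → Divides k (- x)
  Divides-neg (z , h) = - z , trans (-‿cong h) (-‿distribʳ-* _ _)

  Divides-0 : ∀ k → Divides k 0#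
  Divides-0 k = 0# , sym (zeroʳ _)

  Divides-≤ : ∀ {j k x} → j ℕ.≤ k → Divides k x → Divides j x
  Divides-≤ {j} {k} j≤k (y , h) = π ^ (k ℕ.∸ j) * y ,
    trans h (trans (*-congʳ (trans (reflexive (≡.cong (π ^_) (≡.sym (ℕₚ.m+[n∸m]≡n j≤k)))) (^-homo-* π j (k ℕ.∸ j)))) (*-assoc _ _ _))

  open Finite
  open SemiringSum commutativeSemiring using (∑; ∑-cong; ∑-*ˡ)

  Divides-∑ : ∀ {k A} (FA : Finite A) {f : A → ∣R∣} → (∀ x → Divides k (f x)) → Divides k (∑ FA f)
  Divides-∑ FA h = ∑ FA (λ x → quotient (h x)) , trans (∑-cong FA (λ x → factorisation (h x))) (sym (∑-*ˡ FA _ _))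

  Divides-Q : ∀ m → Divides (p-1 ℕ.* m) (fromℕ· (p ℕ.^ m))
  Divides-Q m = f ^ m , (begin
    fromℕ· (p ℕ.^ m)        ≈⟨ fromℕ·-^ p m ⟩
    P ^ m                   ≈⟨ ^-congˡ m (factorisation p≈π^p-1*) ⟩
    (π ^ p-1 * f) ^ m       ≈⟨ ^-distrib-* (π ^ p-1) f m ⟩
    (π ^ p-1) ^ m * f ^ m   ≈⟨ *-congʳ (^-assocʳ π p-1 m) ⟩
    π ^ (p-1 ℕ.* m) * f ^ m ∎)
    where f = quotient p≈π^p-1*

  π^-cancel : ∀ k {x y} → π ^ k * x ≈ π ^ k * y → x ≈ y
  π^-cancel zero    eq = trans (sym (*-identityˡ _)) (trans eq (*-identityˡ _))
  π^-cancel (suc k) {x} {y} eq = π^-cancel k (x-y≈0⇒x≈y (π-cancel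
    (trans (solve 4 (λ π u x y → π :* (u :* x :- u :* y) := π :* u :* x :- π :* u :* y) refl π (π ^ k) x y)
      (x≈y⇒x-y≈0 eq))))
    where open Solver

  Divides-cancel : ∀ k j {x} → Divides (k ℕ.+ j) (π ^ k * x) → Divides j x
  Divides-cancel k j (y , h) = y , π^-cancel k (trans h (trans (*-congʳ (^-homo-* π k j)) (*-assoc _ _ _)))

  Divides-p : Divides 1 P
  Divides-p = Divides-≤ 1≤p-1 p≈π^p-1*

  fromℤ-π∣ : ∀ i → p ∣ ℤ.∣ i ∣ → Divides 1 (fromℤ i)
  fromℤ-π∣ (+ n) (divides q ≡.refl) = Divides-resp (trans (*-comm _ _) (sym (×1-homo-* q p))) (Divides-* (fromℕ· q) Divides-p)
  fromℤ-π∣ -[1+ n ] (divides q eq) = Divides-resp (-‿cong (trans (*-comm _ _) (trans (sym (×1-homo-* q p)) (reflexive (≡.cong fromℕ· (≡.sym eq))))))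
    (Divides-neg (Divides-* (fromℕ· q) Divides-p))

  π∣fromℤ : ∀ i → Divides 1 (fromℤ i) → p ∣ ℤ.∣ i ∣
  π∣fromℤ i (y , h) = π∣ℤ⇒p∣ {i} {y} (trans h (*-congʳ (*-identityʳ π)))

  -- Modulo `π` the element x is an integer, and `π` divides an integer exactly when p does.
  π∣_≟ : ∀ x → Dec (Divides 1 x)
  π∣ x ≟ with residue x
  ... | i , y , h with p ∣? ℤ.∣ i ∣
  ...   | yes d = yes (Divides-resp (sym h) (Divides-+ (fromℤ-π∣ i d) (y , *-congʳ (sym (*-identityʳ π)))))
  ...   | no ¬d = no λ d → ¬d (π∣fromℤ i (Divides-resp
            (trans (+-congʳ h) (solve 2 (λ a b → a :+ b :+ :- b := a) refl (fromℤ i) (π * y)))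
            (Divides-+ d (Divides-neg (y , *-congʳ (sym (*-identityʳ π)))))))
    where open Solver

  -- One factor `π` at a time; a negative answer for the quotient is final because `π` can be
  -- cancelled. Decidability allows the least divisible Weil sum to be found by search.
  Divides? : ∀ k x → Dec (Divides k x)
  Divides? zero    x = yes (x , sym (*-identityˡ x))
  Divides? (suc k) x with π∣ x ≟
  ... | no ¬d = no λ d → ¬d (Divides-≤ {1} (s≤s z≤n) d)
  ... | yes (y , h) with Divides? k y
  ...   | yes (z , g) = yes (z , trans h (trans (*-cong (*-identityʳ π) g) (sym (*-assoc _ _ _))))
  ...   | no ¬d = no λ d → ¬d (Divides-cancel 1 k (Divides-resp h d))

-- Absolute trace, additive character and Weil sums of one field.

module Character {p : ℕ} (pr : Prime p) (𝒪 : CyclotomicRing p)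
                 (F : FiniteField) (n : ℕ) (1≤n : 1 ℕ.≤ n) (cd : HasCharDeg F p n) where
  open HasCharDeg cd
  open FieldProperties F
  open Characteristic F pr charp
  open CyclotomicRing 𝒪 using (ζ; π; ζ^p≈1; π-cancel; fromVector)
  private
    module R = RingProperties (CyclotomicRing.ring 𝒪)
    module RS = SemiringSum R.commutativeSemiring
    open R.Solver using () renaming (solve to solveᴿ; con to conᴿ; _:=_ to _:=ᴿ_; _:+_ to _:+ᴿ_; _:*_ to _:*ᴿ_; _:-_ to _:-ᴿ_; :-_ to -:ᴿ_)
  open Valuation pr 𝒪 using (Divides; module Divides)
  open ≡ using (refl; sym; trans; cong; cong₂; subst)

  1<p : 1 ℕ.< p
  1<p = prime⇒1< pr

  fromℕ·-difference : ∀ {i j} → i ℕ.≤ j → fromℕ· i ≡ fromℕ· j → p ∣ j ℕ.∸ i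
  fromℕ·-difference {i} {j} i≤j eq = fromℕ·≡0⇒∣ (j ℕ.∸ i) (begin
    fromℕ· (j ℕ.∸ i)                          ≡⟨ solve 2 (λ a b → b := a :+ b :- a) refl (fromℕ· i) _ ⟩
    fromℕ· i + fromℕ· (j ℕ.∸ i) - fromℕ· i    ≡⟨ cong (_- fromℕ· i) (×-homo-+ 1# i (j ℕ.∸ i)) ⟨
    fromℕ· (i ℕ.+ (j ℕ.∸ i)) - fromℕ· i       ≡⟨ cong (λ k → fromℕ· k - fromℕ· i) (ℕₚ.m+[n∸m]≡n i≤j) ⟩
    fromℕ· j - fromℕ· i                       ≡⟨ x≈y⇒x-y≈0 (sym eq) ⟩
    0#                                        ∎)
    where open ≡.≡-Reasoning
          open Solver

  private
    fromℕ·-injective-≤ : ∀ {i j} → i ℕ.≤ j → j ℕ.< p → fromℕ· i ≡ fromℕ· j → i ≡ j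
    fromℕ·-injective-≤ {i} {j} i≤j j<p eq with j ℕ.∸ i | fromℕ·-difference i≤j eq | ℕₚ.m∸n≤m j i | ℕₚ.m+[n∸m]≡n i≤j
    ... | zero  | _   | _    | i≡j = trans (sym (ℕₚ.+-identityʳ i)) i≡j
    ... | suc l | p∣l | l≤j  | _   = ⊥-elim (ℕₚ.<⇒≱ (ℕₚ.≤-<-trans l≤j j<p) (∣⇒≤ p∣l))

  fromℕ·-injective : ∀ {i j} → i ℕ.< p → j ℕ.< p → fromℕ· i ≡ fromℕ· j → i ≡ j
  fromℕ·-injective {i} {j} i<p j<p eq with ℕₚ.≤-total i j
  ... | inj₁ i≤j = fromℕ·-injective-≤ i≤j j<p eq
  ... | inj₂ j≤i = sym (fromℕ·-injective-≤ j≤i i<p (sym eq))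

  frobenius-p : ∀ x y → (x + y) ^ p ≡ x ^ p + y ^ p
  frobenius-p = Binomial.frobenius-+ (fieldRing F) pr p·1≡0

  fromℕ·^p : ∀ j → fromℕ· j ^ p ≡ fromℕ· j
  fromℕ·^p zero    = 0^ p {{prime⇒nonZero pr}}
  fromℕ·^p (suc j) = trans (frobenius-p 1# (fromℕ· j)) (cong₂ _+_ (1^n≈1 p) (fromℕ·^p j))

  -- Otherwise y and the p multiples of 1 would be p + 1 roots of X^p - X.
  primeField : ∀ y → y ^ p ≡ y → Σ (Fin p) λ j → fromℕ· (toℕ j) ≡ y
  primeField y y^p≡y with Finite.search (finiteFin p) (λ j → fromℕ· (toℕ j) ≟F y)
  ... | yes found = found
  ... | no none = ⊥-elim (ℕₚ.<-irrefl refl (ℕₚ.≤-trans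
      (ℕ-Sum.count-injection finite (λ x → (x ^ p + (- 1#) * x) ≟F 0#) (finiteFin (suc p)) g injective root)
      (frobenius-fibre-≤ p 1<p (- 1#) 0#)))
    where
    g : Fin (suc p) → Carrier
    g Fin.zero    = y
    g (Fin.suc j) = fromℕ· (toℕ j)
    injective : ∀ i j → g i ≡ g j → i ≡ j
    injective Fin.zero    Fin.zero    eq = refl
    injective Fin.zero    (Fin.suc j) eq = ⊥-elim (none (j , sym eq))
    injective (Fin.suc i) Fin.zero    eq = ⊥-elim (none (i , eq))
    injective (Fin.suc i) (Fin.suc j) eq = cong Fin.suc (Finₚ.toℕ-injective (fromℕ·-injective (toℕ<n i) (toℕ<n j) eq))
    fixed-root : ∀ x → x ^ p ≡ x → x ^ p + (- 1#) * x ≡ 0#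
    fixed-root x eq = trans (cong (_+ (- 1#) * x) eq) (solve 1 (λ x → x :+ (:- con (+ 1)) :* x := con (+ 0)) refl x)
      where open Solver
    root : ∀ i → g i ^ p + (- 1#) * g i ≡ 0#
    root Fin.zero    = fixed-root y y^p≡y
    root (Fin.suc j) = fixed-root _ (fromℕ·^p (toℕ j))

  trace : ℕ → Carrier → Carrier
  trace zero    x = 0#
  trace (suc k) x = x ^ (p ℕ.^ k) + trace k x

  Tr : Carrier → Carrier
  Tr = trace n

  -- The local function of traceF has no name; unification finds it for the underscore.
  mutual
    traceF≡trace : ∀ k x → traceF F p k x ≡ trace k x
    traceF≡trace zero    x = refl
    traceF≡trace (suc k) x with suc k
    ... | w = cong₂ _+_ (^F≡^ x (p ℕ.^ k)) (go≡trace x w k)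

    go≡trace : ∀ x w k → _ ≡ trace k x
    go≡trace x w zero    = refl
    go≡trace x w (suc k) = cong₂ _+_ (^F≡^ x (p ℕ.^ k)) (go≡trace x w k)

  trace-+ : ∀ k x y → trace k (x + y) ≡ trace k x + trace k y
  trace-+ zero    x y = sym (+-identityˡ _)
  trace-+ (suc k) x y = trans (cong₂ _+_ (frobenius k x y) (trace-+ k x y))
    (solve 4 (λ a b c d → (a :+ b) :+ (c :+ d) := (a :+ c) :+ (b :+ d)) refl
      (x ^ (p ℕ.^ k)) (y ^ (p ℕ.^ k)) (trace k x) (trace k y))
    where open Solver

  ^p-comm : ∀ x k → (x ^ p) ^ k ≡ (x ^ k) ^ p
  ^p-comm x k = trans (^-assocʳ x p k) (trans (cong (x ^_) (ℕₚ.*-comm p k)) (sym (^-assocʳ x k p)))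

  trace-^p : ∀ k x → trace k x ^ p ≡ trace k (x ^ p)
  trace-^p zero    x = 0^ p {{prime⇒nonZero pr}}
  trace-^p (suc k) x = trans (frobenius-p _ _) (cong₂ _+_ (sym (^p-comm x (p ℕ.^ k))) (trace-^p k x))

  -- Telescoping: a p-th power shifts the terms, so x^(p^k) enters and x leaves. For k = n these two
  -- are equal, whence `Tr-frobenius`.
  trace-shift : ∀ k x → trace k (x ^ p) + x ≡ x ^ (p ℕ.^ k) + trace k x
  trace-shift zero    x = trans (+-identityˡ x) (sym (trans (+-identityʳ _) (*-identityʳ x)))
  trace-shift (suc k) x = trans (+-assoc _ _ _) (cong₂ _+_ (^-assocʳ x p (p ℕ.^ k)) (trace-shift k x))

  x^q≡x : ∀ x → x ^ (p ℕ.^ n) ≡ x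
  x^q≡x x = subst (λ q → x ^ q ≡ x) order (x^size≡x x)

  Tr-frobenius : ∀ x → Tr (x ^ p) ≡ Tr x
  Tr-frobenius x = begin
    Tr (x ^ p)                    ≡⟨ solve 2 (λ a b → a := a :+ b :- b) refl (Tr (x ^ p)) x ⟩
    Tr (x ^ p) + x - x            ≡⟨ cong (_- x) (trans (trace-shift n x) (cong (_+ Tr x) (x^q≡x x))) ⟩
    x + Tr x - x                  ≡⟨ solve 2 (λ a b → b :+ a :- b := a) refl (Tr x) x ⟩
    Tr x                          ∎
    where open ≡.≡-Reasoning
          open Solver

  opaque
    Tr-index : ∀ x → Σ (Fin p) λ j → fromℕ· (toℕ j) ≡ Tr x
    Tr-index x = primeField (Tr x) (trans (trace-^p n x) (Tr-frobenius x))

  trace-scale : ∀ {c} → c ^ p ≡ c → ∀ k x → trace k (c * x) ≡ c * trace k x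
  trace-scale {c} c^p≡c zero    x = sym (zeroʳ c)
  trace-scale {c} c^p≡c (suc k) x = trans (cong₂ _+_ (trans (^-distrib-* c x (p ℕ.^ k)) (cong (_* x ^ (p ℕ.^ k)) (fixed k)))
      (trace-scale c^p≡c k x)) (sym (distribˡ c _ _))
    where
    fixed : ∀ k → c ^ (p ℕ.^ k) ≡ c
    fixed zero    = *-identityʳ c
    fixed (suc k) = trans (sym (^-assocʳ c p (p ℕ.^ k))) (trans (cong (_^ (p ℕ.^ k)) c^p≡c) (fixed k))

  private
    0<q : 0 ℕ.< p ℕ.^ n
    0<q = ℕₚ.m^n>0 p {{prime⇒nonZero pr}} n

    tracePolynomial : ∀ k → k ℕ.≤ n → Polynomial (p ℕ.^ n)
    tracePolynomial zero    _   = 0# ⊛ X^ 0 0<q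
    tracePolynomial (suc k) k<n = X^ (p ℕ.^ k) (ℕₚ.^-monoʳ-< p 1<p k<n) ⊕ tracePolynomial k (ℕₚ.<⇒≤ k<n)

    tracePolynomial-function : ∀ k k≤n x → function (tracePolynomial k k≤n) x ≡ trace k x
    tracePolynomial-function zero    _   x = zeroˡ _
    tracePolynomial-function (suc k) k<n x = cong (λ z → x ^ (p ℕ.^ k) + z) (tracePolynomial-function k _ x)

    -- Only the summand X^(p^0) has degree 1. This one coefficient keeps the trace, of degree below
    -- q, from vanishing identically.
    tracePolynomial-coefficient : ∀ k k<n → coefficient (tracePolynomial (suc k) k<n) 1 ≡ 1#
    tracePolynomial-coefficient zero    k<n = trans (cong₂ _+_ (𝟙-true (1 ℕ.≟ 1) refl) (zeroˡ (δ 0 1))) (+-identityʳ _)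
    tracePolynomial-coefficient (suc k) k<n = trans (cong₂ _+_
        (𝟙-false (p ℕ.^ suc k ℕ.≟ 1) (ℕₚ.>⇒≢ (ℕₚ.^-monoʳ-< p 1<p (s≤s (z≤n {k})))))
        (tracePolynomial-coefficient k _)) (+-identityˡ _)

    Tr-nonzero : Σ Carrier λ x → Tr x ≢ 0#
    Tr-nonzero with Finite.search-all finite (λ x → Tr x ≟F 0#)
    ... | inj₂ found = found
    ... | inj₁ all = ⊥-elim (1≢0 contra)
      where
      contra : 1# ≡ 0#
      contra = trans (sym (lead n ℕₚ.≤-refl 1≤n)) (polynomial-identity′ (tracePolynomial n ℕₚ.≤-refl)
          (λ x → trans (tracePolynomial-function n ℕₚ.≤-refl x) (all x)) (ℕₚ.^-monoʳ-< p 1<p 1≤n))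
        where
        lead : ∀ k k≤n → 1 ℕ.≤ k → coefficient (tracePolynomial k k≤n) 1 ≡ 1#
        lead (suc k) k<n _ = tracePolynomial-coefficient k k<n
        polynomial-identity′ : (P : Polynomial (p ℕ.^ n)) → (∀ x → function P x ≡ 0#) →
                               ∀ {i} → i ℕ.< p ℕ.^ n → coefficient P i ≡ 0#
        polynomial-identity′ = subst (λ q → (P : Polynomial q) → (∀ x → function P x ≡ 0#) →
                               ∀ {i} → i ℕ.< q → coefficient P i ≡ 0#) order polynomial-identity

  -- A nonzero trace satisfies c^p = c, and so does its inverse; the trace is linear in such
  -- factors, so one may divide by it.
  Tr-one : Σ Carrier λ x → Tr x ≡ 1#
  Tr-one with Tr-nonzero
  ... | x , ne = c * x , trans (trace-scale c^p≡c n x) (x⁻¹*x ne)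
    where
    c = Tr x ⁻¹⟨ ne ⟩
    c^p≡c : c ^ p ≡ c
    c^p≡c = *-cancelˡ ne (begin
      Tr x * c ^ p       ≡⟨ cong (_* c ^ p) (trans (trace-^p n x) (Tr-frobenius x)) ⟨
      Tr x ^ p * c ^ p   ≡⟨ ^-distrib-* (Tr x) c p ⟨
      (Tr x * c) ^ p     ≡⟨ cong (_^ p) (x*x⁻¹ ne) ⟩
      1# ^ p             ≡⟨ 1^n≈1 p ⟩
      1#                 ≡⟨ x*x⁻¹ ne ⟨
      Tr x * c           ∎)
      where open ≡.≡-Reasoning

  opaque
    ψ : Carrier → R.∣R∣
    ψ x = ζ R.^ toℕ (proj₁ (Tr-index x))

  private
    ζ^multiple : ∀ k → ζ R.^ (k ℕ.* p) R.≈ R.1#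
    ζ^multiple k = R.trans (R.reflexive (cong (ζ R.^_) (ℕₚ.*-comm k p)))
      (R.trans (R.sym (R.^-assocʳ ζ p k)) (R.trans (R.^-congˡ k ζ^p≈1) (R.1^n≈1 k)))

    ζ^-≤ : ∀ {i j} → i ℕ.≤ j → fromℕ· i ≡ fromℕ· j → ζ R.^ i R.≈ ζ R.^ j
    ζ^-≤ {i} {j} i≤j eq = R.trans (R.sym (R.*-identityʳ _)) (R.trans (R.*-congˡ (R.sym power))
        (R.trans (R.sym (R.^-homo-* ζ i (j ℕ.∸ i))) (R.reflexive (cong (ζ R.^_) (ℕₚ.m+[n∸m]≡n i≤j)))))
      where
      power : ζ R.^ (j ℕ.∸ i) R.≈ R.1#
      power with fromℕ·-difference i≤j eq
      ... | divides q eq = R.trans (R.reflexive (cong (ζ R.^_) eq)) (ζ^multiple q)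

  ζ^-cong : ∀ i j → fromℕ· i ≡ fromℕ· j → ζ R.^ i R.≈ ζ R.^ j
  ζ^-cong i j eq with ℕₚ.≤-total i j
  ... | inj₁ i≤j = ζ^-≤ i≤j eq
  ... | inj₂ j≤i = R.sym (ζ^-≤ j≤i (sym eq))

  opaque
    unfolding ψ

    ψ≈ζ^ : ∀ {x} j → fromℕ· j ≡ Tr x → ψ x R.≈ ζ R.^ j
    ψ≈ζ^ {x} j eq = ζ^-cong (toℕ (proj₁ (Tr-index x))) j (trans (proj₂ (Tr-index x)) (sym eq))

    ψ-index : ∀ x → ψ x ≡ ζ R.^ toℕ (proj₁ (Tr-index x))
    ψ-index x = refl

  ψ-Tr : ∀ {x y} → Tr x ≡ Tr y → ψ x R.≈ ψ y
  ψ-Tr {x} {y} eq = R.trans (ψ≈ζ^ (toℕ (proj₁ (Tr-index y))) (trans (proj₂ (Tr-index y)) (sym eq)))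
    (R.reflexive (sym (ψ-index y)))

  ψ-+ : ∀ x y → ψ (x + y) R.≈ ψ x R.* ψ y
  ψ-+ x y = begin
    ψ (x + y)                   ≈⟨ ψ≈ζ^ (i ℕ.+ j) (trans (×-homo-+ 1# i j) (trans (cong₂ _+_ (proj₂ (Tr-index x)) (proj₂ (Tr-index y)))
                                     (sym (trace-+ n x y)))) ⟩
    ζ R.^ (i ℕ.+ j)             ≈⟨ R.^-homo-* ζ i j ⟩
    ζ R.^ i R.* ζ R.^ j         ≡⟨ cong₂ R._*_ (ψ-index x) (ψ-index y) ⟨
    ψ x R.* ψ y                 ∎
    where
    open R.≈R
    i = toℕ (proj₁ (Tr-index x))
    j = toℕ (proj₁ (Tr-index y))

  ψ-0 : ψ 0# R.≈ R.1#
  ψ-0 = ψ≈ζ^ 0 (sym (trans (solve 1 (λ a → a := a :+ a :- a) refl (Tr 0#))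
      (x≈y⇒x-y≈0 (trans (sym (trace-+ n 0# 0#)) (cong Tr (+-identityˡ 0#))))))
    where open Solver

  ψ-frobenius : ∀ k x → ψ (x ^ (p ℕ.^ k)) R.≈ ψ x
  ψ-frobenius zero    x = R.reflexive (cong ψ (*-identityʳ x))
  ψ-frobenius (suc k) x = R.trans (R.reflexive (cong ψ (sym (^-assocʳ x p (p ℕ.^ k)))))
    (R.trans (ψ-frobenius k (x ^ p)) (ψ-Tr (Tr-frobenius x)))

  -- Translation by an element of trace 1 multiplies the sum by ζ, and 1 - ζ can be cancelled.
  ∑ψ≈0 : RS.∑ finite ψ R.≈ R.0#
  ∑ψ≈0 = π-cancel (R.trans (solveᴿ 2 (λ z s → (conᴿ (+ 1) :-ᴿ z) :*ᴿ s :=ᴿ s :-ᴿ z :*ᴿ s) R.refl ζ S)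
      (R.x≈y⇒x-y≈0 (R.trans shifted (R.sym (RS.∑-*ˡ finite ζ ψ)))))
    where
    S = RS.∑ finite ψ
    x₁ = proj₁ Tr-one
    open Solver
    ψx₁ : ψ x₁ R.≈ ζ
    ψx₁ = R.trans (ψ≈ζ^ 1 (trans (+-identityʳ 1#) (sym (proj₂ Tr-one)))) (R.*-identityʳ ζ)
    shifted : S R.≈ RS.∑ finite (λ x → ζ R.* ψ x)
    shifted = R.trans (RS.∑-bijection finite finite (λ y → x₁ + y) (λ y → y - x₁)
        (λ y → solve 2 (λ a y → a :+ (y :- a) := y) refl x₁ y)
        (λ y → solve 2 (λ a y → (a :+ y) :- a := y) refl x₁ y) ψ)
      (RS.∑-cong finite (λ x → R.trans (ψ-+ x₁ x) (R.*-congʳ ψx₁)))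

  scale-bijection : ∀ {a} → a ≢ 0# → ∀ f → RS.∑ finite f R.≈ RS.∑ finite (λ x → f (a * x))
  scale-bijection {a} a≢0 f = RS.∑-bijection finite finite (a *_) (a ⁻¹⟨ a≢0 ⟩ *_)
    (x*[x⁻¹*y] a≢0) (x⁻¹*[x*y] a≢0) f

  q : R.∣R∣
  q = R.fromℕ· size

  ∑-orthogonality : ∀ a → RS.∑ finite (λ x → ψ (a * x)) R.≈ RS.𝟙 (a ≟F 0#) R.* q
  ∑-orthogonality a with a ≟F 0#
  ... | no a≢0   = R.trans (R.trans (R.sym (scale-bijection a≢0 ψ)) ∑ψ≈0) (R.sym (R.zeroˡ q))
  ... | yes refl = R.trans (RS.∑-cong finite (λ x → R.trans (R.reflexive (cong ψ (zeroˡ x))) ψ-0))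
    (R.trans (RS.∑-const finite R.1#) (R.sym (R.*-identityˡ q)))

  module _ (d : ℕ) where

    W : Carrier → R.∣R∣
    W a = RS.∑ finite (λ x → ψ (x ^ d - a * x))

    private
      module ℤS = Algebra.Properties.CommutativeMonoid.Sum ℤₚ.+-0-commutativeMonoid

    -- As for traceF, unification finds the local function of sumF.
    mutual
      sumF≡sum : ∀ f → FiniteField.sumF F f ≡ ℤS.sum (f ∘ Inverse.to (FiniteField.enum F))
      sumF≡sum f with FiniteField.size F | Inverse.to (FiniteField.enum F)
      ... | m | g = go≡sum f m g

      go≡sum : ∀ f m (g : Fin m → Carrier) → _ ≡ ℤS.sum (f ∘ g)
      go≡sum f zero    g = refl
      go≡sum f (suc m) g = cong (λ z → f (g Fin.zero) ℤ.+ z) (go≡sum f m (g ∘ Fin.suc))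

    private
      fromℤ-sum : ∀ {m} (f : Fin m → ℤ) → R.fromℤ (ℤS.sum f) R.≈ R.sum (R.fromℤ ∘ f)
      fromℤ-sum {zero}  f = R.refl
      fromℤ-sum {suc m} f = R.trans (R.fromℤ-+ (f Fin.zero) _) (R.+-congˡ (fromℤ-sum (f ∘ Fin.suc)))

      fromℤ-sumF : ∀ f → R.fromℤ (FiniteField.sumF F f) R.≈ RS.∑ finite (R.fromℤ ∘ f)
      fromℤ-sumF f = R.trans (R.reflexive (cong R.fromℤ (sumF≡sum f)))
        (R.trans (fromℤ-sum (f ∘ Inverse.to (FiniteField.enum F))) (R.reflexive (sym (RS.∑-unfold finite (R.fromℤ ∘ f)))))

      summand : Carrier → Fin p → Carrier → ℤ
      summand a j x = if ⌊ (toℕ j • 1#) ≟F traceF F p n ((x ^F d) + (- (a * x))) ⌋ then + 1 else + 0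

      fromℤ-summand : ∀ a j x → R.fromℤ (summand a j x)
        R.≈ RS.𝟙 (Fin._≟_ (proj₁ (Tr-index (x ^ d - a * x))) j)
      fromℤ-summand a j x with (toℕ j • 1#) ≟F traceF F p n ((x ^F d) + (- (a * x)))
      ... | yes eq = R.trans (R.+-identityʳ R.1#) (R.sym (RS.𝟙-true (Fin._≟_ (proj₁ (Tr-index (x ^ d - a * x))) j)
              (Finₚ.toℕ-injective (fromℕ·-injective (toℕ<n _) (toℕ<n j)
                (trans (proj₂ (Tr-index (x ^ d - a * x))) (sym (trans (sym (•≡· (toℕ j) 1#)) (trans eq
                  (trans (traceF≡trace n _) (cong (λ y → Tr (y - a * x)) (^F≡^ x d)))))))))))
      ... | no ne = R.sym (RS.𝟙-false (Fin._≟_ (proj₁ (Tr-index (x ^ d - a * x))) j) λ eq → ne (trans (•≡· (toℕ j) 1#)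
              (trans (trans (cong (fromℕ· ∘ toℕ) (sym eq)) (proj₂ (Tr-index (x ^ d - a * x))))
                (sym (trans (traceF≡trace n _) (cong (λ y → Tr (y - a * x)) (^F≡^ x d)))))))

    -- Coefficient j counts the x for which the summand is ζ^j. This connects the counting vector
    -- with the sum in ℤ[ζ] on which the proof works.
    fromVector-weil : ∀ a → fromVector (weil F p n d a) R.≈ W a
    fromVector-weil a = begin
      R.sum (λ j → R.fromℤ (weil F p n d a j) R.* ζ R.^ toℕ j)
        ≡⟨ RS.∑-unfold (finiteFin p) (λ j → R.fromℤ (weil F p n d a j) R.* ζ R.^ toℕ j) ⟨
      RS.∑ (finiteFin p) (λ j → R.fromℤ (weil F p n d a j) R.* ζ R.^ toℕ j)
        ≈⟨ RS.∑-cong (finiteFin p) (λ j → R.trans (R.*-congʳ (fromℤ-sumF (summand a j))) (RS.∑-*ʳ finite (ζ R.^ toℕ j) (R.fromℤ ∘ summand a j))) ⟩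
      RS.∑ (finiteFin p) (λ j → RS.∑ finite (λ x → R.fromℤ (summand a j x) R.* ζ R.^ toℕ j))
        ≈⟨ RS.∑-swap (finiteFin p) finite _ ⟩
      RS.∑ finite (λ x → RS.∑ (finiteFin p) (λ j → R.fromℤ (summand a j x) R.* ζ R.^ toℕ j))
        ≈⟨ RS.∑-cong finite (λ x → R.trans (RS.∑-cong (finiteFin p) (λ j → R.*-congʳ (fromℤ-summand a j x)))
             (R.trans (RS.∑-select (finiteFin p) (proj₁ (Tr-index (x ^ d - a * x))) (λ j → ζ R.^ toℕ j))
               (R.reflexive (sym (ψ-index (x ^ d - a * x)))))) ⟩
      W a ∎
      where open R.≈R

    valAtLeast⇒Divides : ∀ a r → valAtLeast (weil F p n d a) r → Divides r (W a)
    valAtLeast⇒Divides a r v with CyclotomicRing.valAtLeast⇒π^∣ 𝒪 (weil F p n d a) r v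
    ... | y , h = record { quotient = y ; factorisation = R.trans (R.sym (fromVector-weil a)) h }

    Divides⇒valAtLeast : ∀ a r → Divides r (W a) → valAtLeast (weil F p n d a) r
    Divides⇒valAtLeast a r v = CyclotomicRing.π^∣⇒valAtLeast 𝒪 (weil F p n d a) r
      (Divides.quotient v) (R.trans (fromVector-weil a) (Divides.factorisation v))

-- Quadratic extensions and the subfield of order √q.

module _ (p m : ℕ) (E K : FiniteField) where
  private
    module E = FieldProperties E
    module K = FieldProperties K

  record QuadraticExtension : Set where
   field
    charE         : HasCharDeg E p (m ℕ.+ m)
    charK         : HasCharDeg K p m
    ι             : K.Carrier → E.Carrier
    ι-injective   : ∀ {x y} → ι x ≡ ι y → x ≡ y
    ι-+           : ∀ x y → ι (x K.+ y) ≡ ι x E.+ ι y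
    ι-*           : ∀ x y → ι (x K.* y) ≡ ι x E.* ι y
    ι-1           : ι K.1# ≡ E.1#
    ι-fixed       : ∀ k → ι k E.^ (p ℕ.^ m) ≡ ι k
    fixed         : ∀ x → x E.^ (p ℕ.^ m) ≡ x → Σ K.Carrier λ k → ι k ≡ x
    tr            : E.Carrier → K.Carrier
    ι-tr          : ∀ x → ι (tr x) ≡ x E.+ x E.^ (p ℕ.^ m)
    norm          : E.Carrier → K.Carrier
    ι-norm        : ∀ x → ι (norm x) ≡ x E.* x E.^ (p ℕ.^ m)
    tr-fibre      : ∀ y → ℕ-Sum.count E.finite (λ x → tr x K.≟F y) ≡ p ℕ.^ m

module FixedField {p : ℕ} (pr : Prime p) (m : ℕ) (1≤m : 1 ℕ.≤ m)
                  (E : FiniteField) (cd : HasCharDeg E p (m ℕ.+ m)) where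
  open HasCharDeg cd
  open FieldProperties E
  open Characteristic E pr charp
  open ≡ using (refl; sym; trans; cong; cong₂; subst)

  Q : ℕ
  Q = p ℕ.^ m

  1<Q : 1 ℕ.< Q
  1<Q = ℕₚ.^-monoʳ-< p (prime⇒1< pr) 1≤m

  Q≢0 : NonZero Q
  Q≢0 = p^k-nonZero m

  size≡Q*Q : size ≡ Q ℕ.* Q
  size≡Q*Q = trans order (ℕₚ.^-distribˡ-+-* p m m)

  σ-involutive : ∀ x → (x ^ Q) ^ Q ≡ x
  σ-involutive x = trans (^-assocʳ x Q Q) (trans (cong (x ^_) (sym size≡Q*Q)) (x^size≡x x))

  private
    Fixed : Carrier → Set
    Fixed x = x ^ Q ≡ x

    Fix : Set
    Fix = Σ Carrier Fixed

    ext : {x y : Fix} → proj₁ x ≡ proj₁ y → x ≡ y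
    ext {x , p} {_ , q} refl = cong (x ,_) (irrelevant p q)

    finiteC : Finite Fix
    finiteC = ℕ-Sum.subset finite (λ x → (x ^ Q) ≟F x) (λ _ → irrelevant)

    _+C_ _*C_ : Fix → Fix → Fix
    (x , p) +C (y , q) = x + y , trans (frobenius m x y) (cong₂ _+_ p q)
    (x , p) *C (y , q) = x * y , trans (^-distrib-* x y Q) (cong₂ _*_ p q)

    -C_ : Fix → Fix
    -C (x , p) = - x , trans (frobenius-neg m x) (cong -_ p)

    0C 1C : Fix
    0C = 0# , 0^ Q {{Q≢0}}
    1C = 1# , 1^n≈1 Q

    isCommutativeRingC : IsCommutativeRing _≡_ _+C_ _*C_ -C_ 0C 1C
    isCommutativeRingC = record
      { isRing = record
        { +-isAbelianGroup = record
          { isGroup = record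
            { isMonoid = record
              { isSemigroup = record
                { isMagma = record { isEquivalence = ≡.isEquivalence ; ∙-cong = cong₂ _+C_ }
                ; assoc = λ x y z → ext (+-assoc _ _ _)
                }
              ; identity = (λ x → ext (+-identityˡ _)) , (λ x → ext (+-identityʳ _))
              }
            ; inverse = (λ x → ext (-‿inverseˡ _)) , (λ x → ext (-‿inverseʳ _))
            ; ⁻¹-cong = cong -C_
            }
          ; comm = λ x y → ext (+-comm _ _)
          }
        ; *-cong = cong₂ _*C_
        ; *-assoc = λ x y z → ext (*-assoc _ _ _)
        ; *-identity = (λ x → ext (*-identityˡ _)) , (λ x → ext (*-identityʳ _))
        ; distrib = (λ x y z → ext (distribˡ _ _ _)) , (λ x y z → ext (distribʳ _ _ _))
        }
      ; *-comm = λ x y → ext (*-comm _ _)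
      }

    inverseC : (x : Fix) → x ≢ 0C → Σ Fix λ y → x *C y ≡ 1C
    inverseC (x , fx) ne = (y , fy) , ext (x*x⁻¹ x≢0)
      where
      x≢0 : x ≢ 0#
      x≢0 eq = ne (ext eq)
      y = x ⁻¹⟨ x≢0 ⟩
      fy : y ^ Q ≡ y
      fy = *-cancelˡ x≢0 (begin
        x * y ^ Q       ≡⟨ cong (_* y ^ Q) fx ⟨
        x ^ Q * y ^ Q   ≡⟨ ^-distrib-* x y Q ⟨
        (x * y) ^ Q     ≡⟨ cong (_^ Q) (x*x⁻¹ x≢0) ⟩
        1# ^ Q          ≡⟨ 1^n≈1 Q ⟩
        1#              ≡⟨ x*x⁻¹ x≢0 ⟨
        x * y           ∎)
        where open ≡.≡-Reasoning

  private
    tr norm : Carrier → Fix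
    tr x = x + x ^ Q , trans (frobenius m x (x ^ Q)) (trans (cong (λ z → x ^ Q + z) (σ-involutive x)) (+-comm _ _))
    norm x = x * x ^ Q , trans (^-distrib-* x (x ^ Q) Q) (trans (cong (x ^ Q *_) (σ-involutive x)) (*-comm _ _))

    module N = ℕ-Sum

    fibre : Fix → ℕ
    fibre y = N.count finite (λ x → Finite._≟_ finiteC (tr x) y)

    fibre-≤ : ∀ y → fibre y ℕ.≤ Q
    fibre-≤ y = ℕₚ.≤-trans (N.count-mono finite (λ x → Finite._≟_ finiteC (tr x) y) (λ x → (x ^ Q + 1# * x) ≟F proj₁ y) λ x eq →
        trans (cong (λ z → x ^ Q + z) (*-identityˡ x)) (trans (+-comm _ _) (cong proj₁ eq)))
      (frobenius-fibre-≤ Q 1<Q 1# (proj₁ y))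

    sizeK≤Q : Finite.size finiteC ℕ.≤ Q
    sizeK≤Q = ℕₚ.≤-trans (N.count-mono finite (λ x → (x ^ Q) ≟F x) (λ x → (x ^ Q + (- 1#) * x) ≟F 0#) λ x eq →
        trans (cong (_+ (- 1#) * x) eq) (solve 1 (λ x → x :+ (:- con (+ 1)) :* x := con (+ 0)) refl x))
      (frobenius-fibre-≤ Q 1<Q (- 1#) 0#)
      where open Solver

    ∑fibre : N.∑ finiteC fibre ≡ Q ℕ.* Q
    ∑fibre = begin
      N.∑ finiteC fibre
        ≡⟨ N.∑-swap finite finiteC (λ x y → N.𝟙 (Finite._≟_ finiteC (tr x) y)) ⟨
      N.∑ finite (λ x → N.∑ finiteC (λ y → N.𝟙 (Finite._≟_ finiteC (tr x) y)))
        ≡⟨ N.∑-cong finite (λ x → N.∑-𝟙 finiteC (tr x)) ⟩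
      N.∑ finite (λ _ → 1)
        ≡⟨ N.∑-constant finite 1 ⟩
      size ℕ.* 1
        ≡⟨ trans (ℕₚ.*-identityʳ size) size≡Q*Q ⟩
      Q ℕ.* Q ∎
      where open ≡.≡-Reasoning

    -- The Q^2 elements of E are distributed over the fibres of the trace, one fibre for each fixed
    -- element, and each fibre has at most Q of them. With `sizeK≤Q` all these bounds become
    -- equalities, so all fibres have exactly Q elements.
    Q≤sizeK : Q ℕ.≤ Finite.size finiteC
    Q≤sizeK = ℕₚ.*-cancelʳ-≤ Q _ Q {{Q≢0}} (ℕₚ.≤-trans (ℕₚ.≤-reflexive (sym ∑fibre))
      (ℕₚ.≤-trans (N.∑-mono finiteC fibre-≤) (ℕₚ.≤-reflexive (N.∑-constant finiteC Q))))

    sizeK : Finite.size finiteC ≡ Q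
    sizeK = ℕₚ.≤-antisym sizeK≤Q Q≤sizeK

    fibre≡Q : ∀ y → fibre y ≡ Q
    fibre≡Q = N.∑-squeeze finiteC fibre-≤ (ℕₚ.≤-reflexive (trans (N.∑-constant finiteC Q)
      (trans (cong (ℕ._* Q) sizeK) (sym ∑fibre))))

  private
    fixedField : FiniteField
    fixedField = record
      { Carrier = Fix ; _+_ = _+C_ ; _*_ = _*C_ ; -_ = -C_ ; 0# = 0C ; 1# = 1C
      ; isCommutativeRing = isCommutativeRingC
      ; 1≢0 = 1≢0 ∘ cong proj₁
      ; inverse = inverseC
      ; _≟F_ = Finite._≟_ finiteC
      ; size = Finite.size finiteC
      ; enum = Finite.enum finiteC
      }

    proj₁-• : ∀ k (x : Fix) → proj₁ (FiniteField._•_ fixedField k x) ≡ FiniteField._•_ E k (proj₁ x)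
    proj₁-• zero    x = refl
    proj₁-• (suc k) x = cong (λ z → proj₁ x + z) (proj₁-• k x)

    fixedFieldExtension : QuadraticExtension p m E fixedField
    fixedFieldExtension = record
      { charE = cd
      ; charK = record { charp = ext (trans (proj₁-• p 1C) charp) ; order = sizeK }
      ; ι = proj₁
      ; ι-injective = ext
      ; ι-+ = λ _ _ → refl
      ; ι-* = λ _ _ → refl
      ; ι-1 = refl
      ; ι-fixed = proj₂
      ; fixed = λ x eq → (x , eq) , refl
      ; tr = tr
      ; ι-tr = λ _ → refl
      ; norm = norm
      ; ι-norm = λ _ → refl
      ; tr-fibre = fibre≡Q
      }

  opaque
    K : FiniteField
    K = fixedField

    extension : QuadraticExtension p m E K
    extension = fixedFieldExtension

-- Reduction modulo π and the group algebra of K.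

-- θ is reduction modulo π, with the residue field 𝔽_p embedded in K.
module Reduction {p : ℕ} (pr : Prime p) (𝒪 : CyclotomicRing p) (K : FiniteField)
                 (charp : FiniteField._•_ K p (FiniteField.1# K) ≡ FiniteField.0# K) where
  open CyclotomicRing 𝒪 using (π; residue)
  private
    module R = RingProperties (CyclotomicRing.ring 𝒪)
    module RS = SemiringSum R.commutativeSemiring
    open R.Solver using () renaming (solve to solveᴿ; con to conᴿ; _:=_ to _:=ᴿ_; _:+_ to _:+ᴿ_; _:*_ to _:*ᴿ_; _:-_ to _:-ᴿ_; :-_ to -:ᴿ_)
  open FieldProperties K
  open Characteristic K pr charp
  open Valuation pr 𝒪
  open ≡ using (refl; sym; trans; cong; cong₂; subst)

  multiple⇒≡0 : ∀ i → p ∣ ℤ.∣ i ∣ → fromℤ i ≡ 0#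
  multiple⇒≡0 (+ n)    (divides q refl) = multiple·1≡0 q
  multiple⇒≡0 -[1+ n ] (divides q eq)   = trans (cong (-_ ∘ fromℕ·) eq) (trans (cong -_ (multiple·1≡0 q)) -0#≈0#)

  fromℤ≡0⇒∣ : ∀ i → fromℤ i ≡ 0# → p ∣ ℤ.∣ i ∣
  fromℤ≡0⇒∣ (+ n)    eq = fromℕ·≡0⇒∣ n eq
  fromℤ≡0⇒∣ -[1+ n ] eq = fromℕ·≡0⇒∣ (suc n) (trans (sym (-‿involutive _)) (trans (cong -_ eq) -0#≈0#))

  opaque
    θ : R.∣R∣ → Carrier
    θ x = fromℤ (proj₁ (residue x))

    π* : ∀ y → Divides 1 (π R.* y)
    π* y = y , R.*-congʳ (R.sym (R.*-identityʳ π))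

    -- Two integers congruent to x modulo `π` differ by a multiple of p, so the representative does
    -- not matter in K.
    θ-residue : ∀ {x} i → Divides 1 (x R.- R.fromℤ i) → θ x ≡ fromℤ i
    θ-residue {x} i d = let j , y , h = residue x in
      x-y≈0⇒x≈y (trans (sym (trans (fromℤ-+ j (ℤ.- i)) (cong (λ z → fromℤ j + z) (fromℤ-neg i))))
        (multiple⇒≡0 (j ℤ.- i) (π∣fromℤ (j ℤ.- i) (Divides-resp (R.sym (R.trans (R.fromℤ-+ j (ℤ.- i)) (R.trans (R.+-congˡ (R.fromℤ-neg i))
          (R.trans (solveᴿ 3 (λ j i z → j :-ᴿ i :=ᴿ (j :+ᴿ z :-ᴿ i) :+ᴿ (-:ᴿ z)) R.refl (R.fromℤ j) (R.fromℤ i) (π R.* y))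
            (R.+-congʳ (R.+-congʳ (R.sym h)))))))
          (Divides-+ d (Divides-neg (π* y)))))))

    residue-θ : ∀ x → Σ ℤ λ i → θ x ≡ fromℤ i × Divides 1 (x R.- R.fromℤ i)
    residue-θ x = let j , y , h = residue x in j , refl , Divides-resp
      (R.trans (solveᴿ 2 (λ j z → z :=ᴿ j :+ᴿ z :-ᴿ j) R.refl (R.fromℤ j) (π R.* y)) (R.+-congʳ (R.sym h))) (π* y)

  θ-+ : ∀ x y → θ (x R.+ y) ≡ θ x + θ y
  θ-+ x y = let i , θx , d = residue-θ x ; j , θy , d′ = residue-θ y in
    trans (θ-residue (i ℤ.+ j) (Divides-resp (R.trans
        (solveᴿ 4 (λ x y i j → (x :-ᴿ i) :+ᴿ (y :-ᴿ j) :=ᴿ (x :+ᴿ y) :-ᴿ (i :+ᴿ j)) R.refl x y (R.fromℤ i) (R.fromℤ j))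
        (R.+-congˡ (R.-‿cong (R.sym (R.fromℤ-+ i j))))) (Divides-+ d d′)))
      (trans (fromℤ-+ i j) (sym (cong₂ _+_ θx θy)))

  θ-* : ∀ x y → θ (x R.* y) ≡ θ x * θ y
  θ-* x y = let i , θx , d = residue-θ x ; j , θy , d′ = residue-θ y in
    trans (θ-residue (i ℤ.* j) (Divides-resp (R.trans
        (solveᴿ 4 (λ x y i j → (x :-ᴿ i) :*ᴿ y :+ᴿ (y :-ᴿ j) :*ᴿ i :=ᴿ (x :*ᴿ y) :-ᴿ (i :*ᴿ j)) R.refl x y (R.fromℤ i) (R.fromℤ j))
        (R.+-congˡ (R.-‿cong (R.sym (R.fromℤ-* i j))))) (Divides-+ (Divides-* y d) (Divides-* (R.fromℤ i) d′))))
      (trans (fromℤ-* i j) (sym (cong₂ _*_ θx θy)))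

  θ-0 : ∀ {x} → Divides 1 x → θ x ≡ 0#
  θ-0 {x} d = θ-residue (+ 0) (Divides-resp (solveᴿ 1 (λ x → x :=ᴿ x :-ᴿ conᴿ (+ 0)) R.refl x) d)

  θ-1 : θ R.1# ≡ 1#
  θ-1 = trans (θ-residue (+ 1) (Divides-resp (R.sym (R.trans (R.+-congˡ (R.-‿cong (R.+-identityʳ R.1#))) (R.-‿inverseʳ R.1#))) (Divides-0 1)))
    (+-identityʳ 1#)

  θ≡0⇒Divides : ∀ x → θ x ≡ 0# → Divides 1 x
  θ≡0⇒Divides x eq = let i , θx , d = residue-θ x in
    Divides-resp (solveᴿ 2 (λ x i → (x :-ᴿ i) :+ᴿ i :=ᴿ x) R.refl x (R.fromℤ i))
      (Divides-+ d (fromℤ-π∣ i (fromℤ≡0⇒∣ i (trans (sym θx) eq))))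

  θ-𝟙 : ∀ {P : Set} (P? : Dec P) → θ (RS.𝟙 P?) ≡ 𝟙 P?
  θ-𝟙 (yes _) = θ-1
  θ-𝟙 (no _)  = θ-0 (Divides-0 1)

  θ-∑ : ∀ {A} (FA : Finite A) f → θ (RS.∑ FA f) ≡ ∑ FA (θ ∘ f)
  θ-∑ FA f = trans (cong θ (RS.∑-unfold FA f)) (trans (go (f ∘ Finite.element FA)) (sym (∑-unfold FA (θ ∘ f))))
    where
    go : ∀ {n} (u : Fin n → R.∣R∣) → θ (R.sum u) ≡ sum (θ ∘ u)
    go {zero}  u = θ-0 (Divides-0 1)
    go {suc n} u = trans (θ-+ _ _) (cong (λ z → θ (u Fin.zero) + z) (go (u ∘ Fin.suc)))

module GroupAlgebra (K : FiniteField) where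
  open FieldProperties K
  open ≡ using (refl; sym; trans; cong; cong₂; subst)

  -- The group algebra K[K^×] is reduced: the Mellin transforms ∑ f(b) b^j of
  -- f * f are squares, so those of f vanish, and f(b₀) = ∑ f(b) (1 - (b - b₀)^(q-1)).
  convolution-reduced : ∀ (f : Carrier → Carrier) →
    (∀ v → ∑ finite (λ b → ∑ finite (λ c → 𝟙 ((b * c) ≟F v) * (f b * f c))) ≡ 0#) → ∀ b → f b ≡ 0#
  convolution-reduced f f*f≡0 b₀ = begin
    f b₀
      ≡⟨ ∑-select finite b₀ f ⟨
    ∑ finite (λ b → 𝟙 (b₀ ≟F b) * f b)
      ≡⟨ ∑-cong finite (λ b → split b) ⟩
    ∑ finite (λ b → f b * (b ^ 0 * 1#) + (- 1#) * (f b * (b ^ 0 * (b - b₀) ^ (size ℕ.∸ 1))))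
      ≡⟨ trans (∑-+ finite _ _) (cong (λ z → ∑ finite (λ b → f b * (b ^ 0 * 1#)) + z) (sym (∑-*ˡ finite (- 1#) _))) ⟩
    ∑ finite (λ b → f b * (b ^ 0 * 1#)) + (- 1#) * ∑ finite (λ b → f b * (b ^ 0 * (b - b₀) ^ (size ℕ.∸ 1)))
      ≡⟨ cong₂ (λ y z → y + (- 1#) * z) (annihilated 0 0) (annihilated (size ℕ.∸ 1) 0) ⟩
    0# + (- 1#) * 0#
      ≡⟨ trans (+-identityˡ _) (zeroʳ _) ⟩
    0# ∎
    where
    open ≡.≡-Reasoning

    moment : ℕ → Carrier
    moment j = ∑ finite (λ b → f b * b ^ j)

    -- As b^j c^j = (b c)^j, the square groups by v = b c into the coefficients of f * f.
    moment² : ∀ j → moment j * moment j ≡ 0#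
    moment² j = begin
      moment j * moment j
        ≡⟨ ∑-*∑ finite finite _ _ ⟩
      ∑ finite (λ b → ∑ finite (λ c → f b * b ^ j * (f c * c ^ j)))
        ≡⟨ ∑-cong finite (λ b → ∑-cong finite (λ c → trans
             (solve 4 (λ x y z w → x :* y :* (z :* w) := x :* z :* (y :* w)) refl (f b) (b ^ j) (f c) (c ^ j))
             (cong (f b * f c *_) (sym (^-distrib-* b c j))))) ⟩
      ∑ finite (λ b → ∑ finite (λ c → f b * f c * (b * c) ^ j))
        ≡⟨ ∑-cong finite (λ b → ∑-fibres finite finite (b *_) (λ c → f b * f c) (_^ j)) ⟩
      ∑ finite (λ b → ∑ finite (λ v → ∑ finite (λ c → 𝟙 ((b * c) ≟F v) * (f b * f c)) * v ^ j))
        ≡⟨ ∑-swap finite finite _ ⟩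
      ∑ finite (λ v → ∑ finite (λ b → ∑ finite (λ c → 𝟙 ((b * c) ≟F v) * (f b * f c)) * v ^ j))
        ≡⟨ ∑-zero finite (λ v → trans (sym (∑-*ʳ finite _ _)) (trans (cong (_* v ^ j) (f*f≡0 v)) (zeroˡ _))) ⟩
      0# ∎
      where open Solver

    moment≡0 : ∀ j → moment j ≡ 0#
    moment≡0 j = x*x≡0⇒x≡0 (moment² j)

    -- Each factor b - b₀ is traded for an increase of j and a multiple by - b₀; the extra exponent
    -- j is what makes the induction on k go through.
    annihilated : ∀ k j → ∑ finite (λ b → f b * (b ^ j * (b - b₀) ^ k)) ≡ 0#
    annihilated zero    j = trans (∑-cong finite (λ b → cong (f b *_) (*-identityʳ _))) (moment≡0 j)
    annihilated (suc k) j = begin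
      ∑ finite (λ b → f b * (b ^ j * ((b - b₀) * (b - b₀) ^ k)))
        ≡⟨ ∑-cong finite (λ b → solve 5 (λ u x v b a → u :* (x :* ((b :- a) :* v))
             := u :* (b :* x :* v) :+ (:- a) :* (u :* (x :* v))) refl (f b) (b ^ j) ((b - b₀) ^ k) b b₀) ⟩
      ∑ finite (λ b → f b * (b ^ suc j * (b - b₀) ^ k) + (- b₀) * (f b * (b ^ j * (b - b₀) ^ k)))
        ≡⟨ trans (∑-+ finite _ _) (cong₂ _+_ (annihilated k (suc j)) (trans (sym (∑-*ˡ finite (- b₀) _)) (cong ((- b₀) *_) (annihilated k j)))) ⟩
      0# + (- b₀) * 0#
        ≡⟨ trans (+-identityˡ _) (zeroʳ _) ⟩
      0# ∎
      where open Solver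

    1<size : 1 ℕ.< size
    1<size = ℕₚ.≰⇒> λ size≤1 → 1≢0 (trans (sym (Finite.element-index finite 1#))
      (trans (cong (Finite.element finite) (unique size≤1 (Finite.index finite 1#) (Finite.index finite 0#))) (Finite.element-index finite 0#)))
      where
      unique : ∀ {n} → n ℕ.≤ 1 → (i j : Fin n) → i ≡ j
      unique (s≤s z≤n) Fin.zero Fin.zero = refl

    -- By Fermat, 1 - (b - b₀)^(q-1) is the indicator of b = b₀; at b = b₀ this uses q - 1 > 0. The
    -- factors `b ^ 0` and `1#` give both terms the shape of `annihilated`.
    split : ∀ b → 𝟙 (b₀ ≟F b) * f b ≡ f b * (b ^ 0 * 1#) + (- 1#) * (f b * (b ^ 0 * (b - b₀) ^ (size ℕ.∸ 1)))
    split b with b₀ ≟F b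
    ... | yes refl = trans (solve 1 (λ u → con (+ 1) :* u := u :* (con (+ 1) :* con (+ 1)) :+ (:- con (+ 1)) :* (u :* (con (+ 1) :* con (+ 0)))) refl (f b))
            (cong (λ z → f b * (1# * 1#) + (- 1#) * (f b * (1# * z))) (sym (trans (cong (_^ (size ℕ.∸ 1)) (-‿inverseʳ b))
              (0^ (size ℕ.∸ 1) {{ℕ.>-nonZero (ℕₚ.m<n⇒0<n∸m 1<size)}}))))
      where open Solver
    ... | no ne = trans (solve 1 (λ u → con (+ 0) :* u := u :* (con (+ 1) :* con (+ 1)) :+ (:- con (+ 1)) :* (u :* (con (+ 1) :* con (+ 1)))) refl (f b))
            (cong (λ z → f b * (1# * 1#) + (- 1#) * (f b * (1# * z))) (sym (x^[size-1]≡1 (x-y≢0 (ne ∘ sym)))))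
      where open Solver

-- Congruences of exponents.

-- Free of subtraction: multiples of M are added on both sides, so exponents stay natural numbers.
record Congruent (M a b : ℕ) : Set where
  constructor congruent
  field
    {u v} : ℕ
    equation : a ℕ.+ u ℕ.* M ≡ b ℕ.+ v ℕ.* M

module Congruences where
  open ≡ using (refl; sym; trans; cong; cong₂; subst)
  open ≡.≡-Reasoning
  open Data.Nat.Solver.+-*-Solver

  Congruent-refl : ∀ {M a} → Congruent M a a
  Congruent-refl = congruent {u = 0} {0} refl

  Congruent-sym : ∀ {M a b} → Congruent M a b → Congruent M b a
  Congruent-sym (congruent {u} {v} eq) = congruent {u = v} {u} (sym eq)

  Congruent-trans : ∀ {M a b c} → Congruent M a b → Congruent M b c → Congruent M a c
  Congruent-trans {M} {a} {b} {c} (congruent {u} {v} eq) (congruent {u′} {v′} eq′) = congruent {u = u ℕ.+ u′} {v ℕ.+ v′} (begin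
    a ℕ.+ (u ℕ.+ u′) ℕ.* M         ≡⟨ solve 4 (λ a u u′ M → a :+ (u :+ u′) :* M := (a :+ u :* M) :+ u′ :* M) refl a u u′ M ⟩
    a ℕ.+ u ℕ.* M ℕ.+ u′ ℕ.* M     ≡⟨ cong (ℕ._+ u′ ℕ.* M) eq ⟩
    b ℕ.+ v ℕ.* M ℕ.+ u′ ℕ.* M     ≡⟨ solve 4 (λ b v u′ M → b :+ v :* M :+ u′ :* M := (b :+ u′ :* M) :+ v :* M) refl b v u′ M ⟩
    b ℕ.+ u′ ℕ.* M ℕ.+ v ℕ.* M     ≡⟨ cong (ℕ._+ v ℕ.* M) eq′ ⟩
    c ℕ.+ v′ ℕ.* M ℕ.+ v ℕ.* M     ≡⟨ solve 4 (λ c v v′ M → c :+ v′ :* M :+ v :* M := c :+ (v :+ v′) :* M) refl c v v′ M ⟩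
    c ℕ.+ (v ℕ.+ v′) ℕ.* M         ∎)

  Congruent-* : ∀ {M a b} c → Congruent M a b → Congruent M (a ℕ.* c) (b ℕ.* c)
  Congruent-* {M} {a} {b} c (congruent {u} {v} eq) = congruent {u = u ℕ.* c} {v ℕ.* c} (trans (lemma a u) (trans (cong (ℕ._* c) eq) (sym (lemma b v))))
    where
    lemma : ∀ a u → a ℕ.* c ℕ.+ u ℕ.* c ℕ.* M ≡ (a ℕ.+ u ℕ.* M) ℕ.* c
    lemma a u = solve 4 (λ a u c M → a :* c :+ u :* c :* M := (a :+ u :* M) :* c) refl a u c M

  private
    abs-difference : ∀ a b → ℤ.∣ + a ℤ.- + b ∣ ≡ ℤ.∣ a ℤ.⊖ b ∣
    abs-difference a b = cong ℤ.∣_∣ (ℤₚ.m-n≡m⊖n a b)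

  CongPowMod⇒Congruent : ∀ {d p M} → CongPowMod d p M → Σ ℕ λ j → Congruent M d (p ℕ.^ j)
  CongPowMod⇒Congruent {d} {p} {M} (j , M∣) = j , go (ℕₚ.≤-total d (p ℕ.^ j)) (subst (M ∣_) (abs-difference d (p ℕ.^ j)) M∣)
    where
    go : d ℕ.≤ p ℕ.^ j ⊎ p ℕ.^ j ℕ.≤ d → M ∣ ℤ.∣ d ℤ.⊖ p ℕ.^ j ∣ → Congruent M d (p ℕ.^ j)
    go (inj₁ d≤) (divides k eq) = congruent {u = k} {0}
      (trans (cong (d ℕ.+_) (sym (trans (sym (ℤₚ.∣⊖∣-≤ d≤)) eq))) (trans (ℕₚ.m+[n∸m]≡n d≤) (sym (ℕₚ.+-identityʳ _))))
    go (inj₂ ≤d) (divides k eq) = congruent {u = 0} {k} (trans (ℕₚ.+-identityʳ d) (trans (sym (ℕₚ.m+[n∸m]≡n ≤d))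
      (cong (p ℕ.^ j ℕ.+_) (trans (sym (ℤₚ.∣⊖∣-≤ ≤d)) (trans (ℤₚ.∣m⊖n∣≡∣n⊖m∣ (p ℕ.^ j) d) eq)))))

  private
    Congruent⇒∣-≤ : ∀ {M a b} → a ℕ.≤ b → Congruent M a b → M ∣ ℤ.∣ a ℤ.⊖ b ∣
    Congruent⇒∣-≤ {M} {a} {b} a≤b (congruent {u} {v} eq) = subst (M ∣_) (sym (ℤₚ.∣⊖∣-≤ a≤b))
      (∣m+n∣m⇒∣n (subst (M ∣_) uM (n∣m*n u)) (n∣m*n v))
      where
      uM : u ℕ.* M ≡ v ℕ.* M ℕ.+ (b ℕ.∸ a)
      uM = ℕₚ.+-cancelˡ-≡ a _ _ (begin
        a ℕ.+ u ℕ.* M                   ≡⟨ eq ⟩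
        b ℕ.+ v ℕ.* M                   ≡⟨ cong (ℕ._+ v ℕ.* M) (ℕₚ.m+[n∸m]≡n a≤b) ⟨
        a ℕ.+ (b ℕ.∸ a) ℕ.+ v ℕ.* M     ≡⟨ trans (ℕₚ.+-assoc a _ _) (cong (a ℕ.+_) (ℕₚ.+-comm (b ℕ.∸ a) _)) ⟩
        a ℕ.+ (v ℕ.* M ℕ.+ (b ℕ.∸ a))   ∎)

  Congruent⇒CongPowMod : ∀ {d p M} j → Congruent M d (p ℕ.^ j) → CongPowMod d p M
  Congruent⇒CongPowMod {d} {p} {M} j c with ℕₚ.≤-total d (p ℕ.^ j)
  ... | inj₁ d≤ = j , subst (M ∣_) (sym (abs-difference d (p ℕ.^ j))) (Congruent⇒∣-≤ d≤ c)
  ... | inj₂ ≤d = j , subst (M ∣_) (sym (trans (abs-difference d (p ℕ.^ j)) (ℤₚ.∣m⊖n∣≡∣n⊖m∣ d (p ℕ.^ j))))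
      (Congruent⇒∣-≤ ≤d (Congruent-sym c))

  -- The range is 1, ..., M because exponents must stay positive: at x = 0 the exponents 0 and M
  -- give different powers.
  representative : ∀ M .{{_ : NonZero M}} a → 1 ℕ.≤ a → Σ ℕ λ r → 1 ℕ.≤ r × r ℕ.≤ M × Congruent M a r
  representative M (suc a) _ = suc (a % M) , s≤s z≤n , m%n<n a M ,
    congruent {u = 0} {a / M} (trans (ℕₚ.+-identityʳ _) (cong suc (m≡m%n+[m/n]*n a M)))

  modular-inverse : ∀ {M d} → 1 ℕ.≤ M → gcd d M ≡ 1 → Σ ℕ λ e → 1 ℕ.≤ e × Congruent M (d ℕ.* e) 1
  modular-inverse {M} {d} 1≤M gcd≡1 with coprime-Bézout (gcd≡1⇒coprime gcd≡1)
  ... | Bézout.+- x y eq = x ℕ.+ M , ℕₚ.≤-trans 1≤M (ℕₚ.m≤n+m M x) , congruent {u = 0} {y ℕ.+ d} (begin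
        d ℕ.* (x ℕ.+ M) ℕ.+ 0           ≡⟨ solve 3 (λ d x M → d :* (x :+ M) :+ con 0 := x :* d :+ d :* M) refl d x M ⟩
        x ℕ.* d ℕ.+ d ℕ.* M             ≡⟨ cong (ℕ._+ d ℕ.* M) eq ⟨
        1 ℕ.+ y ℕ.* M ℕ.+ d ℕ.* M       ≡⟨ solve 3 (λ y d M → con 1 :+ y :* M :+ d :* M := con 1 :+ (y :+ d) :* M) refl y d M ⟩
        1 ℕ.+ (y ℕ.+ d) ℕ.* M           ∎)
  -- Here 1 + x d = y M, so the inverse is - x; since x d ≡ -1, the natural number x x d is
  -- congruent to it. The summand M keeps the exponent positive.
  ... | Bézout.-+ x y eq = x ℕ.* x ℕ.* d ℕ.+ M , ℕₚ.≤-trans 1≤M (ℕₚ.m≤n+m M _) , congruent {u = y} {x ℕ.* d ℕ.* y ℕ.+ d} (begin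
        d ℕ.* (x ℕ.* x ℕ.* d ℕ.+ M) ℕ.+ y ℕ.* M
          ≡⟨ cong (d ℕ.* (x ℕ.* x ℕ.* d ℕ.+ M) ℕ.+_) eq ⟨
        d ℕ.* (x ℕ.* x ℕ.* d ℕ.+ M) ℕ.+ (1 ℕ.+ x ℕ.* d)
          ≡⟨ solve 3 (λ d x M → d :* (x :* x :* d :+ M) :+ (con 1 :+ x :* d) := con 1 :+ (x :* d :* (con 1 :+ x :* d) :+ d :* M)) refl d x M ⟩
        1 ℕ.+ (x ℕ.* d ℕ.* (1 ℕ.+ x ℕ.* d) ℕ.+ d ℕ.* M)
          ≡⟨ cong (λ z → 1 ℕ.+ (x ℕ.* d ℕ.* z ℕ.+ d ℕ.* M)) eq ⟩
        1 ℕ.+ (x ℕ.* d ℕ.* (y ℕ.* M) ℕ.+ d ℕ.* M)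
          ≡⟨ solve 4 (λ d x y M → con 1 :+ (x :* d :* (y :* M) :+ d :* M) := con 1 :+ (x :* d :* y :+ d) :* M) refl d x y M ⟩
        1 ℕ.+ (x ℕ.* d ℕ.* y ℕ.+ d) ℕ.* M ∎)

module PowerCongruence (F : FiniteField) where
  open FieldProperties F
  open ≡ using (refl; sym; trans; cong; cong₂; subst)

  ^-congruent : ∀ {a b} → 1 ℕ.≤ a → 1 ℕ.≤ b → Congruent (size ℕ.∸ 1) a b → ∀ x → x ^ a ≡ x ^ b
  ^-congruent {a} {b} 1≤a 1≤b (congruent {u} {v} eq) x with x ≟F 0#
  ... | yes refl = trans (0^ a {{ℕ.>-nonZero 1≤a}}) (sym (0^ b {{ℕ.>-nonZero 1≤b}}))
  ... | no x≢0   = trans (sym (reduce a u)) (trans (cong (x ^_) eq) (reduce b v))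
    where
    reduce : ∀ a u → x ^ (a ℕ.+ u ℕ.* (size ℕ.∸ 1)) ≡ x ^ a
    reduce a u = trans (^-homo-* x a _) (trans (cong (λ z → x ^ a * z) (trans (cong (x ^_) (ℕₚ.*-comm u _))
      (trans (sym (^-assocʳ x (size ℕ.∸ 1) u)) (trans (^-congˡ u (x^[size-1]≡1 x≢0)) (1^n≈1 u))))) (*-identityʳ _))

-- One quadratic step E/K: trace, norm and roots of quadratics.

module Extension {p : ℕ} (pr : Prime p) (𝒪 : CyclotomicRing p) (m : ℕ) (1≤m : 1 ℕ.≤ m)
                 (E K : FiniteField) (X : QuadraticExtension p m E K) where
  module E = FieldProperties E
  module K = FieldProperties K
  open QuadraticExtension X
  open Valuation pr 𝒪
  open Congruences
  open ≡ using (refl; sym; trans; cong; cong₂; subst)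

  Q : ℕ
  Q = p ℕ.^ m

  1≤m+m : 1 ℕ.≤ m ℕ.+ m
  1≤m+m = ℕₚ.≤-trans 1≤m (ℕₚ.m≤m+n m m)

  module CE = Character pr 𝒪 E (m ℕ.+ m) 1≤m+m charE
  module CK = Character pr 𝒪 K m 1≤m charK
  module PE = Characteristic E pr (HasCharDeg.charp charE)
  module R = RingProperties (CyclotomicRing.ring 𝒪)
  module RS = SemiringSum R.commutativeSemiring
  module N = ℕ-Sum
  open R.Solver using () renaming (solve to solveᴿ; con to conᴿ; _:=_ to _:=ᴿ_; _:+_ to _:+ᴿ_; _:*_ to _:*ᴿ_; _:-_ to _:-ᴿ_; :-_ to -:ᴿ_)
  open K.Solver using () renaming (solve to solveᴷ; con to conᴷ; _:=_ to _:=ᴷ_; _:+_ to _:+ᴷ_; _:*_ to _:*ᴷ_; _:-_ to _:-ᴷ_; :-_ to -:ᴷ_)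
  open E.Solver using () renaming (solve to solveᴱ; con to conᴱ; _:=_ to _:=ᴱ_; _:+_ to _:+ᴱ_; _:*_ to _:*ᴱ_; _:-_ to _:-ᴱ_; :-_ to -:ᴱ_)

  sizeK : K.size ≡ Q
  sizeK = HasCharDeg.order charK

  sizeE : E.size ≡ Q ℕ.* Q
  sizeE = trans (HasCharDeg.order charE) (ℕₚ.^-distribˡ-+-* p m m)

  1<Q : 1 ℕ.< Q
  1<Q = ℕₚ.^-monoʳ-< p (prime⇒1< pr) 1≤m

  ι-0 : ι K.0# ≡ E.0#
  ι-0 = begin
    ι K.0#                           ≡⟨ solveᴱ 1 (λ a → a :=ᴱ a :+ᴱ a :-ᴱ a) refl (ι K.0#) ⟩
    ι K.0# E.+ ι K.0# E.- ι K.0#     ≡⟨ cong (E._- ι K.0#) (sym (ι-+ K.0# K.0#)) ⟩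
    ι (K.0# K.+ K.0#) E.- ι K.0#     ≡⟨ cong (λ a → ι a E.- ι K.0#) (K.+-identityˡ K.0#) ⟩
    ι K.0# E.- ι K.0#                ≡⟨ E.-‿inverseʳ (ι K.0#) ⟩
    E.0#                             ∎
    where open ≡.≡-Reasoning

  ι-neg : ∀ x → ι (K.- x) ≡ E.- ι x
  ι-neg x = E.+-inverseˡ-unique _ _ (trans (sym (ι-+ (K.- x) x)) (trans (cong ι (K.-‿inverseˡ x)) ι-0))

  ι-≡0 : ∀ {x} → ι x ≡ E.0# → x ≡ K.0#
  ι-≡0 eq = ι-injective (trans eq (sym ι-0))

  ι-^ : ∀ x n → ι (x K.^ n) ≡ ι x E.^ n
  ι-^ x zero    = ι-1
  ι-^ x (suc n) = trans (ι-* x _) (cong (ι x E.*_) (ι-^ x n))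

  ι-fromℕ· : ∀ n → ι (K.fromℕ· n) ≡ E.fromℕ· n
  ι-fromℕ· zero    = ι-0
  ι-fromℕ· (suc n) = trans (ι-+ K.1# _) (cong₂ E._+_ ι-1 (ι-fromℕ· n))

  tr-+ : ∀ x y → tr (x E.+ y) ≡ tr x K.+ tr y
  tr-+ x y = ι-injective (begin
    ι (tr (x E.+ y))                              ≡⟨ ι-tr _ ⟩
    x E.+ y E.+ (x E.+ y) E.^ Q                   ≡⟨ cong (λ a → x E.+ y E.+ a) (PE.frobenius m x y) ⟩
    x E.+ y E.+ (x E.^ Q E.+ y E.^ Q)             ≡⟨ solve 4 (λ a b c d → a :+ b :+ (c :+ d) := (a :+ c) :+ (b :+ d)) refl x y (x E.^ Q) (y E.^ Q) ⟩
    x E.+ x E.^ Q E.+ (y E.+ y E.^ Q)             ≡⟨ cong₂ E._+_ (ι-tr x) (ι-tr y) ⟨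
    ι (tr x) E.+ ι (tr y)                         ≡⟨ ι-+ _ _ ⟨
    ι (tr x K.+ tr y)                             ∎)
    where open ≡.≡-Reasoning
          open E.Solver

  tr-scale : ∀ k x → tr (ι k E.* x) ≡ k K.* tr x
  tr-scale k x = ι-injective (begin
    ι (tr (ι k E.* x))                            ≡⟨ ι-tr _ ⟩
    ι k E.* x E.+ (ι k E.* x) E.^ Q               ≡⟨ cong (λ a → ι k E.* x E.+ a) (E.^-distrib-* (ι k) x Q) ⟩
    ι k E.* x E.+ ι k E.^ Q E.* x E.^ Q           ≡⟨ cong (λ a → ι k E.* x E.+ a E.* x E.^ Q) (ι-fixed k) ⟩
    ι k E.* x E.+ ι k E.* x E.^ Q                 ≡⟨ E.distribˡ (ι k) x (x E.^ Q) ⟨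
    ι k E.* (x E.+ x E.^ Q)                       ≡⟨ cong (ι k E.*_) (ι-tr x) ⟨
    ι k E.* ι (tr x)                              ≡⟨ ι-* _ _ ⟨
    ι (k K.* tr x)                                ∎)
    where open ≡.≡-Reasoning

  tr-neg : ∀ x → tr (E.- x) ≡ K.- tr x
  tr-neg x = K.+-inverseˡ-unique _ _ (trans (sym (tr-+ (E.- x) x)) (trans (cong tr (E.-‿inverseˡ x)) tr-0))
    where
    tr-0 : tr E.0# ≡ K.0#
    tr-0 = begin
      tr E.0#                ≡⟨ cong tr (trans (cong (E._* E.0#) ι-0) (E.zeroˡ _)) ⟨
      tr (ι K.0# E.* E.0#)   ≡⟨ tr-scale K.0# E.0# ⟩
      K.0# K.* tr E.0#       ≡⟨ K.zeroˡ _ ⟩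
      K.0#                   ∎
      where open ≡.≡-Reasoning

  norm-* : ∀ x y → norm (x E.* y) ≡ norm x K.* norm y
  norm-* x y = ι-injective (begin
    ι (norm (x E.* y))                            ≡⟨ ι-norm _ ⟩
    x E.* y E.* (x E.* y) E.^ Q                   ≡⟨ cong (λ a → x E.* y E.* a) (E.^-distrib-* x y Q) ⟩
    x E.* y E.* (x E.^ Q E.* y E.^ Q)             ≡⟨ solve 4 (λ a b c d → a :* b :* (c :* d) := (a :* c) :* (b :* d)) refl x y (x E.^ Q) (y E.^ Q) ⟩
    x E.* x E.^ Q E.* (y E.* y E.^ Q)             ≡⟨ cong₂ E._*_ (ι-norm x) (ι-norm y) ⟨
    ι (norm x) E.* ι (norm y)                     ≡⟨ ι-* _ _ ⟨
    ι (norm x K.* norm y)                         ∎)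
    where open ≡.≡-Reasoning
          open E.Solver

  norm-1 : norm E.1# ≡ K.1#
  norm-1 = ι-injective (trans (ι-norm E.1#) (trans (E.*-identityˡ _) (trans (E.1^n≈1 Q) (sym ι-1))))

  norm-^ : ∀ x n → norm (x E.^ n) ≡ norm x K.^ n
  norm-^ x zero    = norm-1
  norm-^ x (suc n) = trans (norm-* x _) (cong (norm x K.*_) (norm-^ x n))

  norm-0 : norm E.0# ≡ K.0#
  norm-0 = ι-injective (trans (ι-norm E.0#) (trans (E.zeroˡ _) (sym ι-0)))

  norm-neg : ∀ x → norm (E.- x) ≡ norm x
  norm-neg x = ι-injective (trans (ι-norm _) (trans (cong (E.- x E.*_) (PE.frobenius-neg m x))
      (trans (solve 2 (λ a b → (:- a) :* (:- b) := a :* b) refl x (x E.^ Q)) (sym (ι-norm x)))))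
    where open E.Solver

  norm≡0 : ∀ {x} → norm x ≡ K.0# → x ≡ E.0#
  norm≡0 {x} eq with E.x*y≡0 (trans (sym (ι-norm x)) (trans (cong ι eq) ι-0))
  ... | inj₁ x≡0  = x≡0
  ... | inj₂ xQ≡0 = E.x^n≡0⇒x≡0 Q xQ≡0

  trace-split : ∀ j x → CE.trace (j ℕ.+ m) x ≡ CE.trace m x E.+ CE.trace j (x E.^ Q)
  trace-split zero    x = sym (E.+-identityʳ _)
  trace-split (suc j) x = trans (cong₂ E._+_ power (trace-split j x))
      (solve 3 (λ a b c → a :+ (b :+ c) := b :+ (a :+ c)) refl ((x E.^ Q) E.^ (p ℕ.^ j)) (CE.trace m x) (CE.trace j (x E.^ Q)))
    where
    open E.Solver
    power : x E.^ (p ℕ.^ (j ℕ.+ m)) ≡ (x E.^ Q) E.^ (p ℕ.^ j)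
    power = trans (cong (x E.^_) (trans (ℕₚ.^-distribˡ-+-* p j m) (ℕₚ.*-comm (p ℕ.^ j) Q))) (sym (E.^-assocʳ x Q (p ℕ.^ j)))

  ι-trace : ∀ k y → ι (CK.trace k y) ≡ CE.trace k (ι y)
  ι-trace zero    y = ι-0
  ι-trace (suc k) y = trans (ι-+ _ _) (cong₂ E._+_ (ι-^ y (p ℕ.^ k)) (ι-trace k y))

  Tr-transitive : ∀ x → CE.Tr x ≡ ι (CK.Tr (tr x))
  Tr-transitive x = begin
    CE.trace (m ℕ.+ m) x                       ≡⟨ trace-split m x ⟩
    CE.trace m x E.+ CE.trace m (x E.^ Q)      ≡⟨ CE.trace-+ m x (x E.^ Q) ⟨
    CE.trace m (x E.+ x E.^ Q)                 ≡⟨ cong (CE.trace m) (ι-tr x) ⟨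
    CE.trace m (ι (tr x))                      ≡⟨ ι-trace m (tr x) ⟨
    ι (CK.Tr (tr x))                           ∎
    where open ≡.≡-Reasoning

  ψ-transitive : ∀ x → CE.ψ x R.≈ CK.ψ (tr x)
  ψ-transitive x = R.trans (CE.ψ≈ζ^ j (trans (sym (ι-fromℕ· j)) (trans (cong ι (proj₂ (CK.Tr-index (tr x)))) (sym (Tr-transitive x)))))
      (R.reflexive (sym (CK.ψ-index (tr x))))
    where j = toℕ (proj₁ (CK.Tr-index (tr x)))

  -- X² - T X + v has two roots, those in E with trace T and norm v and those in
  -- K counted together: never more than two, and two on average over (T, v).
  InE : K.Carrier → K.Carrier → E.Carrier → Set
  InE T v x = tr x ≡ T × norm x ≡ v

  InE? : ∀ T v x → Dec (InE T v x)
  InE? T v x = (tr x K.≟F T) ×-dec (norm x K.≟F v)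

  InK : K.Carrier → K.Carrier → K.Carrier → Set
  InK T v y = y K.* (T K.- y) ≡ v

  InK? : ∀ T v y → Dec (InK T v y)
  InK? T v y = (y K.* (T K.- y)) K.≟F v

  countE countK : K.Carrier → K.Carrier → ℕ
  countE T v = N.count E.finite (InE? T v)
  countK T v = N.count K.finite (InK? T v)

  private
    E-quadratic : ∀ {T v x} → InE T v x → x E.* (ι T E.- x) ≡ ι v
    E-quadratic {x = x} (refl , refl) = begin
      x E.* (ι (tr x) E.- x)         ≡⟨ cong (λ a → x E.* (a E.- x)) (ι-tr x) ⟩
      x E.* (x E.+ x E.^ Q E.- x)    ≡⟨ solve 2 (λ a b → a :* (a :+ b :- a) := a :* b) refl x (x E.^ Q) ⟩
      x E.* x E.^ Q                  ≡⟨ ι-norm x ⟨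
      ι (norm x)                     ∎
      where open ≡.≡-Reasoning
            open E.Solver

    ι-quadratic : ∀ {T v y} → InK T v y → ι y E.* (ι T E.- ι y) ≡ ι v
    ι-quadratic {T} {y = y} refl = sym (trans (ι-* y _) (cong (ι y E.*_) (trans (ι-+ T _) (cong (ι T E.+_) (ι-neg y)))))

    tr-ι : ∀ y → tr (ι y) ≡ y K.+ y
    tr-ι y = ι-injective (trans (ι-tr (ι y)) (trans (cong (ι y E.+_) (ι-fixed y)) (sym (ι-+ y y))))

    -- If x comes from K, the trace doubles it, so T is twice one of the roots y and T - y. Then the
    -- two coincide.
    double-root : ∀ {T y x} → tr x ≡ T → ι y ≡ x ⊎ ι T E.- ι y ≡ x → y K.+ y ≡ T × x ≡ ι y
    double-root {T} {y} trx (inj₁ refl) = trans (sym (tr-ι y)) trx , refl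
    double-root {T} {y} trx (inj₂ refl) = 2y≡T , trans (cong (λ a → ι a E.- ι y) (sym 2y≡T)) (trans (cong (E._- ι y) (ι-+ y y))
        (solve 1 (λ a → a :+ a :- a := a) refl (ι y)))
      where
      open E.Solver
      z = T K.- y
      2z≡T : z K.+ z ≡ T
      2z≡T = trans (sym (tr-ι z)) (trans (cong tr (trans (ι-+ T _) (cong (λ a → ι T E.+ a) (ι-neg y)))) trx)
      2y≡T : y K.+ y ≡ T
      2y≡T = K.x-y≈0⇒x≈y (trans (solveᴷ 2 (λ y t → y :+ᴷ y :-ᴷ t
          :=ᴷ t :-ᴷ ((t :-ᴷ y) :+ᴷ (t :-ᴷ y))) refl y T)
        (K.x≈y⇒x-y≈0 (sym 2z≡T)))

    double : ∀ {T v y} → InK T v y → ∀ x → InE T v x → y K.+ y ≡ T × x ≡ ι y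
    double ky x ex = double-root (proj₁ ex) (E.quadratic-roots (trans (E-quadratic ex) (sym (ι-quadratic ky))))

    unique-root : ∀ {v y} → InK (y K.+ y) v y → ∀ x → InK (y K.+ y) v x → x ≡ y
    unique-root {v} {y} ky x kx = [ sym , (λ eq → trans (sym eq) (solveᴷ 1 (λ a → a :+ᴷ a :-ᴷ a :=ᴷ a) refl y)) ]′
      (K.quadratic-roots (trans kx (sym ky)))

    -- Without a root in K there are at most two in E. A root y in K with 2 y ≠ T excludes all roots
    -- in E by `double`. If 2 y = T, then y is the only root on each side.
    count-≤2 : ∀ T v → countE T v ℕ.+ countK T v ℕ.≤ 2
    count-≤2 T v = split (Finite.search K.finite (InK? T v))
      where
      open ℕₚ.≤-Reasoning

      split-E : Dec (Σ E.Carrier (InE T v)) → countE T v ℕ.≤ 2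
      split-E (no none)        = ℕₚ.≤-trans (ℕₚ.≤-reflexive (N.count-none E.finite (InE? T v) (λ x ex → none (x , ex)))) z≤n
      split-E (yes (x₀ , ex₀)) = N.count-≤2 E.finite (InE? T v) x₀ (ι T E.- x₀)
        (λ x ex → E.quadratic-roots (trans (E-quadratic ex) (sym (E-quadratic ex₀))))

      split-T : ∀ {y} → InK T v y → Dec (y K.+ y ≡ T) → countE T v ℕ.+ countK T v ℕ.≤ 2
      split-T {y} ky (no ne) = ℕₚ.≤-trans
        (ℕₚ.≤-reflexive (cong (ℕ._+ countK T v) (N.count-none E.finite (InE? T v) (λ x ex → ne (proj₁ (double ky x ex))))))
        (N.count-≤2 K.finite (InK? T v) y (T K.- y) (λ x kx → K.quadratic-roots (trans kx (sym ky))))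
      split-T {y} ky (yes refl) = ℕₚ.+-mono-≤
        (N.count-≤1 E.finite (InE? T v) (λ x x′ ex ex′ → trans (proj₂ (double ky x ex)) (sym (proj₂ (double ky x′ ex′)))))
        (N.count-≤1 K.finite (InK? T v) (λ x x′ kx kx′ → trans (unique-root ky x kx) (sym (unique-root ky x′ kx′))))

      split : Dec (Σ K.Carrier (InK T v)) → countE T v ℕ.+ countK T v ℕ.≤ 2
      split (yes (y , ky)) = split-T ky ((y K.+ y) K.≟F T)
      split (no none)      = begin
        countE T v ℕ.+ countK T v
          ≡⟨ cong (countE T v ℕ.+_) (N.count-none K.finite (InK? T v) (λ y ky → none (y , ky))) ⟩
        countE T v ℕ.+ 0
          ≡⟨ ℕₚ.+-identityʳ _ ⟩
        countE T v
          ≤⟨ split-E (Finite.search E.finite (InE? T v)) ⟩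
        2 ∎

    ∑∑ : (K.Carrier → K.Carrier → ℕ) → ℕ
    ∑∑ f = N.∑ K.finite (λ T → N.∑ K.finite (f T))

    ∑∑-countE : ∑∑ countE ≡ Q ℕ.* Q
    ∑∑-countE = begin
      ∑∑ countE
        ≡⟨ N.∑-cong K.finite (λ T → N.∑-swap K.finite E.finite (λ v x → N.𝟙 (InE? T v x))) ⟩
      N.∑ K.finite (λ T → N.∑ E.finite (λ x → N.∑ K.finite (λ v → N.𝟙 (InE? T v x))))
        ≡⟨ N.∑-swap K.finite E.finite _ ⟩
      N.∑ E.finite (λ x → N.∑ K.finite (λ T → N.∑ K.finite (λ v → N.𝟙 (InE? T v x))))
        ≡⟨ N.∑-cong E.finite one ⟩
      N.∑ E.finite (λ _ → 1)
        ≡⟨ trans (N.∑-constant E.finite 1) (trans (ℕₚ.*-identityʳ E.size) sizeE) ⟩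
      Q ℕ.* Q ∎
      where
      open ≡.≡-Reasoning
      one : ∀ x → N.∑ K.finite (λ T → N.∑ K.finite (λ v → N.𝟙 (InE? T v x))) ≡ 1
      one x = trans (N.∑-single K.finite (tr x) λ T ne → N.∑-zero K.finite (λ v → N.𝟙-false (InE? T v x) (ne ∘ sym ∘ proj₁)))
        (N.count-one K.finite (λ v → InE? (tr x) v x) (norm x) (refl , refl) (λ v → sym ∘ proj₂))

    ∑∑-countK : ∑∑ countK ≡ Q ℕ.* Q
    ∑∑-countK = begin
      ∑∑ countK
        ≡⟨ N.∑-cong K.finite (λ T → N.∑-swap K.finite K.finite (λ v y → N.𝟙 (InK? T v y))) ⟩
      N.∑ K.finite (λ T → N.∑ K.finite (λ y → N.∑ K.finite (λ v → N.𝟙 (InK? T v y))))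
        ≡⟨ N.∑-cong K.finite (λ T → trans (N.∑-cong K.finite (λ y → N.∑-𝟙 K.finite (y K.* (T K.- y))))
             (trans (N.∑-constant K.finite 1) (ℕₚ.*-identityʳ K.size))) ⟩
      N.∑ K.finite (λ _ → K.size)
        ≡⟨ N.∑-constant K.finite K.size ⟩
      K.size ℕ.* K.size
        ≡⟨ cong₂ ℕ._*_ sizeK sizeK ⟩
      Q ℕ.* Q ∎
      where open ≡.≡-Reasoning

  count≡2 : ∀ T v → countE T v ℕ.+ countK T v ≡ 2
  -- Two squeezes: the one over T shows that every sum over v is as large as possible, the one over
  -- v then fixes each count.
  count≡2 T = N.∑-squeeze K.finite (count-≤2 T)
      (ℕₚ.≤-reflexive (sym (N.∑-squeeze K.finite (λ T → N.∑-mono K.finite (count-≤2 T)) (ℕₚ.≤-reflexive total) T)))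
    where
    open ≡.≡-Reasoning
    total : ∑∑ (λ _ _ → 2) ≡ ∑∑ (λ T v → countE T v ℕ.+ countK T v)
    total = begin
      ∑∑ (λ _ _ → 2)
        ≡⟨ N.∑-cong K.finite (λ _ → N.∑-constant K.finite 2) ⟩
      N.∑ K.finite (λ _ → K.size ℕ.* 2)
        ≡⟨ N.∑-constant K.finite (K.size ℕ.* 2) ⟩
      K.size ℕ.* (K.size ℕ.* 2)
        ≡⟨ trans (sym (ℕₚ.*-assoc K.size K.size 2)) (cong₂ (λ a b → a ℕ.* b ℕ.* 2) sizeK sizeK) ⟩
      Q ℕ.* Q ℕ.* 2
        ≡⟨ trans (ℕₚ.*-comm (Q ℕ.* Q) 2) (cong (Q ℕ.* Q ℕ.+_) (ℕₚ.+-identityʳ _)) ⟩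
      Q ℕ.* Q ℕ.+ Q ℕ.* Q
        ≡⟨ cong₂ ℕ._+_ ∑∑-countE ∑∑-countK ⟨
      ∑∑ countE ℕ.+ ∑∑ countK
        ≡⟨ N.∑-+ K.finite _ _ ⟨
      N.∑ K.finite (λ T → N.∑ K.finite (countE T) ℕ.+ N.∑ K.finite (countK T))
        ≡⟨ N.∑-cong K.finite (λ T → sym (N.∑-+ K.finite (countE T) (countK T))) ⟩
      ∑∑ (λ T v → countE T v ℕ.+ countK T v) ∎

  -- Weil sums of E from products of Weil sums of K, and V_E ≤ 2 V_K.

  module PermutationExponent (d e : ℕ) (1≤d : 1 ℕ.≤ d)
      (inverseE : ∀ x → (x E.^ d) E.^ e ≡ x) (inverseK : ∀ x → (x K.^ d) K.^ e ≡ x) where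
    open RS using (𝟙; 𝟙-true; 𝟙-false; 𝟙-⇔; ∑-𝟙; ∑-cong; ∑-swap; ∑-*ˡ; ∑-*ʳ; ∑-+; ∑-zero; ∑-single; ∑-bijection; ∑-fibres; ∑-const)
    open R using (_+_; _*_; _-_; -_; _≈_; ∣R∣; 0#; 1#; fromℕ·)
    open R.≈R
    open CK using (ψ)
    module FH = FiniteSumHomomorphism (CyclotomicRing.ring 𝒪)

    ∑E : (E.Carrier → ∣R∣) → ∣R∣
    ∑E = RS.∑ E.finite

    ∑K : (K.Carrier → ∣R∣) → ∣R∣
    ∑K = RS.∑ K.finite

    fromQ : ∣R∣
    fromQ = fromℕ· Q

    𝟙-× : ∀ {P P′ : Set} (a : Dec P) (b : Dec P′) → 𝟙 (a ×-dec b) ≈ 𝟙 a * 𝟙 b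
    𝟙-× (yes _) (yes _) = R.sym (R.*-identityˡ 1#)
    𝟙-× (yes _) (no _)  = R.sym (R.zeroʳ 1#)
    𝟙-× (no _)  (yes _) = R.sym (R.zeroˡ 1#)
    𝟙-× (no _)  (no _)  = R.sym (R.zeroˡ 0#)

    -- `count≡2` weighted by a function of the trace T. With f = `ψ` it is the relation of
    -- Hasse-Davenport type; with f = 1 it gives the size of the norm fibres.
    quadratic-sum : ∀ (f : K.Carrier → ∣R∣) v →
      ∑E (λ x → 𝟙 (norm x K.≟F v) * f (tr x)) + ∑K (λ y → ∑K (λ z → 𝟙 ((y K.* z) K.≟F v) * f (y K.+ z)))
        ≈ (1# + 1#) * ∑K f
    quadratic-sum f v = begin
      ∑E (λ x → 𝟙 (norm x K.≟F v) * f (tr x)) + ∑K (λ y → ∑K (λ z → 𝟙 ((y K.* z) K.≟F v) * f (y K.+ z)))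
        ≈⟨ R.+-cong partE partK ⟩
      ∑K (λ T → fromℕ· (countE T v) * f T) + ∑K (λ T → fromℕ· (countK T v) * f T)
        ≈⟨ ∑-+ K.finite _ _ ⟨
      ∑K (λ T → fromℕ· (countE T v) * f T + fromℕ· (countK T v) * f T)
        ≈⟨ ∑-cong K.finite (λ T → R.trans (R.sym (R.distribʳ (f T) _ _)) (R.*-congʳ (two T))) ⟩
      ∑K (λ T → (1# + 1#) * f T)
        ≈⟨ ∑-*ˡ K.finite (1# + 1#) f ⟨
      (1# + 1#) * ∑K f ∎
      where
      two : ∀ T → fromℕ· (countE T v) + fromℕ· (countK T v) ≈ 1# + 1#
      two T = R.trans (R.sym (R.×-homo-+ 1# (countE T v) (countK T v)))
        (R.trans (R.reflexive (cong fromℕ· (count≡2 T v))) (R.+-congˡ (R.+-identityʳ 1#)))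

      partE : ∑E (λ x → 𝟙 (norm x K.≟F v) * f (tr x)) ≈ ∑K (λ T → fromℕ· (countE T v) * f T)
      partE = R.trans (∑-fibres E.finite K.finite tr (λ x → 𝟙 (norm x K.≟F v)) f)
        (∑-cong K.finite (λ T → R.*-congʳ (R.sym (R.trans (FH.fromℕ·-∑ E.finite (λ x → N.𝟙 (InE? T v x)))
          (∑-cong E.finite (λ x → R.trans (FH.fromℕ·-𝟙 (InE? T v x)) (𝟙-× (tr x K.≟F T) (norm x K.≟F v))))))))

      partK : ∑K (λ y → ∑K (λ z → 𝟙 ((y K.* z) K.≟F v) * f (y K.+ z))) ≈ ∑K (λ T → fromℕ· (countK T v) * f T)
      partK = begin
        ∑K (λ y → ∑K (λ z → 𝟙 ((y K.* z) K.≟F v) * f (y K.+ z)))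
          ≈⟨ ∑-cong K.finite (λ y → ∑-bijection K.finite K.finite (K._- y) (y K.+_)
               (λ z → solve 2 (λ y z → y :+ z :- y := z) refl y z) (λ T → solve 2 (λ y T → y :+ (T :- y) := T) refl y T) _) ⟩
        ∑K (λ y → ∑K (λ T → 𝟙 (InK? T v y) * f (y K.+ (T K.- y))))
          ≈⟨ ∑-cong K.finite (λ y → ∑-cong K.finite (λ T → R.*-congˡ (R.reflexive (cong f (solve 2 (λ y T → y :+ (T :- y) := T) refl y T))))) ⟩
        ∑K (λ y → ∑K (λ T → 𝟙 (InK? T v y) * f T))
          ≈⟨ ∑-swap K.finite K.finite _ ⟩
        ∑K (λ T → ∑K (λ y → 𝟙 (InK? T v y) * f T))
          ≈⟨ ∑-cong K.finite (λ T → R.trans (R.sym (∑-*ʳ K.finite (f T) _)) (R.*-congʳ (R.sym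
               (R.trans (FH.fromℕ·-∑ K.finite (λ y → N.𝟙 (InK? T v y))) (∑-cong K.finite (λ y → FH.fromℕ·-𝟙 (InK? T v y))))))) ⟩
        ∑K (λ T → fromℕ· (countK T v) * f T) ∎
        where open K.Solver

    -- For v ≠ 0, `h v` is a Kloosterman sum of K, and `g v` is its analogue on the elements of norm
    -- v.
    g h : K.Carrier → ∣R∣
    g v = ∑E (λ x → 𝟙 (norm x K.≟F v) * ψ (tr x))
    h v = ∑K (λ y → ∑K (λ z → 𝟙 ((y K.* z) K.≟F v) * ψ (y K.+ z)))

    g≈-h : ∀ v → g v ≈ - h v
    g≈-h v = R.+-inverseˡ-unique _ _ (R.trans (quadratic-sum ψ v) (R.trans (R.*-congˡ CK.∑ψ≈0) (R.zeroʳ _)))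

    ψ-≡0 : ∀ {x} → x ≡ K.0# → ψ x ≈ 1#
    ψ-≡0 refl = CK.ψ-0

    g0≈1 : g K.0# ≈ 1#
    g0≈1 = R.trans (∑-single E.finite E.0# (λ x ne → R.trans (R.*-congʳ (𝟙-false (norm x K.≟F K.0#) (ne ∘ norm≡0))) (R.zeroˡ _)))
      (R.trans (R.*-cong (𝟙-true (norm E.0# K.≟F K.0#) norm-0) (R.trans (R.sym (ψ-transitive E.0#)) CE.ψ-0)) (R.*-identityˡ 1#))

    h0≈-1 : h K.0# ≈ - 1#
    h0≈-1 = R.trans (R.sym (R.-‿involutive _)) (R.-‿cong (R.trans (R.sym (g≈-h K.0#)) g0≈1))

    hyperbola : ∀ {v} → v ≢ K.0# → ∀ b → ∑K (λ c → 𝟙 ((b K.* c) K.≟F v)) ≈ 1# - 𝟙 (K.0# K.≟F b)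
    hyperbola {v} v≢0 b with K.0# K.≟F b
    ... | yes refl = R.trans (∑-zero K.finite (λ c → 𝟙-false ((K.0# K.* c) K.≟F v) (λ eq → v≢0 (trans (sym eq) (K.zeroˡ c)))))
        (R.sym (R.-‿inverseʳ 1#))
    ... | no ne = R.trans (∑-single K.finite c₀ (λ c c≢ → 𝟙-false ((b K.* c) K.≟F v) (λ eq → c≢ (K.*-cancelˡ b≢0 (trans eq (sym bc₀))))))
        (R.trans (𝟙-true ((b K.* c₀) K.≟F v) bc₀) (R.sym (R.trans (R.+-congˡ R.-0#≈0#) (R.+-identityʳ 1#))))
      where
      b≢0 : b ≢ K.0#
      b≢0 eq = ne (sym eq)
      c₀ : K.Carrier
      c₀ = b K.⁻¹⟨ b≢0 ⟩ K.* v
      bc₀ : b K.* c₀ ≡ v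
      bc₀ = K.x*[x⁻¹*y] b≢0 v

    ∑K-1 : ∑K (λ _ → 1#) ≈ fromQ
    ∑K-1 = R.trans (∑-const K.finite 1#) (R.reflexive (cong fromℕ· sizeK))

    countK* : ∀ {v} → v ≢ K.0# → ∑K (λ b → ∑K (λ c → 𝟙 ((b K.* c) K.≟F v))) ≈ fromQ - 1#
    countK* {v} v≢0 = begin
      ∑K (λ b → ∑K (λ c → 𝟙 ((b K.* c) K.≟F v)))    ≈⟨ ∑-cong K.finite (hyperbola v≢0) ⟩
      ∑K (λ b → 1# - 𝟙 (K.0# K.≟F b))               ≈⟨ ∑-sub (λ _ → 1#) (λ b → 𝟙 (K.0# K.≟F b)) ⟩
      ∑K (λ _ → 1#) - ∑K (λ b → 𝟙 (K.0# K.≟F b))    ≈⟨ R.+-cong ∑K-1 (R.-‿cong (∑-𝟙 K.finite K.0#)) ⟩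
      fromQ - 1#                                    ∎
      where
      ∑-sub : ∀ f f′ → ∑K (λ b → f b - f′ b) ≈ ∑K f - ∑K f′
      ∑-sub f f′ = R.trans (∑-+ K.finite f (λ b → - f′ b)) (R.+-congˡ (R.trans (∑-cong K.finite (λ b → minus (f′ b)))
          (R.trans (R.sym (∑-*ˡ K.finite (- 1#) f′)) (R.sym (minus _)))))
        where
        minus : ∀ x → - x ≈ (- 1#) * x
        minus = solveᴿ 1 (λ x → -:ᴿ x :=ᴿ (-:ᴿ conᴿ (+ 1)) :*ᴿ x) R.refl

    -- The two counts add up to 2 Q, and the hyperbola b c = v has Q - 1 points.
    countE* : ∀ {v} → v ≢ K.0# → ∑E (λ x → 𝟙 (norm x K.≟F v)) ≈ 1# + fromQ
    countE* {v} v≢0 = R.x-y≈0⇒x≈y (begin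
      A - (1# + fromQ)
        ≈⟨ solve 3 (λ a b q → a :- (con (+ 1) :+ q) := (a :+ b) :- ((con (+ 1) :+ con (+ 1)) :* q) :+ (q :- con (+ 1) :- b)) R.refl A B fromQ ⟩
      (A + B) - (1# + 1#) * fromQ + (fromQ - 1# - B)
        ≈⟨ R.+-cong (R.x≈y⇒x-y≈0 total) (R.x≈y⇒x-y≈0 (R.sym (countK* v≢0))) ⟩
      0# + 0#
        ≈⟨ R.+-identityˡ 0# ⟩
      0# ∎)
      where
      open R.Solver
      A B : ∣R∣
      A = ∑E (λ x → 𝟙 (norm x K.≟F v))
      B = ∑K (λ b → ∑K (λ c → 𝟙 ((b K.* c) K.≟F v)))
      total : A + B ≈ (1# + 1#) * fromQ
      total = R.trans (R.+-cong (∑-cong E.finite (λ x → R.sym (R.*-identityʳ _)))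
          (∑-cong K.finite (λ b → ∑-cong K.finite (λ c → R.sym (R.*-identityʳ _)))))
        (R.trans (quadratic-sum (λ _ → 1#) v) (R.*-congˡ ∑K-1))

    neg-scale : ∀ {x} → x ≢ E.0# → (f : E.Carrier → ∣R∣) → ∑E f ≈ ∑E (λ a → f (E.- (a E.* x)))
    neg-scale {x} x≢0 f = R.trans (CE.scale-bijection -x≢0 f)
        (∑-cong E.finite (λ a → R.reflexive (cong f (solveᴱ 2 (λ a x → (-:ᴱ x) :*ᴱ a :=ᴱ -:ᴱ (a :*ᴱ x)) refl a x))))
      where
      -x≢0 : E.- x ≢ E.0#
      -x≢0 eq = x≢0 (trans (sym (E.-‿involutive x)) (trans (cong E.-_ eq) E.-0#≈0#))

    -- For x ≠ 0, the map from a to - a x carries norm v to norm v N(x). At x = 0 the sum counts a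
    -- norm fibre, Q + 1 = g(0) + Q, which explains the correction.
    twistE : ∀ {v} → v ≢ K.0# → ∀ x →
      ∑E (λ a → 𝟙 (norm a K.≟F v) * CE.ψ (E.- (a E.* x))) ≈ g (v K.* norm x) + 𝟙 (E.0# E.≟F x) * fromQ
    twistE {v} v≢0 x with E.0# E.≟F x
    ... | yes refl = begin
      ∑E (λ a → 𝟙 (norm a K.≟F v) * CE.ψ (E.- (a E.* E.0#)))
        ≈⟨ ∑-cong E.finite (λ a → R.trans
             (R.*-congˡ (R.trans (R.reflexive (cong CE.ψ (trans (cong E.-_ (E.zeroʳ a)) E.-0#≈0#))) CE.ψ-0))
             (R.*-identityʳ _)) ⟩
      ∑E (λ a → 𝟙 (norm a K.≟F v))         ≈⟨ countE* v≢0 ⟩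
      1# + fromQ                           ≈⟨ R.+-cong (R.sym g0≈1) (R.sym (R.*-identityˡ fromQ)) ⟩
      g K.0# + 1# * fromQ                  ≡⟨ cong (λ w → g w + 1# * fromQ) (trans (cong (v K.*_) norm-0) (K.zeroʳ v)) ⟨
      g (v K.* norm E.0#) + 1# * fromQ     ∎
    ... | no ne = R.trans (R.sym (begin
      g (v K.* norm x)
        ≈⟨ neg-scale x≢0 _ ⟩
      ∑E (λ a → 𝟙 (norm (E.- (a E.* x)) K.≟F (v K.* norm x)) * ψ (tr (E.- (a E.* x))))
        ≈⟨ ∑-cong E.finite (λ a → R.*-cong (𝟙-⇔ (norm (E.- (a E.* x)) K.≟F (v K.* norm x)) (norm a K.≟F v)
             (λ eq → K.*-cancelʳ norm≢0 (trans (sym (step a)) eq)) (λ eq → trans (step a) (cong (K._* norm x) eq)))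
             (R.sym (ψ-transitive _))) ⟩
      ∑E (λ a → 𝟙 (norm a K.≟F v) * CE.ψ (E.- (a E.* x))) ∎))
      (R.sym (R.trans (R.+-congˡ (R.zeroˡ fromQ)) (R.+-identityʳ _)))
      where
      x≢0 : x ≢ E.0#
      x≢0 eq = ne (sym eq)
      norm≢0 : norm x ≢ K.0#
      norm≢0 eq = x≢0 (norm≡0 eq)
      step : ∀ a → norm (E.- (a E.* x)) ≡ norm a K.* norm x
      step a = trans (norm-neg _) (norm-* a x)

    -- The counterpart for K of the sum in `twistE`: a pair (s, t) takes the place of the element x
    -- of E, and s t that of its norm.
    J : K.Carrier → K.Carrier → K.Carrier → ∣R∣
    J w s t = ∑K (λ b → ∑K (λ c → 𝟙 ((b K.* c) K.≟F w) * (ψ (s K.* b) * ψ (t K.* c))))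

    J-swap : ∀ w s t → J w s t ≈ J w t s
    J-swap w s t = R.trans (∑-swap K.finite K.finite _) (∑-cong K.finite (λ c → ∑-cong K.finite (λ b →
      R.*-cong (𝟙-⇔ ((b K.* c) K.≟F w) ((c K.* b) K.≟F w) (trans (K.*-comm c b)) (trans (K.*-comm b c))) (R.*-comm _ _))))

    J-scale : ∀ {s} → s ≢ K.0# → ∀ w t → J w s t ≈ J (s K.* w) K.1# t
    J-scale {s} s≢0 w t = R.sym (R.trans (CK.scale-bijection s≢0 _) (∑-cong K.finite (λ b → ∑-cong K.finite (λ c →
      R.*-cong (𝟙-⇔ (((s K.* b) K.* c) K.≟F (s K.* w)) ((b K.* c) K.≟F w)
          (λ eq → K.*-cancelˡ s≢0 (trans (sym (K.*-assoc s b c)) eq)) (λ eq → trans (K.*-assoc s b c) (cong (s K.*_) eq)))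
        (R.*-congʳ (R.reflexive (cong ψ (K.*-identityˡ _))))))))

    J-1-0 : ∀ {w} → w ≢ K.0# → J w K.1# K.0# ≈ - 1#
    J-1-0 {w} w≢0 = begin
      J w K.1# K.0#
        ≈⟨ ∑-cong K.finite (λ b → ∑-cong K.finite (λ c → R.trans (R.*-congˡ (R.trans (R.*-cong (R.reflexive (cong ψ (K.*-identityˡ b)))
             (ψ-≡0 (K.zeroˡ c))) (R.*-identityʳ (ψ b)))) (R.*-comm _ _))) ⟩
      ∑K (λ b → ∑K (λ c → ψ b * 𝟙 ((b K.* c) K.≟F w)))
        ≈⟨ ∑-cong K.finite (λ b → R.trans (R.sym (∑-*ˡ K.finite (ψ b) _)) (R.*-congˡ (hyperbola w≢0 b))) ⟩
      ∑K (λ b → ψ b * (1# - 𝟙 (K.0# K.≟F b)))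
        ≈⟨ ∑-cong K.finite (λ b → solveᴿ 2 (λ x i → x :*ᴿ (conᴿ (+ 1) :-ᴿ i)
             :=ᴿ x :+ᴿ i :*ᴿ (-:ᴿ x)) R.refl (ψ b) (𝟙 (K.0# K.≟F b))) ⟩
      ∑K (λ b → ψ b + 𝟙 (K.0# K.≟F b) * (- ψ b))
        ≈⟨ ∑-+ K.finite _ _ ⟩
      ∑K ψ + ∑K (λ b → 𝟙 (K.0# K.≟F b) * (- ψ b))
        ≈⟨ R.+-cong CK.∑ψ≈0 (RS.∑-select K.finite K.0# (λ b → - ψ b)) ⟩
      0# + - ψ K.0#
        ≈⟨ R.trans (R.+-identityˡ _) (R.-‿cong CK.ψ-0) ⟩
      - 1# ∎

    h-boundary : ∀ {w x} → w ≡ K.0# → x ≈ 0# → - 1# ≈ h w + x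
    h-boundary refl x≈0 = R.sym (R.trans (R.+-cong h0≈-1 x≈0) (R.+-identityʳ _))

    -- Nonzero s and t are absorbed into b and c. If just one of them is 0, the sum is -1 = h(0); if
    -- both are, it is Q - 1 = h(0) + Q.
    J≈h : ∀ {v} → v ≢ K.0# → ∀ s t →
      J v s t ≈ h (v K.* (s K.* t)) + 𝟙 (K.0# K.≟F s) * 𝟙 (K.0# K.≟F t) * fromQ
    J≈h {v} v≢0 s t with K.0# K.≟F s | K.0# K.≟F t
    ... | yes refl | yes refl = begin
      J v K.0# K.0#
        ≈⟨ ∑-cong K.finite (λ b → ∑-cong K.finite (λ c → R.trans
             (R.*-congˡ (R.trans (R.*-cong (ψ-≡0 (K.zeroˡ b)) (ψ-≡0 (K.zeroˡ c))) (R.*-identityˡ 1#)))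
             (R.*-identityʳ _))) ⟩
      ∑K (λ b → ∑K (λ c → 𝟙 ((b K.* c) K.≟F v)))
        ≈⟨ countK* v≢0 ⟩
      fromQ - 1#
        ≈⟨ solveᴿ 1 (λ q → q :-ᴿ conᴿ (+ 1) :=ᴿ (-:ᴿ conᴿ (+ 1)) :+ᴿ conᴿ (+ 1) :*ᴿ conᴿ (+ 1) :*ᴿ q) R.refl fromQ ⟩
      - 1# + 1# * 1# * fromQ
        ≈⟨ R.+-congʳ (R.sym h0≈-1) ⟩
      h K.0# + 1# * 1# * fromQ
        ≡⟨ cong (λ w → h w + 1# * 1# * fromQ) (trans (cong (v K.*_) (K.zeroˡ K.0#)) (K.zeroʳ v)) ⟨
      h (v K.* (K.0# K.* K.0#)) + 1# * 1# * fromQ ∎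
    ... | no s≢0 | yes refl = begin
      J v s K.0#              ≈⟨ J-scale (s≢0 ∘ sym) v K.0# ⟩
      J (s K.* v) K.1# K.0#   ≈⟨ J-1-0 (K.*-nonzero (s≢0 ∘ sym) v≢0) ⟩
      - 1#                    ≈⟨ h-boundary (trans (cong (v K.*_) (K.zeroʳ s)) (K.zeroʳ v))
                                   (R.trans (R.*-congʳ (R.zeroˡ 1#)) (R.zeroˡ fromQ)) ⟩
      h (v K.* (s K.* K.0#)) + 0# * 1# * fromQ ∎
    ... | yes refl | no t≢0 = begin
      J v K.0# t              ≈⟨ J-swap v K.0# t ⟩
      J v t K.0#              ≈⟨ J-scale (t≢0 ∘ sym) v K.0# ⟩
      J (t K.* v) K.1# K.0#   ≈⟨ J-1-0 (K.*-nonzero (t≢0 ∘ sym) v≢0) ⟩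
      - 1#                    ≈⟨ h-boundary (trans (cong (v K.*_) (K.zeroˡ t)) (K.zeroʳ v))
                                   (R.trans (R.*-congʳ (R.zeroʳ 1#)) (R.zeroˡ fromQ)) ⟩
      h (v K.* (K.0# K.* t)) + 1# * 0# * fromQ ∎
    ... | no s≢0 | no t≢0 = begin
      J v s t                                      ≈⟨ J-scale (s≢0 ∘ sym) v t ⟩
      J (s K.* v) K.1# t                           ≈⟨ J-swap _ _ _ ⟩
      J (s K.* v) t K.1#                           ≈⟨ J-scale (t≢0 ∘ sym) (s K.* v) K.1# ⟩
      J (t K.* (s K.* v)) K.1# K.1#
        ≈⟨ ∑-cong K.finite (λ b → ∑-cong K.finite (λ c → R.*-cong
             (R.reflexive (cong (λ w → 𝟙 ((b K.* c) K.≟F w))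
               (solveᴷ 3 (λ t s v → t :*ᴷ (s :*ᴷ v) :=ᴷ v :*ᴷ (s :*ᴷ t)) refl t s v)))
             (R.trans (R.*-cong (R.reflexive (cong ψ (K.*-identityˡ b))) (R.reflexive (cong ψ (K.*-identityˡ c)))) (R.sym (CK.ψ-+ b c))))) ⟩
      h (v K.* (s K.* t))
        ≈⟨ R.+-identityʳ _ ⟨
      h (v K.* (s K.* t)) + 0#
        ≈⟨ R.+-congˡ (R.trans (R.*-congʳ (R.zeroˡ 0#)) (R.zeroˡ fromQ)) ⟨
      h (v K.* (s K.* t)) + 0# * 0# * fromQ ∎

    inverseE′ : ∀ x → (x E.^ e) E.^ d ≡ x
    inverseE′ x = trans (E.^-assocʳ x e d) (trans (cong (x E.^_) (ℕₚ.*-comm e d)) (trans (sym (E.^-assocʳ x d e)) (inverseE x)))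

    inverseK′ : ∀ x → (x K.^ e) K.^ d ≡ x
    inverseK′ x = trans (K.^-assocʳ x e d) (trans (cong (x K.^_) (ℕₚ.*-comm e d)) (trans (sym (K.^-assocʳ x d e)) (inverseK x)))

    d≢0 : NonZero d
    d≢0 = ℕ.>-nonZero 1≤d

    A B : K.Carrier → ∣R∣
    A v = ∑E (λ a → 𝟙 (norm a K.≟F v) * CE.W d a)
    B v = ∑K (λ b → ∑K (λ c → 𝟙 ((b K.* c) K.≟F v) * (CK.W d b * CK.W d c)))

    private
      rotate : ∀ {x y z : ∣R∣} → x * (y * z) ≈ y * (x * z)
      rotate {x} {y} {z} = solveᴿ 3 (λ x y z → x :*ᴿ (y :*ᴿ z) :=ᴿ y :*ᴿ (x :*ᴿ z)) R.refl x y z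

    -- Sum over a first, by `twistE`; the correction at x = 0 leaves the summand Q. With x = y^e,
    -- the factor ψ(x^d) becomes ψ(tr y) and N(x) becomes N(y)^e, and the sum groups by μ = N(y).
    A≈ : ∀ {v} → v ≢ K.0# → A v ≈ ∑K (λ μ → g μ * g (v K.* μ K.^ e)) + fromQ
    A≈ {v} v≢0 = begin
      A v
        ≈⟨ ∑-cong E.finite (λ a → R.trans (∑-*ˡ E.finite _ _) (∑-cong E.finite (λ x →
             R.trans (R.*-congˡ (CE.ψ-+ (x E.^ d) (E.- (a E.* x)))) rotate))) ⟩
      ∑E (λ a → ∑E (λ x → CE.ψ (x E.^ d) * (𝟙 (norm a K.≟F v) * CE.ψ (E.- (a E.* x)))))
        ≈⟨ ∑-swap E.finite E.finite _ ⟩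
      ∑E (λ x → ∑E (λ a → CE.ψ (x E.^ d) * (𝟙 (norm a K.≟F v) * CE.ψ (E.- (a E.* x)))))
        ≈⟨ ∑-cong E.finite (λ x → R.trans (R.sym (∑-*ˡ E.finite (CE.ψ (x E.^ d)) _)) (R.trans (R.*-congˡ (twistE v≢0 x))
             (R.trans (R.distribˡ _ _ _) (R.+-congˡ rotate)))) ⟩
      ∑E (λ x → CE.ψ (x E.^ d) * g (v K.* norm x) + 𝟙 (E.0# E.≟F x) * (CE.ψ (x E.^ d) * fromQ))
        ≈⟨ ∑-+ E.finite _ _ ⟩
      ∑E (λ x → CE.ψ (x E.^ d) * g (v K.* norm x)) + ∑E (λ x → 𝟙 (E.0# E.≟F x) * (CE.ψ (x E.^ d) * fromQ))
        ≈⟨ R.+-cong main (R.trans (RS.∑-select E.finite E.0# (λ x → CE.ψ (x E.^ d) * fromQ)) zero-term) ⟩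
      ∑K (λ μ → g μ * g (v K.* μ K.^ e)) + fromQ ∎
      where
      zero-term : CE.ψ (E.0# E.^ d) * fromQ ≈ fromQ
      zero-term = R.trans (R.*-congʳ (R.trans (R.reflexive (cong CE.ψ (E.0^ d {{d≢0}}))) CE.ψ-0)) (R.*-identityˡ fromQ)
      main : ∑E (λ x → CE.ψ (x E.^ d) * g (v K.* norm x)) ≈ ∑K (λ μ → g μ * g (v K.* μ K.^ e))
      main = begin
        ∑E (λ x → CE.ψ (x E.^ d) * g (v K.* norm x))
          ≈⟨ ∑-bijection E.finite E.finite (E._^ e) (E._^ d) inverseE inverseE′ _ ⟩
        ∑E (λ y → CE.ψ ((y E.^ e) E.^ d) * g (v K.* norm (y E.^ e)))
          ≈⟨ ∑-cong E.finite (λ y → R.*-cong (R.trans (R.reflexive (cong CE.ψ (inverseE′ y))) (ψ-transitive y))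
               (R.reflexive (cong (λ w → g (v K.* w)) (norm-^ y e)))) ⟩
        ∑E (λ y → ψ (tr y) * g (v K.* norm y K.^ e))
          ≈⟨ ∑-fibres E.finite K.finite norm (ψ ∘ tr) (λ μ → g (v K.* μ K.^ e)) ⟩
        ∑K (λ μ → g μ * g (v K.* μ K.^ e)) ∎

    -- The same computation on pairs (x, y), with `J≈h` for `twistE` and the product x y for the
    -- norm.
    B≈ : ∀ {v} → v ≢ K.0# → B v ≈ ∑K (λ μ → h μ * h (v K.* μ K.^ e)) + fromQ
    B≈ {v} v≢0 = begin
      B v
        ≈⟨ ∑-cong K.finite (λ b → ∑-cong K.finite (λ c → expand b c)) ⟩
      ∑K (λ b → ∑K (λ c → ∑K (λ x → ∑K (λ y → F b c x y))))
        ≈⟨ ∑-cong K.finite (λ b → R.trans (∑-swap K.finite K.finite _) (∑-cong K.finite (λ x → ∑-swap K.finite K.finite _))) ⟩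
      ∑K (λ b → ∑K (λ x → ∑K (λ y → ∑K (λ c → F b c x y))))
        ≈⟨ R.trans (∑-swap K.finite K.finite _) (∑-cong K.finite (λ x → ∑-swap K.finite K.finite _)) ⟩
      ∑K (λ x → ∑K (λ y → ∑K (λ b → ∑K (λ c → F b c x y))))
        ≈⟨ ∑-cong K.finite (λ x → ∑-cong K.finite (λ y → collapse x y)) ⟩
      ∑K (λ x → ∑K (λ y → P x y * h (v K.* (x K.* y)) + 𝟙 (K.0# K.≟F x) * (𝟙 (K.0# K.≟F y) * (P x y * fromQ))))
        ≈⟨ R.trans (∑-cong K.finite (λ x → ∑-+ K.finite _ _)) (∑-+ K.finite _ _) ⟩
      ∑K (λ x → ∑K (λ y → P x y * h (v K.* (x K.* y)))) + ∑K (λ x → ∑K (λ y → 𝟙 (K.0# K.≟F x) * (𝟙 (K.0# K.≟F y) * (P x y * fromQ))))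
        ≈⟨ R.+-cong main (R.trans (∑-cong K.finite (λ x → R.trans (R.sym (∑-*ˡ K.finite _ _))
             (R.*-congˡ (RS.∑-select K.finite K.0# (λ y → P x y * fromQ)))))
             (R.trans (RS.∑-select K.finite K.0# (λ x → P x K.0# * fromQ)) zero-term)) ⟩
      ∑K (λ μ → h μ * h (v K.* μ K.^ e)) + fromQ ∎
      where
      P : K.Carrier → K.Carrier → ∣R∣
      P x y = ψ (x K.^ d) * ψ (y K.^ d)

      F : K.Carrier → K.Carrier → K.Carrier → K.Carrier → ∣R∣
      F b c x y = P x y * (𝟙 ((b K.* c) K.≟F v) * (ψ ((K.- x) K.* b) * ψ ((K.- y) K.* c)))

      ψ-split : ∀ x b → ψ (x K.^ d K.- b K.* x) ≈ ψ (x K.^ d) * ψ ((K.- x) K.* b)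
      ψ-split x b = R.trans (CK.ψ-+ _ _) (R.*-congˡ (R.reflexive (cong ψ
        (solveᴷ 2 (λ x b → -:ᴷ (b :*ᴷ x) :=ᴷ (-:ᴷ x) :*ᴷ b) refl x b))))

      expand : ∀ b c → 𝟙 ((b K.* c) K.≟F v) * (CK.W d b * CK.W d c) ≈ ∑K (λ x → ∑K (λ y → F b c x y))
      expand b c = begin
        𝟙 ((b K.* c) K.≟F v) * (CK.W d b * CK.W d c)
          ≈⟨ R.*-congˡ (RS.∑-*∑ K.finite K.finite _ _) ⟩
        𝟙 ((b K.* c) K.≟F v) * ∑K (λ x → ∑K (λ y → ψ (x K.^ d K.- b K.* x) * ψ (y K.^ d K.- c K.* y)))
          ≈⟨ R.trans (∑-*ˡ K.finite _ _) (∑-cong K.finite (λ x → ∑-*ˡ K.finite _ _)) ⟩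
        ∑K (λ x → ∑K (λ y → 𝟙 ((b K.* c) K.≟F v) * (ψ (x K.^ d K.- b K.* x) * ψ (y K.^ d K.- c K.* y))))
          ≈⟨ ∑-cong K.finite (λ x → ∑-cong K.finite (λ y → R.trans (R.*-congˡ (R.*-cong (ψ-split x b) (ψ-split y c)))
               (solveᴿ 5 (λ i a b c d → i :*ᴿ ((a :*ᴿ b) :*ᴿ (c :*ᴿ d))
                 :=ᴿ (a :*ᴿ c) :*ᴿ (i :*ᴿ (b :*ᴿ d))) R.refl
                 (𝟙 ((b K.* c) K.≟F v)) (ψ (x K.^ d)) (ψ ((K.- x) K.* b)) (ψ (y K.^ d)) (ψ ((K.- y) K.* c))))) ⟩
        ∑K (λ x → ∑K (λ y → F b c x y)) ∎

      𝟙-neg : ∀ x → 𝟙 (K.0# K.≟F (K.- x)) ≈ 𝟙 (K.0# K.≟F x)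
      𝟙-neg x = 𝟙-⇔ (K.0# K.≟F (K.- x)) (K.0# K.≟F x)
        (λ eq → trans (sym K.-0#≈0#) (trans (cong K.-_ eq) (K.-‿involutive x)))
        (λ eq → trans (sym K.-0#≈0#) (cong K.-_ eq))

      collapse : ∀ x y → ∑K (λ b → ∑K (λ c → F b c x y)) ≈
        P x y * h (v K.* (x K.* y)) + 𝟙 (K.0# K.≟F x) * (𝟙 (K.0# K.≟F y) * (P x y * fromQ))
      collapse x y = begin
        ∑K (λ b → ∑K (λ c → F b c x y))
          ≈⟨ R.trans (∑-cong K.finite (λ b → R.sym (∑-*ˡ K.finite (P x y) _))) (R.sym (∑-*ˡ K.finite (P x y) _)) ⟩
        P x y * J v (K.- x) (K.- y)
          ≈⟨ R.*-congˡ (J≈h v≢0 (K.- x) (K.- y)) ⟩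
        P x y * (h (v K.* ((K.- x) K.* (K.- y))) + 𝟙 (K.0# K.≟F (K.- x)) * 𝟙 (K.0# K.≟F (K.- y)) * fromQ)
          ≈⟨ R.*-congˡ (R.+-cong (R.reflexive (cong (λ w → h (v K.* w)) (solveᴷ 2 (λ x y → (-:ᴷ x) :*ᴷ (-:ᴷ y) :=ᴷ x :*ᴷ y) refl x y)))
               (R.*-congʳ (R.*-cong (𝟙-neg x) (𝟙-neg y)))) ⟩
        P x y * (h (v K.* (x K.* y)) + 𝟙 (K.0# K.≟F x) * 𝟙 (K.0# K.≟F y) * fromQ)
          ≈⟨ solveᴿ 5 (λ p h i j q → p :*ᴿ (h :+ᴿ i :*ᴿ j :*ᴿ q)
               :=ᴿ p :*ᴿ h :+ᴿ i :*ᴿ (j :*ᴿ (p :*ᴿ q))) R.refl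
               (P x y) (h (v K.* (x K.* y))) (𝟙 (K.0# K.≟F x)) (𝟙 (K.0# K.≟F y)) fromQ ⟩
        P x y * h (v K.* (x K.* y)) + 𝟙 (K.0# K.≟F x) * (𝟙 (K.0# K.≟F y) * (P x y * fromQ)) ∎

      zero-term : P K.0# K.0# * fromQ ≈ fromQ
      zero-term = R.trans (R.*-congʳ (R.trans (R.*-cong ψ0 ψ0) (R.*-identityˡ 1#))) (R.*-identityˡ fromQ)
        where
        ψ0 : ψ (K.0# K.^ d) ≈ 1#
        ψ0 = ψ-≡0 (K.0^ d {{d≢0}})

      main : ∑K (λ x → ∑K (λ y → P x y * h (v K.* (x K.* y)))) ≈ ∑K (λ μ → h μ * h (v K.* μ K.^ e))
      main = begin
        ∑K (λ x → ∑K (λ y → P x y * h (v K.* (x K.* y))))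
          ≈⟨ R.trans (∑-bijection K.finite K.finite (K._^ e) (K._^ d) inverseK inverseK′ _)
               (∑-cong K.finite (λ x → ∑-bijection K.finite K.finite (K._^ e) (K._^ d) inverseK inverseK′ _)) ⟩
        ∑K (λ x → ∑K (λ y → P (x K.^ e) (y K.^ e) * h (v K.* (x K.^ e K.* y K.^ e))))
          ≈⟨ ∑-cong K.finite (λ x → ∑-cong K.finite (λ y → R.*-cong
               (R.trans (R.*-cong (R.reflexive (cong ψ (inverseK′ x))) (R.reflexive (cong ψ (inverseK′ y)))) (R.sym (CK.ψ-+ x y)))
               (R.reflexive (cong (λ w → h (v K.* w)) (sym (K.^-distrib-* x y e)))))) ⟩
        ∑K (λ x → ∑K (λ y → ψ (x K.+ y) * h (v K.* (x K.* y) K.^ e)))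
          ≈⟨ ∑-cong K.finite (λ x → ∑-fibres K.finite K.finite (x K.*_) (λ y → ψ (x K.+ y)) (λ μ → h (v K.* μ K.^ e))) ⟩
        ∑K (λ x → ∑K (λ μ → ∑K (λ y → 𝟙 ((x K.* y) K.≟F μ) * ψ (x K.+ y)) * h (v K.* μ K.^ e)))
          ≈⟨ ∑-swap K.finite K.finite _ ⟩
        ∑K (λ μ → ∑K (λ x → ∑K (λ y → 𝟙 ((x K.* y) K.≟F μ) * ψ (x K.+ y)) * h (v K.* μ K.^ e)))
          ≈⟨ ∑-cong K.finite (λ μ → R.sym (∑-*ʳ K.finite _ _)) ⟩
        ∑K (λ μ → h μ * h (v K.* μ K.^ e)) ∎

    A≈B : ∀ {v} → v ≢ K.0# → A v ≈ B v
    A≈B {v} v≢0 = R.trans (A≈ v≢0) (R.trans (R.+-congʳ (∑-cong K.finite (λ μ →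
        R.trans (R.*-cong (g≈-h μ) (g≈-h (v K.* μ K.^ e)))
          (solveᴿ 2 (λ a b → (-:ᴿ a) :*ᴿ (-:ᴿ b) :=ᴿ a :*ᴿ b) R.refl (h μ) (h (v K.* μ K.^ e))))))
      (R.sym (B≈ v≢0)))

    open Reduction pr 𝒪 K (HasCharDeg.charp charK)
    open CyclotomicRing 𝒪 using (π)

    private
      WK : K.Carrier → R.∣R∣
      WK = CK.W d

      WK0≈0 : WK K.0# R.≈ R.0#
      WK0≈0 = R.trans (RS.∑-bijection K.finite K.finite (K._^ e) (K._^ d) inverseK inverseK′ _)
        (R.trans (RS.∑-cong K.finite (λ x → R.reflexive (cong CK.ψ (trans (cong₂ K._-_ (inverseK′ x) (K.zeroˡ _))
          (solveᴷ 1 (λ x → x :-ᴷ conᴷ (+ 0) :=ᴷ x) refl x))))) CK.∑ψ≈0)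

      -- `A≈B` covers v ≠ 0 only. At v = 0 every term contains W_K(0), which is 0 because x^d
      -- permutes K.
      B0≈0 : B K.0# R.≈ R.0#
      B0≈0 = RS.∑-zero K.finite (λ b → RS.∑-zero K.finite (λ c → term b c))
        where
        term : ∀ b c → RS.𝟙 ((b K.* c) K.≟F K.0#) R.* (WK b R.* WK c) R.≈ R.0#
        term b c with (b K.* c) K.≟F K.0#
        ... | no _ = R.zeroˡ _
        ... | yes eq with K.x*y≡0 eq
        ...   | inj₁ refl = R.trans (R.*-congˡ (R.trans (R.*-congʳ WK0≈0) (R.zeroˡ _))) (R.zeroʳ _)
        ...   | inj₂ refl = R.trans (R.*-congˡ (R.trans (R.*-congˡ WK0≈0) (R.zeroʳ _))) (R.zeroʳ _)

      -- Descends from v: an element whose sum is not divisible by π^v becomes the witness for v -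
      -- 1. The search ends at the exact minimum of the valuations.
      minimal : ∀ v → Σ K.Carrier (λ b → ¬ Divides (suc v) (WK b)) →
        Σ ℕ λ v′ → v′ ℕ.≤ v × (∀ b → Divides v′ (WK b)) × Σ K.Carrier (λ b → ¬ Divides (suc v′) (WK b))
      minimal v found with Finite.search-all K.finite (λ b → Divides? v (WK b))
      minimal v       found | inj₁ all       = v , ℕₚ.≤-refl , all , found
      minimal zero    found | inj₂ (b , ¬d)  = ⊥-elim (¬d (WK b , R.sym (R.*-identityˡ _)))
      minimal (suc v) found | inj₂ found′ with minimal v found′
      ... | v′ , v′≤v , rest = v′ , ℕₚ.m≤n⇒m≤1+n v′≤v , rest

    -- Divide all W_K by their largest common power π^v′ and reduce modulo `π` to get f. More than 2
    -- v′ factors in all W_E would give f * f = 0, hence f = 0, against the choice of v′.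
    descent : ∀ v → Σ K.Carrier (λ b → ¬ Divides (suc v) (WK b)) →
              ¬ (∀ a → Divides (suc (v ℕ.+ v)) (CE.W d a))
    descent v found divisible with minimal v found
    ... | v′ , v′≤v , all , b₁ , ¬d = ¬d (Divides-resp (R.sym (factorisation (all b₁)))
            (divides-more (θ≡0⇒Divides (w b₁) (GroupAlgebra.convolution-reduced K f f*f≡0 b₁))))
      where
      open Divides
      w : K.Carrier → R.∣R∣
      w b = quotient (all b)

      f : K.Carrier → K.Carrier
      f b = θ (w b)

      divides-more : ∀ {x} → Divides 1 x → Divides (suc v′) (π R.^ v′ R.* x)
      divides-more (y , h) = y , R.trans (R.*-congˡ h) (R.trans (R.sym (R.*-assoc _ _ _)) (R.*-congʳ
        (R.trans (R.sym (R.^-homo-* π v′ 1)) (R.reflexive (cong (π R.^_) (ℕₚ.+-comm v′ 1))))))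

      S : K.Carrier → R.∣R∣
      S u = RS.∑ K.finite (λ b → RS.∑ K.finite (λ c → RS.𝟙 ((b K.* c) K.≟F u) R.* (w b R.* w c)))

      B≈π^S : ∀ u → B u R.≈ π R.^ (v′ ℕ.+ v′) R.* S u
      B≈π^S u = R.trans (RS.∑-cong K.finite (λ b → R.trans (RS.∑-cong K.finite (λ c →
          R.trans (R.*-congˡ (R.*-cong (factorisation (all b)) (factorisation (all c))))
            (R.trans (solveᴿ 4 (λ i P x y → i :*ᴿ ((P :*ᴿ x) :*ᴿ (P :*ᴿ y)) :=ᴿ
                (P :*ᴿ P) :*ᴿ (i :*ᴿ (x :*ᴿ y))) R.refl (RS.𝟙 ((b K.* c) K.≟F u)) (π R.^ v′) (w b) (w c))
              (R.*-congʳ (R.sym (R.^-homo-* π v′ v′)))))) (R.sym (RS.∑-*ˡ K.finite _ _)))) (R.sym (RS.∑-*ˡ K.finite _ _))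

      Divides-B : ∀ u → Divides (suc (v ℕ.+ v)) (B u)
      Divides-B u with u K.≟F K.0#
      ... | yes refl = Divides-resp (R.sym B0≈0) (Divides-0 _)
      ... | no u≢0   = Divides-resp (A≈B u≢0) (Divides-∑ E.finite (λ a → Divides-resp (R.*-comm _ _) (Divides-* (RS.𝟙 (norm a K.≟F u)) (divisible a))))

      Divides-S : ∀ u → Divides 1 (S u)
      Divides-S u = Divides-cancel (v′ ℕ.+ v′) 1 (Divides-resp (B≈π^S u) (Divides-≤
        (subst (ℕ._≤ suc (v ℕ.+ v)) (ℕₚ.+-comm 1 (v′ ℕ.+ v′)) (s≤s (ℕₚ.+-mono-≤ v′≤v v′≤v))) (Divides-B u)))

      f*f≡0 : ∀ u → K.∑ K.finite (λ b → K.∑ K.finite (λ c → K.𝟙 ((b K.* c) K.≟F u) K.* (f b K.* f c))) ≡ K.0#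
      f*f≡0 u = trans (sym (trans (θ-∑ K.finite _) (K.∑-cong K.finite (λ b → trans (θ-∑ K.finite _) (K.∑-cong K.finite (λ c →
        trans (θ-* _ _) (cong₂ K._*_ (θ-𝟙 ((b K.* c) K.≟F u)) (θ-* _ _)))))))) (θ-0 (Divides-S u))

  -- The first nondegenerate step: lines in an affine plane.

  -- The case of an exponent that is 1 modulo Q - 1. For a in the affine plane E
  -- over K, Z a - 1 is Q - 1 times the number of lines tr (a x) = tr (x^d) through a,
  -- one line in each of the Q + 1 directions. If p divides every Z a, then the lines
  -- cover the plane, and as in the classification of blocking sets of size Q + 1
  -- they have a common point.
  module Layer (d : ℕ) (1≤d : 1 ℕ.≤ d) (powerK : ∀ k → k K.^ d ≡ k) where

    t : E.Carrier → E.Carrier → K.Carrier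
    t a x = tr (x E.^ d E.- a E.* x)

    -- Homogeneity, from k^d = k on K, survives although t need not be additive in x; the zeros of
    -- `t a` thus form a union of K-lines through 0.
    t-scale : ∀ a k x → t a (ι k E.* x) ≡ k K.* t a x
    t-scale a k x = trans (cong tr (trans
        (cong (E._- a E.* (ι k E.* x)) (trans (E.^-distrib-* (ι k) x d) (cong (E._* x E.^ d) (trans (sym (ι-^ k d)) (cong ι (powerK k))))))
        (solve 4 (λ k y a x → k :* y :- a :* (k :* x) := k :* (y :- a :* x)) refl (ι k) (x E.^ d) a x)))
      (tr-scale k _)
      where open E.Solver

    Z? : ∀ a x → Dec (t a x ≡ K.0#)
    Z? a x = t a x K.≟F K.0#

    Z : E.Carrier → ℕ
    Z a = N.count E.finite (Z? a)

    private
      fromQ : R.∣R∣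
      fromQ = R.fromℕ· Q

      ∑E : (E.Carrier → R.∣R∣) → R.∣R∣
      ∑E = RS.∑ E.finite

      ∑K : (K.Carrier → R.∣R∣) → R.∣R∣
      ∑K = RS.∑ K.finite

      module FH = FiniteSumHomomorphism (CyclotomicRing.ring 𝒪)

      tr-0 : tr E.0# ≡ K.0#
      tr-0 = trans (cong tr (sym (E.-‿inverseʳ E.0#))) (trans (tr-+ _ _) (trans (cong (λ z → tr E.0# K.+ z) (tr-neg E.0#)) (K.-‿inverseʳ _)))

      t-0 : ∀ a → t a E.0# ≡ K.0#
      t-0 a = trans (cong tr (trans (cong₂ E._-_ (E.0^ d {{ℕ.>-nonZero 1≤d}}) (E.zeroʳ a)) (E.-‿inverseʳ E.0#))) tr-0

    W : E.Carrier → R.∣R∣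
    W = CE.W d

    -- The sum of ψ(k t(a, x)) over all k and x, evaluated twice. By points, orthogonality gives Q
    -- Z(a). By scalars, homogeneity gives W(a) for each k ≠ 0, and k = 0 gives Q^2.
    W≈ : ∀ a → W a R.≈ fromQ R.* (W a R.+ fromQ R.- R.fromℕ· (Z a))
    W≈ a = R.x-y≈0⇒x≈y (R.trans
        (solve 3 (λ w q z → w :- q :* (w :+ q :- z) := z :* q :- (q :* w :+ (q :* q :- w))) R.refl (W a) fromQ (R.fromℕ· (Z a)))
        (R.x≈y⇒x-y≈0 (R.trans (R.sym by-points) by-scalars)))
      where
      open R.Solver
      open R.≈R
      S : K.Carrier → R.∣R∣
      S k = ∑E (λ x → CK.ψ (t a x K.* k))

      by-points : ∑K S R.≈ R.fromℕ· (Z a) R.* fromQ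
      by-points = begin
        ∑K S
          ≈⟨ RS.∑-swap K.finite E.finite _ ⟩
        ∑E (λ x → ∑K (λ k → CK.ψ (t a x K.* k)))
          ≈⟨ RS.∑-cong E.finite (λ x → R.trans (CK.∑-orthogonality (t a x))
               (R.*-cong (R.sym (FH.fromℕ·-𝟙 (Z? a x))) (R.reflexive (cong R.fromℕ· sizeK)))) ⟩
        ∑E (λ x → R.fromℕ· (N.𝟙 (Z? a x)) R.* fromQ)
          ≈⟨ R.trans (R.sym (RS.∑-*ʳ E.finite fromQ _)) (R.*-congʳ (R.sym (FH.fromℕ·-∑ E.finite (λ x → N.𝟙 (Z? a x))))) ⟩
        R.fromℕ· (Z a) R.* fromQ ∎

      q≈Q*Q : R.fromℕ· E.size R.≈ fromQ R.* fromQ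
      q≈Q*Q = R.trans (R.reflexive (cong R.fromℕ· sizeE)) (R.×1-homo-* Q Q)

      S≈ : ∀ k → S k R.≈ W a R.+ RS.𝟙 (K.0# K.≟F k) R.* (fromQ R.* fromQ R.- W a)
      S≈ k with K.0# K.≟F k
      ... | yes refl = begin
        S K.0#
          ≈⟨ RS.∑-cong E.finite (λ x → R.trans (R.reflexive (cong CK.ψ (K.zeroʳ (t a x)))) CK.ψ-0) ⟩
        ∑E (λ _ → R.1#)
          ≈⟨ R.trans (RS.∑-const E.finite R.1#) q≈Q*Q ⟩
        fromQ R.* fromQ
          ≈⟨ solve 2 (λ w q → q := w :+ con (+ 1) :* (q :- w)) R.refl (W a) (fromQ R.* fromQ) ⟩
        W a R.+ R.1# R.* (fromQ R.* fromQ R.- W a) ∎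
      ... | no ne = begin
        S k
          ≈⟨ RS.∑-cong E.finite (λ x → R.trans (R.reflexive (cong CK.ψ (trans (K.*-comm (t a x) k) (sym (t-scale a k x))))) (R.sym (ψ-transitive _))) ⟩
        ∑E (λ x → CE.ψ ((ι k E.* x) E.^ d E.- a E.* (ι k E.* x)))
          ≈⟨ R.sym (CE.scale-bijection (λ eq → ne (sym (ι-≡0 eq))) (λ x → CE.ψ (x E.^ d E.- a E.* x))) ⟩
        W a
          ≈⟨ solve 2 (λ w q → w := w :+ con (+ 0) :* (q :- w)) R.refl (W a) (fromQ R.* fromQ) ⟩
        W a R.+ R.0# R.* (fromQ R.* fromQ R.- W a) ∎

      by-scalars : ∑K S R.≈ fromQ R.* W a R.+ (fromQ R.* fromQ R.- W a)
      by-scalars = begin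
        ∑K S
          ≈⟨ R.trans (RS.∑-cong K.finite S≈) (RS.∑-+ K.finite _ _) ⟩
        ∑K (λ _ → W a) R.+ ∑K (λ k → RS.𝟙 (K.0# K.≟F k) R.* (fromQ R.* fromQ R.- W a))
          ≈⟨ R.+-cong (R.trans (RS.∑-const K.finite (W a)) (R.trans (R.·≈* K.size (W a)) (R.*-congʳ (R.reflexive (cong R.fromℕ· sizeK)))))
               (RS.∑-select K.finite K.0# (λ _ → fromQ R.* fromQ R.- W a)) ⟩
        fromQ R.* W a R.+ (fromQ R.* fromQ R.- W a) ∎

    divisible : ∀ a → Divides (p-1 ℕ.* m) (W a)
    divisible a = Divides-resp (R.sym (W≈ a)) (Divides-* _ (Divides-Q m))

    module _ (all : ∀ a → Divides (suc (p-1 ℕ.* m)) (W a)) where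

      private
        M = p-1 ℕ.* m

        1≤M : 1 ℕ.≤ M
        1≤M = ℕₚ.*-mono-≤ {1} {p-1} {1} {m} 1≤p-1 1≤m

        -- Cancelling Q from W = Q (W + Q - Z) leaves one `π` dividing W + Q - Z; it divides W and Q
        -- too, hence Z.
        p∣Z : ∀ a → p ∣ Z a
        p∣Z a = π∣fromℤ (+ Z a) (Divides-resp
            (solve 3 (λ w q z → (w :+ q) :+ :- (w :+ q :- z) := z) R.refl (W a) fromQ (R.fromℕ· (Z a)))
            (Divides-+ (Divides-+ (Divides-≤ (s≤s z≤n) (all a)) (Divides-≤ 1≤M (Divides-Q m))) (Divides-neg cancelled)))
          where
          open R.Solver
          e : R.∣R∣
          e = proj₁ (Q*≈π^ m)
          x : R.∣R∣
          x = W a R.+ fromQ R.- R.fromℕ· (Z a)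
          W*e≈ : W a R.* e R.≈ CyclotomicRing.π 𝒪 R.^ M R.* x
          W*e≈ = R.trans (R.*-congʳ (W≈ a)) (R.trans (solve 3 (λ q x e → q :* x :* e := q :* e :* x) R.refl fromQ x e)
            (R.*-congʳ (proj₂ (Q*≈π^ m))))
          cancelled : Divides 1 x
          cancelled = Divides-cancel M 1 (subst (λ k → Divides k (CyclotomicRing.π 𝒪 R.^ M R.* x)) (ℕₚ.+-comm 1 M)
            (Divides-resp W*e≈ (Divides-* e (all a))))

        1≤Z : ∀ a → 1 ℕ.≤ Z a
        1≤Z a = N.count-injection E.finite (Z? a) (finiteFin 1) (λ _ → E.0#) (λ { Fin.zero Fin.zero _ → refl }) (λ _ → t-0 a)

        -- The zero x = 0 alone would make `Z a` equal to 1, which p does not divide.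
        covered : ∀ a → Σ E.Carrier λ x → t a x ≡ K.0# × x ≢ E.0#
        covered a with Finite.search E.finite (λ x → Z? a x ×-dec ¬? (x E.≟F E.0#))
        ... | yes found = found
        ... | no none = ⊥-elim (ℕₚ.<⇒≱ (prime⇒1< pr)
                (ℕₚ.≤-trans (∣⇒≤ {{ℕ.>-nonZero (1≤Z a)}} (p∣Z a))
                  (N.count-≤1 E.finite (Z? a) (λ x y tx ty → trans (only x tx) (sym (only y ty))))))
          where
          only : ∀ x → t a x ≡ K.0# → x ≡ E.0#
          only x tx with x E.≟F E.0#
          ... | yes x≡0 = x≡0
          ... | no x≢0  = ⊥-elim (none (x , tx , x≢0))

        Q≤Z : ∀ a → Q ℕ.≤ Z a
        Q≤Z a with covered a
        ... | x , tx≡0 , x≢0 = subst (ℕ._≤ Z a) sizeK (N.count-injection E.finite (Z? a) K.finite (λ k → ι k E.* x)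
                (λ k l eq → ι-injective (E.*-cancelʳ x≢0 eq))
                (λ k → trans (t-scale a k x) (trans (cong (k K.*_) tx≡0) (K.zeroʳ k))))

        kernel : Σ E.Carrier λ ε → tr ε ≡ K.0# × ε ≢ E.0#
        kernel with Finite.search E.finite (λ x → (tr x K.≟F K.0#) ×-dec ¬? (x E.≟F E.0#))
        ... | yes found = found
        ... | no none = ⊥-elim (ℕₚ.<⇒≱ 1<Q (subst (ℕ._≤ 1) (tr-fibre K.0#)
                (N.count-≤1 E.finite (λ x → tr x K.≟F K.0#) (λ x y tx ty → trans (only x tx) (sym (only y ty))))))
          where
          only : ∀ x → tr x ≡ K.0# → x ≡ E.0#
          only x tx with x E.≟F E.0#
          ... | yes x≡0 = x≡0
          ... | no x≢0  = ⊥-elim (none (x , tx , x≢0))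

        -- Elements of trace 0 change sign under the Frobenius of E over K, so the quotient of two
        -- of them is fixed and lies in K.
        kernel-line : ∀ {ε} → tr ε ≡ K.0# → ε ≢ E.0# → ∀ y → tr y ≡ K.0# → Σ K.Carrier λ k → ι k E.* ε ≡ y
        kernel-line {ε} trε ε≢0 y try = proj₁ k , trans (cong (E._* ε) (proj₂ k)) zε≡y
          where
          open ≡.≡-Reasoning
          z : E.Carrier
          z = y E.* ε E.⁻¹⟨ ε≢0 ⟩
          zε≡y : z E.* ε ≡ y
          zε≡y = E.[y*x⁻¹]*x ε≢0 y
          conjugate : ∀ y → tr y ≡ K.0# → y E.^ Q ≡ E.- y
          conjugate y try = E.+-inverseˡ-unique _ _ (trans (E.+-comm _ _) (trans (sym (ι-tr y)) (trans (cong ι try) ι-0)))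
          z-fixed : z E.^ Q ≡ z
          z-fixed = E.*-cancelʳ (E.^-nonzero Q ε≢0) (begin
            z E.^ Q E.* ε E.^ Q     ≡⟨ E.^-distrib-* z ε Q ⟨
            (z E.* ε) E.^ Q         ≡⟨ cong (E._^ Q) zε≡y ⟩
            y E.^ Q                 ≡⟨ conjugate y try ⟩
            E.- y                   ≡⟨ cong E.-_ zε≡y ⟨
            E.- (z E.* ε)           ≡⟨ E.-‿distribʳ-* z ε ⟩
            z E.* (E.- ε)           ≡⟨ cong (z E.*_) (conjugate ε trε) ⟨
            z E.* ε E.^ Q           ∎)
          k : Σ K.Carrier λ k → ι k ≡ z
          k = fixed z z-fixed

        fibre-size : ∀ (φ φ⁻¹ : E.Carrier → E.Carrier) → (∀ y → φ (φ⁻¹ y) ≡ y) → (∀ x → φ⁻¹ (φ x) ≡ x) →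
                     N.count E.finite (λ x → tr (φ x) K.≟F K.0#) ≡ Q
        fibre-size φ φ⁻¹ inv₁ inv₂ = trans
          (sym (N.∑-bijection E.finite E.finite φ φ⁻¹ inv₁ inv₂ (λ x → N.𝟙 (tr x K.≟F K.0#)))) (tr-fibre K.0#)

      -- The line through a₀ parallel to the one of direction x₀ misses the latter, so
      -- the other Q lines meet it in Q distinct points.
      not-concurrent : ∀ a₀ x₀ → t a₀ x₀ ≢ K.0# → Z a₀ ≡ Q
      not-concurrent a₀ x₀ tx₀≢0 = sym (trans (N.∑-squeeze K.finite (λ k → Q≤Z (a₀ E.+ δ E.* ι k)) (ℕₚ.≤-reflexive total) K.0#)
          (cong Z (trans (cong (λ z → a₀ E.+ δ E.* z) ι-0) (trans (cong (λ z → a₀ E.+ z) (E.zeroʳ δ)) (E.+-identityʳ a₀)))))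
        where
        open ≡.≡-Reasoning
        x₀≢0 : x₀ ≢ E.0#
        x₀≢0 refl = tx₀≢0 (t-0 a₀)
        ε = proj₁ kernel
        trε≡0 = proj₁ (proj₂ kernel)
        ε≢0 = proj₂ (proj₂ kernel)
        -- As tr (δ k x₀) = k tr ε = 0, the points a₀ + δ k have the same tr (a x₀) as a₀: they are
        -- the parallel through a₀.
        δ : E.Carrier
        δ = ε E.* x₀ E.⁻¹⟨ x₀≢0 ⟩
        δ≢0 : δ ≢ E.0#
        δ≢0 = E.*-nonzero ε≢0 (E.⁻¹-nonzero x₀≢0)
        δx₀≡ε : δ E.* x₀ ≡ ε
        δx₀≡ε = E.[y*x⁻¹]*x x₀≢0 ε

        w : E.Carrier → K.Carrier
        w x = tr (δ E.* x)

        t-line : ∀ k x → t (a₀ E.+ δ E.* ι k) x ≡ t a₀ x K.- k K.* w x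
        t-line k x = begin
          tr (x E.^ d E.- (a₀ E.+ δ E.* ι k) E.* x)
            ≡⟨ cong tr (solve 5 (λ y a δ k x → y :- (a :+ δ :* k) :* x := (y :- a :* x) :+ :- (k :* (δ :* x))) refl (x E.^ d) a₀ δ (ι k) x) ⟩
          tr ((x E.^ d E.- a₀ E.* x) E.+ E.- (ι k E.* (δ E.* x)))
            ≡⟨ trans (tr-+ _ _) (cong (λ z → t a₀ x K.+ z) (trans (tr-neg _) (cong K.-_ (tr-scale k _)))) ⟩
          t a₀ x K.- k K.* w x ∎
          where open E.Solver

        L : E.Carrier → ℕ
        L x = N.∑ K.finite (λ k → N.𝟙 (Z? (a₀ E.+ δ E.* ι k) x))

        -- The line of x meets the parallel in one point if w x ≠ 0. If w x = 0 and x ≠ 0, then x is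
        -- a multiple of x₀ and the two are disjoint. The vector x = 0 counts all Q points.
        L+𝟙 : ∀ x → L x ℕ.+ N.𝟙 (w x K.≟F K.0#) ≡ 1 ℕ.+ N.𝟙 (E.0# E.≟F x) ℕ.* Q
        L+𝟙 x with w x K.≟F K.0# | E.0# E.≟F x
        ... | no w≢0 | yes refl = ⊥-elim (w≢0 (trans (cong tr (E.zeroʳ δ)) tr-0))
        ... | no w≢0 | no _ = trans (ℕₚ.+-identityʳ _) (N.count-one K.finite (λ k → Z? (a₀ E.+ δ E.* ι k) x) k₀
                (trans (t-line k₀ x) (K.x≈y⇒x-y≈0 (sym k₀w)))
                (λ k tk → K.*-cancelʳ w≢0 (trans (sym (K.x-y≈0⇒x≈y (trans (sym (t-line k x)) tk))) (sym k₀w))))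
          where
          k₀ = t a₀ x K.* w x K.⁻¹⟨ w≢0 ⟩
          k₀w : k₀ K.* w x ≡ t a₀ x
          k₀w = K.[y*x⁻¹]*x w≢0 (t a₀ x)
        ... | yes w≡0 | yes refl = trans (cong (ℕ._+ 1) (trans (N.∑-cong K.finite (λ k → N.𝟙-true (Z? (a₀ E.+ δ E.* ι k) E.0#) (t-0 _)))
                (trans (N.∑-constant K.finite 1) (trans (ℕₚ.*-identityʳ K.size) sizeK)))) (trans (ℕₚ.+-comm Q 1) (cong suc (sym (ℕₚ.*-identityˡ Q))))
        ... | yes w≡0 | no x≢0 = cong (ℕ._+ 1) (N.∑-zero K.finite (λ k → N.𝟙-false (Z? (a₀ E.+ δ E.* ι k) x) λ tk →
                t≢0 (trans (sym (trans (cong (λ z → t a₀ x K.- k K.* z) w≡0) (solveᴷ 2 (λ t k → t :-ᴷ k :*ᴷ conᴷ (+ 0) :=ᴷ t) refl (t a₀ x) k)))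
                  (trans (sym (t-line k x)) tk))))
          where
          multiple : Σ K.Carrier λ l → ι l E.* ε ≡ δ E.* x
          multiple = kernel-line trε≡0 ε≢0 (δ E.* x) w≡0
          l = proj₁ multiple
          x≡lx₀ : x ≡ ι l E.* x₀
          x≡lx₀ = E.*-cancelˡ δ≢0 (trans (sym (proj₂ multiple)) (trans (cong (ι l E.*_) (sym δx₀≡ε))
              (solve 3 (λ δ l x → l :* (δ :* x) := δ :* (l :* x)) refl δ (ι l) x₀)))
            where open E.Solver
          l≢0 : l ≢ K.0#
          l≢0 l≡0 = x≢0 (sym (trans x≡lx₀ (trans (cong (λ k → ι k E.* x₀) l≡0) (trans (cong (E._* x₀) ι-0) (E.zeroˡ x₀)))))
          t≢0 : t a₀ x ≢ K.0#
          t≢0 eq = K.*-nonzero l≢0 tx₀≢0 (trans (sym (t-scale a₀ l x₀)) (trans (cong (t a₀) (sym x≡lx₀)) eq))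

        ∑L : N.∑ E.finite L ≡ E.size
        ∑L = ℕₚ.+-cancelʳ-≡ Q _ _ (begin
          N.∑ E.finite L ℕ.+ Q
            ≡⟨ cong (N.∑ E.finite L ℕ.+_) (fibre-size (δ E.*_) (δ E.⁻¹⟨ δ≢0 ⟩ E.*_) (E.x*[x⁻¹*y] δ≢0) (E.x⁻¹*[x*y] δ≢0)) ⟨
          N.∑ E.finite L ℕ.+ N.count E.finite (λ x → w x K.≟F K.0#)
            ≡⟨ N.∑-+ E.finite _ _ ⟨
          N.∑ E.finite (λ x → L x ℕ.+ N.𝟙 (w x K.≟F K.0#))
            ≡⟨ trans (N.∑-cong E.finite L+𝟙) (N.∑-+ E.finite _ _) ⟩
          N.∑ E.finite (λ _ → 1) ℕ.+ N.∑ E.finite (λ x → N.𝟙 (E.0# E.≟F x) ℕ.* Q)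
            ≡⟨ cong₂ ℕ._+_ (trans (N.∑-constant E.finite 1) (ℕₚ.*-identityʳ E.size)) (N.∑-select E.finite E.0# (λ _ → Q)) ⟩
          E.size ℕ.+ Q ∎)

        total : N.∑ K.finite (λ k → Z (a₀ E.+ δ E.* ι k)) ≡ N.∑ K.finite (λ _ → Q)
        total = begin
          N.∑ K.finite (λ k → Z (a₀ E.+ δ E.* ι k))   ≡⟨ N.∑-swap K.finite E.finite _ ⟩
          N.∑ E.finite L                              ≡⟨ ∑L ⟩
          E.size                                      ≡⟨ trans sizeE (cong (ℕ._* Q) (sym sizeK)) ⟩
          K.size ℕ.* Q                                ≡⟨ N.∑-constant K.finite Q ⟨
          N.∑ K.finite (λ _ → Q)                      ∎

      -- Otherwise Z(a) = Q for all a, so there are Q q pairs (a, x) with t(a, x) = 0. But each x ≠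
      -- 0 occurs in Q of them, by the fibres of the trace, and x = 0 in q > Q: too many.
      concurrent : Σ E.Carrier λ a → ∀ x → t a x ≡ K.0#
      concurrent with Finite.search-all E.finite (λ a → Finite.search E.finite (λ x → ¬? (Z? a x)))
      ... | inj₂ (a , none) = a , λ x → decide x
        where
        decide : ∀ x → t a x ≡ K.0#
        decide x with Z? a x
        ... | yes eq = eq
        ... | no ne  = ⊥-elim (none (x , ne))
      ... | inj₁ escape = ⊥-elim (ℕₚ.<⇒≢ Q<q (trans (N.∑-squeeze E.finite Q≤lines (ℕₚ.≤-reflexive total) E.0#) lines-0))
        where
        open ≡.≡-Reasoning
        lines : E.Carrier → ℕ
        lines x = N.∑ E.finite (λ a → N.𝟙 (Z? a x))
        lines-0 : lines E.0# ≡ E.size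
        lines-0 = trans (N.∑-cong E.finite (λ a → N.𝟙-true (Z? a E.0#) (t-0 a))) (trans (N.∑-constant E.finite 1) (ℕₚ.*-identityʳ E.size))
        Q<q : Q ℕ.< E.size
        Q<q = subst (Q ℕ.<_) (sym sizeE) (ℕₚ.m<m*n Q Q {{ℕ.>-nonZero (ℕₚ.<-trans (s≤s z≤n) 1<Q)}} 1<Q)
        Q≤lines : ∀ x → Q ℕ.≤ lines x
        Q≤lines x with x E.≟F E.0#
        ... | yes refl = ℕₚ.≤-trans (ℕₚ.<⇒≤ Q<q) (ℕₚ.≤-reflexive (sym lines-0))
        ... | no x≢0 = ℕₚ.≤-reflexive (sym (fibre-size (λ a → x E.^ d E.- a E.* x) (λ y → (x E.^ d E.- y) E.* x E.⁻¹⟨ x≢0 ⟩)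
                (λ y → trans (cong (λ z → x E.^ d E.- z) (E.[y*x⁻¹]*x x≢0 _))
                  (solve 2 (λ u y → u :- (u :- y) := y) refl (x E.^ d) y))
                (λ a → trans (cong (E._* x E.⁻¹⟨ x≢0 ⟩) (solve 2 (λ u v → u :- (u :- v) := v) refl (x E.^ d) (a E.* x)))
                  (E.[y*x]*x⁻¹ x≢0 a))))
          where open E.Solver
        total : N.∑ E.finite lines ≡ N.∑ E.finite (λ _ → Q)
        total = trans (N.∑-swap E.finite E.finite (λ x a → N.𝟙 (Z? a x)))
          (N.∑-cong E.finite (λ a → not-concurrent a (proj₁ (escape a)) (proj₂ (escape a))))

  -- A common point makes the exponent degenerate.

  module Nonlinear (d : ℕ) (1≤d : 1 ℕ.≤ d) (surjective : ∀ y → Σ E.Carrier λ x → x E.^ d ≡ y) where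
    open PowerCongruence E
    open E using (_⊕_; _⊛_; X^; δ; Polynomial; coefficient; function)

    M : ℕ
    M = E.size ℕ.∸ 1

    private
      Q<size : Q ℕ.< E.size
      Q<size = subst (Q ℕ.<_) (sym sizeE) (ℕₚ.m<m*n Q Q {{ℕ.>-nonZero (ℕₚ.<-trans (s≤s z≤n) 1<Q)}} 1<Q)

      1<size : 1 ℕ.< E.size
      1<size = ℕₚ.<-trans 1<Q Q<size

      1≤M : 1 ℕ.≤ M
      1≤M = ℕₚ.m<n⇒0<n∸m 1<size

      ≤M⇒<size : ∀ {r} → r ℕ.≤ M → r ℕ.< E.size
      ≤M⇒<size r≤M = ℕₚ.≤-trans (s≤s r≤M) (ℕₚ.≤-reflexive (ℕₚ.m+[n∸m]≡n (ℕₚ.<⇒≤ 1<size)))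

      1≤Q : 1 ℕ.≤ Q
      1≤Q = ℕₚ.<⇒≤ 1<Q

      not-fixed : ¬ (∀ y → y E.^ Q ≡ y)
      not-fixed fix = ℕₚ.<⇒≱ Q<size (ℕₚ.≤-trans
        (N.count-injection E.finite (λ y → (y E.^ Q E.+ (E.- E.1#) E.* y) E.≟F E.0#) E.finite id (λ _ _ eq → eq)
          (λ y → trans (cong (E._+ (E.- E.1#) E.* y) (fix y)) (solve 1 (λ y → y :+ (:- con (+ 1)) :* y := con (+ 0)) refl y)))
        (E.frobenius-fibre-≤ Q 1<Q (E.- E.1#) E.0#))
        where open E.Solver

    -- With r ≡ d and r′ ≡ d Q, the polynomial X^r + X^r′ - a X - a^Q X^Q has degree below q and
    -- vanishes on E. Yet its coefficient at r is 1: r is neither 1 nor Q, and r = r′ would give y^Q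
    -- = y for all d-th powers y, that is, on all of E.
    nonlinear : ¬ Congruent M d 1 → ¬ Congruent M d Q → ∀ a → ¬ (∀ x → tr (x E.^ d E.- a E.* x) ≡ K.0#)
    nonlinear d≢1 d≢Q a linear
      with representative M {{ℕ.>-nonZero 1≤M}} d 1≤d | representative M {{ℕ.>-nonZero 1≤M}} (d ℕ.* Q) (ℕₚ.*-mono-≤ 1≤d 1≤Q)
    ... | r , 1≤r , r≤M , d≡r | r′ , 1≤r′ , r′≤M , dQ≡r′ =
      E.1≢0 (trans (sym leading) (E.polynomial-identity P P≡0 (≤M⇒<size r≤M)))
      where
      open ≡.≡-Reasoning
      x^d≡x^r : ∀ x → x E.^ d ≡ x E.^ r
      x^d≡x^r = ^-congruent 1≤d 1≤r d≡r
      x^dQ≡x^r′ : ∀ x → (x E.^ d) E.^ Q ≡ x E.^ r′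
      x^dQ≡x^r′ x = trans (E.^-assocʳ x d Q) (^-congruent (ℕₚ.*-mono-≤ 1≤d 1≤Q) 1≤r′ dQ≡r′ x)
      r≢1 : 1 ≢ r
      r≢1 refl = d≢1 d≡r
      r≢Q : Q ≢ r
      r≢Q refl = d≢Q d≡r
      r′≢r : r′ ≢ r
      r′≢r refl = not-fixed λ y → let x , x^d≡y = surjective y in
        subst (λ y → y E.^ Q ≡ y) x^d≡y (trans (x^dQ≡x^r′ x) (sym (x^d≡x^r x)))
      P : Polynomial E.size
      P = X^ r (≤M⇒<size r≤M) ⊕ X^ r′ (≤M⇒<size r′≤M) ⊕ (E.- a) ⊛ X^ 1 1<size ⊕ (E.- (a E.^ Q)) ⊛ X^ Q Q<size
      P≡0 : ∀ x → function P x ≡ E.0#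
      P≡0 x = begin
        x E.^ r E.+ x E.^ r′ E.+ (E.- a) E.* x E.^ 1 E.+ (E.- (a E.^ Q)) E.* x E.^ Q
          ≡⟨ cong₂ (λ y z → y E.+ z E.+ (E.- a) E.* x E.^ 1 E.+ (E.- (a E.^ Q)) E.* x E.^ Q) (x^d≡x^r x) (x^dQ≡x^r′ x) ⟨
        y E.+ y E.^ Q E.+ (E.- a) E.* (x E.* E.1#) E.+ (E.- (a E.^ Q)) E.* x E.^ Q
          ≡⟨ solve 6 (λ y y′ a x a′ x′ → y :+ y′ :+ (:- a) :* (x :* con (+ 1)) :+ (:- a′) :* x′ := (y :- a :* x) :+ (y′ :+ :- (a′ :* x′))) refl
               y (y E.^ Q) a x (a E.^ Q) (x E.^ Q) ⟩
        (y E.- a E.* x) E.+ (y E.^ Q E.+ E.- (a E.^ Q E.* x E.^ Q))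
          ≡⟨ cong (λ z → (y E.- a E.* x) E.+ (y E.^ Q E.+ z)) (trans (cong E.-_ (sym (E.^-distrib-* a x Q))) (sym (PE.frobenius-neg m (a E.* x)))) ⟩
        (y E.- a E.* x) E.+ (y E.^ Q E.+ (E.- (a E.* x)) E.^ Q)
          ≡⟨ cong (λ z → (y E.- a E.* x) E.+ z) (PE.frobenius m y (E.- (a E.* x))) ⟨
        (y E.- a E.* x) E.+ (y E.- a E.* x) E.^ Q
          ≡⟨ ι-tr _ ⟨
        ι (tr (y E.- a E.* x))
          ≡⟨ trans (cong ι (linear x)) ι-0 ⟩
        E.0# ∎
        where
        open E.Solver
        y = x E.^ d
      leading : coefficient P r ≡ E.1#
      leading = begin
        δ r r E.+ δ r′ r E.+ (E.- a) E.* δ 1 r E.+ (E.- (a E.^ Q)) E.* δ Q r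
          ≡⟨ cong₂ (λ y z → y E.+ z E.+ (E.- a) E.* δ 1 r E.+ (E.- (a E.^ Q)) E.* δ Q r)
               (E.𝟙-true (r ℕ.≟ r) refl) (E.𝟙-false (r′ ℕ.≟ r) r′≢r) ⟩
        E.1# E.+ E.0# E.+ (E.- a) E.* δ 1 r E.+ (E.- (a E.^ Q)) E.* δ Q r
          ≡⟨ cong₂ (λ y z → E.1# E.+ E.0# E.+ (E.- a) E.* y E.+ (E.- (a E.^ Q)) E.* z) (E.𝟙-false (1 ℕ.≟ r) r≢1) (E.𝟙-false (Q ℕ.≟ r) r≢Q) ⟩
        E.1# E.+ E.0# E.+ (E.- a) E.* E.0# E.+ (E.- (a E.^ Q)) E.* E.0#
          ≡⟨ solve 2 (λ a b → con (+ 1) :+ con (+ 0) :+ (:- a) :* con (+ 0) :+ (:- b) :* con (+ 0) := con (+ 1)) refl a (a E.^ Q) ⟩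
        E.1# ∎
        where open E.Solver

  -- An exponent d with d ≡ p^j modulo Q - 1 is replaced by d p^k with k + j = 2 m j,
  -- which is 1 modulo Q - 1 and has the same Weil sums.
  module DegenerateLayer (d e : ℕ) (1≤d : 1 ℕ.≤ d) (inverseE : ∀ x → (x E.^ d) E.^ e ≡ x)
                         (degenerate : DegenerateOver d p m) where

    private
      n : ℕ
      n = m ℕ.+ m

      j : ℕ
      j = proj₁ (CongPowMod⇒Congruent {d} {p} degenerate)

      d≡p^j : Congruent (Q ℕ.∸ 1) d (p ℕ.^ j)
      d≡p^j = proj₂ (CongPowMod⇒Congruent {d} {p} degenerate)

      k : ℕ
      k = (n ℕ.∸ 1) ℕ.* j

      j+k : j ℕ.+ k ≡ n ℕ.* j
      j+k = cong (ℕ._* j) (ℕₚ.m+[n∸m]≡n 1≤m+m)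

      1≤p^ : ∀ i → 1 ℕ.≤ p ℕ.^ i
      1≤p^ i = ℕₚ.m^n>0 p {{prime⇒nonZero pr}} i

      x^p^nj : ∀ j x → x E.^ (p ℕ.^ (n ℕ.* j)) ≡ x
      x^p^nj zero    x = trans (cong (λ i → x E.^ (p ℕ.^ i)) (ℕₚ.*-zeroʳ n)) (E.*-identityʳ x)
      x^p^nj (suc j) x = trans (cong (x E.^_) (trans (cong (p ℕ.^_) (ℕₚ.*-suc n j)) (ℕₚ.^-distribˡ-+-* p n (n ℕ.* j))))
        (trans (sym (E.^-assocʳ x (p ℕ.^ n) (p ℕ.^ (n ℕ.* j)))) (trans (cong (E._^ (p ℕ.^ (n ℕ.* j))) (CE.x^q≡x x)) (x^p^nj j x)))

      x^p^j^p^k : ∀ x → (x E.^ (p ℕ.^ j)) E.^ (p ℕ.^ k) ≡ x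
      x^p^j^p^k x = trans (E.^-assocʳ x (p ℕ.^ j) (p ℕ.^ k)) (trans (cong (x E.^_) (trans (sym (ℕₚ.^-distribˡ-+-* p j k)) (cong (p ℕ.^_) j+k))) (x^p^nj j x))

      d′ : ℕ
      d′ = d ℕ.* p ℕ.^ k

      1≤d′ : 1 ℕ.≤ d′
      1≤d′ = ℕₚ.*-mono-≤ 1≤d (1≤p^ k)

      powerK : ∀ x → x K.^ d′ ≡ x
      powerK x = trans (sym (K.^-assocʳ x d (p ℕ.^ k))) (trans
        (cong (K._^ (p ℕ.^ k)) (PowerCongruence.^-congruent K 1≤d (1≤p^ j) (subst (λ s → Congruent (s ℕ.∸ 1) d (p ℕ.^ j)) (sym sizeK) d≡p^j) x))
        (ι-injective (trans (ι-^ _ (p ℕ.^ k)) (trans (cong (E._^ (p ℕ.^ k)) (ι-^ x (p ℕ.^ j))) (x^p^j^p^k (ι x))))))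

      surjective : ∀ y → Σ E.Carrier λ x → x E.^ d′ ≡ y
      surjective y = z E.^ e , (begin
        (z E.^ e) E.^ d′                     ≡⟨ E.^-assocʳ (z E.^ e) d (p ℕ.^ k) ⟨
        ((z E.^ e) E.^ d) E.^ (p ℕ.^ k)      ≡⟨ cong (E._^ (p ℕ.^ k)) (trans (E.^-assocʳ z e d) (trans (cong (z E.^_) (ℕₚ.*-comm e d))
                                                 (trans (sym (E.^-assocʳ z d e)) (inverseE z)))) ⟩
        z E.^ (p ℕ.^ k)                      ≡⟨ x^p^j^p^k y ⟩
        y                                    ∎)
        where
        open ≡.≡-Reasoning
        z = y E.^ (p ℕ.^ j)

      -- The extra power p^k acts on x^d alone, and ψ is invariant under Frobenius.
      W′≈W : ∀ a → CE.W d′ a R.≈ CE.W d a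
      W′≈W a = RS.∑-cong E.finite (λ x → R.trans (CE.ψ-+ _ _) (R.trans (R.*-congʳ
        (R.trans (R.reflexive (cong CE.ψ (sym (E.^-assocʳ x d (p ℕ.^ k))))) (CE.ψ-frobenius k (x E.^ d)))) (R.sym (CE.ψ-+ _ _))))

      module Untwisted = Layer d′ 1≤d′ powerK

      M : ℕ
      M = p ℕ.^ n ℕ.∸ 1

      p^nj≡1 : ∀ j → Congruent M (p ℕ.^ (n ℕ.* j)) 1
      p^nj≡1 zero    = subst (λ i → Congruent M (p ℕ.^ i) 1) (sym (ℕₚ.*-zeroʳ n)) Congruent-refl
      p^nj≡1 (suc j) = subst (λ i → Congruent M i 1) (sym (trans (cong (p ℕ.^_) (ℕₚ.*-suc n j)) (ℕₚ.^-distribˡ-+-* p n (n ℕ.* j))))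
        (Congruent-trans (Congruent-* (p ℕ.^ (n ℕ.* j)) p^n≡1) (subst (λ i → Congruent M i 1) (sym (ℕₚ.*-identityˡ _)) (p^nj≡1 j)))
        where
        p^n≡1 : Congruent M (p ℕ.^ n) 1
        p^n≡1 = congruent {u = 0} {1} (trans (ℕₚ.+-identityʳ _) (trans (sym (ℕₚ.m+[n∸m]≡n (1≤p^ n))) (cong (1 ℕ.+_) (sym (ℕₚ.*-identityˡ M)))))

      -- Multiplication by p^j undoes the twist: d′ p^j = d p^(n j), and p^n ≡ 1 modulo q - 1.
      d′≡p^i⇒degenerate : ∀ i → Congruent M d′ (p ℕ.^ i) → DegenerateOver d p n
      d′≡p^i⇒degenerate i c = Congruent⇒CongPowMod (i ℕ.+ j) (subst (Congruent M d) (sym (ℕₚ.^-distribˡ-+-* p i j))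
        (Congruent-trans (Congruent-sym d·p^nj≡d) (Congruent-* (p ℕ.^ j) c)))
        where
        d·p^nj≡d : Congruent M (d′ ℕ.* p ℕ.^ j) d
        d·p^nj≡d = subst (λ z → Congruent M z d)
          (trans (ℕₚ.*-comm _ d) (trans (cong (d ℕ.*_) (trans (cong (p ℕ.^_) (trans (sym j+k) (ℕₚ.+-comm j k))) (ℕₚ.^-distribˡ-+-* p k j)))
            (sym (ℕₚ.*-assoc d _ _))))
          (subst (Congruent M (p ℕ.^ (n ℕ.* j) ℕ.* d)) (ℕₚ.*-identityˡ d) (Congruent-* d (p^nj≡1 j)))

    divisible : ∀ a → Divides (p-1 ℕ.* m) (CE.W d a)
    divisible a = Divides-resp (W′≈W a) (Untwisted.divisible a)

    not-more-divisible : ¬ DegenerateOver d p n → ¬ (∀ a → Divides (suc (p-1 ℕ.* m)) (CE.W d a))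
    not-more-divisible ¬degenerate all = Nonlinear.nonlinear d′ 1≤d′ surjective
        -- The residues 1 and Q that `nonlinear` excludes are p^0 and p^m.
        (λ c → ¬degenerate (d′≡p^i⇒degenerate 0 (to-M c)))
        (λ c → ¬degenerate (d′≡p^i⇒degenerate m (to-M c)))
        (proj₁ common) (proj₂ common)
      where
      to-M : ∀ {b} → Congruent (E.size ℕ.∸ 1) d′ b → Congruent M d′ b
      to-M = subst (λ s → Congruent (s ℕ.∸ 1) d′ _) (HasCharDeg.order charE)
      common : Σ E.Carrier λ a → ∀ x → tr (x E.^ d′ E.- a E.* x) ≡ K.0#
      common = Untwisted.concurrent (λ a → Divides-resp (R.sym (W′≈W a)) (all a))

  -- Both bounds for one step of the tower.

  module Bounds (d : ℕ) (1≤d : 1 ℕ.≤ d) (gcd≡1 : gcd d (E.size ℕ.∸ 1) ≡ 1) where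
    private
      1≤M : 1 ℕ.≤ E.size ℕ.∸ 1
      1≤M = ℕₚ.m<n⇒0<n∸m (subst (1 ℕ.<_) (sym sizeE) (ℕₚ.*-mono-< 1<Q 1<Q))

      inverse : Σ ℕ λ e → 1 ℕ.≤ e × Congruent (E.size ℕ.∸ 1) (d ℕ.* e) 1
      inverse = modular-inverse {d = d} 1≤M gcd≡1

      e : ℕ
      e = proj₁ inverse

      inverseE : ∀ x → (x E.^ d) E.^ e ≡ x
      inverseE x = trans (E.^-assocʳ x d e) (trans (PowerCongruence.^-congruent E (ℕₚ.*-mono-≤ 1≤d (proj₁ (proj₂ inverse))) ℕₚ.≤-refl
        (proj₂ (proj₂ inverse)) x) (E.*-identityʳ x))

      inverseK : ∀ x → (x K.^ d) K.^ e ≡ x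
      inverseK x = ι-injective (trans (ι-^ (x K.^ d) e) (trans (cong (E._^ e) (ι-^ x d)) (inverseE (ι x))))

    gcdK≡1 : gcd d (K.size ℕ.∸ 1) ≡ 1
    gcdK≡1 = ∣1⇒≡1 (subst (gcd d (K.size ℕ.∸ 1) ∣_) gcd≡1 (gcd-greatest (gcd[m,n]∣m d _)
        (∣-trans (gcd[m,n]∣n d (K.size ℕ.∸ 1)) (subst (λ q → K.size ℕ.∸ 1 ∣ q ℕ.∸ 1) (sym sizeE)
          (subst (λ s → s ℕ.∸ 1 ∣ Q ℕ.* Q ℕ.∸ 1) (sym sizeK) (factor Q))))))
      where
      factor : ∀ Q → Q ℕ.∸ 1 ∣ Q ℕ.* Q ℕ.∸ 1
      factor zero    = divides 0 refl
      factor (suc Q) = divides (suc (suc Q)) (trans (cong (Q ℕ.+_) (ℕₚ.*-comm Q (suc Q))) refl)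

    module _ (¬degenerate : ¬ DegenerateOver d p (m ℕ.+ m))
             (step : ¬ DegenerateOver d p m → Σ ℕ λ v → p-1 ℕ.* m ≡ v ℕ.+ v ×
                       Σ K.Carrier λ b → ¬ valAtLeast (weil K p m d b) (v ℕ.+ 1)) where

      private
        -- The two cases are joined without deciding degeneracy over K: if all sums were this
        -- divisible, `not-more-divisible` would refute degeneracy, and this refutation is the input
        -- that `step` asks for.
        not-all : ¬ (∀ a → Divides (suc (p-1 ℕ.* m)) (CE.W d a))
        not-all all =
          let v , 2v , b , ¬val = step λ degenerate →
                DegenerateLayer.not-more-divisible d e 1≤d inverseE degenerate ¬degenerate all
          in PermutationExponent.descent d e 1≤d inverseE inverseK v
               (b , λ dv → ¬val (subst (valAtLeast (weil K p m d b)) (ℕₚ.+-comm 1 v) (CK.Divides⇒valAtLeast d b (suc v) dv)))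
               (λ a → subst (λ k → Divides (suc k) (CE.W d a)) 2v (all a))

      upperBound : Σ E.Carrier λ a → ¬ valAtLeast (weil E p (m ℕ.+ m) d a) (p-1 ℕ.* m ℕ.+ 1)
      upperBound with Finite.search-all E.finite (λ a → Divides? (suc (p-1 ℕ.* m)) (CE.W d a))
      ... | inj₁ all      = ⊥-elim (not-all all)
      ... | inj₂ (a , ¬d) = a , λ v → ¬d (CE.valAtLeast⇒Divides d a (suc (p-1 ℕ.* m))
              (subst (valAtLeast (weil E p (m ℕ.+ m) d a)) (ℕₚ.+-comm (p-1 ℕ.* m) 1) v))

    lowerBound : DegenerateOver d p m → ∀ a → valAtLeast (weil E p (m ℕ.+ m) d a) (p-1 ℕ.* m)
    lowerBound degenerate a = CE.Divides⇒valAtLeast d a (p-1 ℕ.* m) (DegenerateLayer.divisible d e 1≤d inverseE degenerate a)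

-- Induction along the tower.

opaque
  cyclotomicRing : ∀ {p} → Prime p → CyclotomicRing p
  cyclotomicRing {zero}  pr = ⊥-elim (ℕ.≢-nonZero⁻¹ 0 {{prime⇒nonZero pr}} ≡.refl)
  cyclotomicRing {suc m} pr = CyclotomicConstruction.cyclotomicRing m

module Tower {p : ℕ} (pr : Prime p) where
  open ≡ using (refl; sym; trans; cong; cong₂; subst)

  private
    double : ∀ s → 2 ℕ.^ suc s ≡ 2 ℕ.^ s ℕ.+ 2 ℕ.^ s
    double s = cong (2 ℕ.^ s ℕ.+_) (ℕₚ.+-identityʳ _)

    1≤2^ : ∀ s → 1 ℕ.≤ 2 ℕ.^ s
    1≤2^ s = ℕₚ.m^n>0 2 s

    p-1 : ℕ
    p-1 = p ℕ.∸ 1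

  -- For s = 0 the two hypotheses on degeneracy contradict each other, since 2^0 = 1, so the
  -- truncated s - 1 in the bound does no harm there.
  upperBound : ∀ s (F : FiniteField) d → HasCharDeg F p (2 ℕ.^ s) → 1 ℕ.≤ d → gcd d (FiniteField.size F ℕ.∸ 1) ≡ 1 →
    ¬ DegenerateOver d p (2 ℕ.^ s) → DegenerateOver d p 1 →
    Σ (FiniteField.Carrier F) λ a → ¬ valAtLeast (weil F p (2 ℕ.^ s) d a) (p-1 ℕ.* 2 ℕ.^ (s ℕ.∸ 1) ℕ.+ 1)
  upperBound zero    F d cd 1≤d gcd≡1 ¬degenerate degenerate₁ = ⊥-elim (¬degenerate degenerate₁)
  upperBound (suc s) F d cd 1≤d gcd≡1 ¬degenerate degenerate₁ =
    subst (λ n → Σ (FiniteField.Carrier F) λ a → ¬ valAtLeast (weil F p n d a) (p-1 ℕ.* 2 ℕ.^ s ℕ.+ 1)) (sym (double s))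
      (Extension.Bounds.upperBound pr (cyclotomicRing pr) (2 ℕ.^ s) (1≤2^ s) F K extension d 1≤d gcd≡1
        (subst (λ n → ¬ DegenerateOver d p n) (double s) ¬degenerate) (step s refl))
    where
    open FixedField pr (2 ℕ.^ s) (1≤2^ s) F (subst (HasCharDeg F p) (double s) cd) using (K; extension)
    -- The induction hypothesis for K. If s = 0, then K is the prime field, over which d is
    -- degenerate, so this case cannot occur.
    step : ∀ s₀ → s₀ ≡ s → ¬ DegenerateOver d p (2 ℕ.^ s) → Σ ℕ λ v → p-1 ℕ.* 2 ℕ.^ s ≡ v ℕ.+ v ×
             Σ (FiniteField.Carrier K) λ b → ¬ valAtLeast (weil K p (2 ℕ.^ s) d b) (v ℕ.+ 1)
    step zero     eq ¬degenerateK = ⊥-elim (¬degenerateK (subst (λ s → DegenerateOver d p (2 ℕ.^ s)) eq degenerate₁))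
    -- Half of (p-1) 2^s, which is the bound for K.
    step (suc s₁) eq ¬degenerateK = p-1 ℕ.* 2 ℕ.^ (s ℕ.∸ 1) ,
      subst (λ s → p-1 ℕ.* 2 ℕ.^ s ≡ p-1 ℕ.* 2 ℕ.^ (s ℕ.∸ 1) ℕ.+ p-1 ℕ.* 2 ℕ.^ (s ℕ.∸ 1)) eq
        (trans (cong (p-1 ℕ.*_) (double s₁)) (ℕₚ.*-distribˡ-+ p-1 (2 ℕ.^ s₁) _)) ,
      upperBound s K d (QuadraticExtension.charK extension) 1≤d
        (Extension.Bounds.gcdK≡1 pr (cyclotomicRing pr) (2 ℕ.^ s) (1≤2^ s) F K extension d 1≤d gcd≡1) ¬degenerateK degenerate₁

  lowerBound : ∀ s (F : FiniteField) d → 1 ℕ.≤ s → HasCharDeg F p (2 ℕ.^ s) → 1 ℕ.≤ d → gcd d (FiniteField.size F ℕ.∸ 1) ≡ 1 →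
    DegenerateOver d p (2 ℕ.^ (s ℕ.∸ 1)) →
    ∀ a → valAtLeast (weil F p (2 ℕ.^ s) d a) (p-1 ℕ.* 2 ℕ.^ (s ℕ.∸ 1))
  lowerBound (suc s) F d _ cd 1≤d gcd≡1 degenerate a =
    subst (λ n → valAtLeast (weil F p n d a) (p-1 ℕ.* 2 ℕ.^ s)) (sym (double s))
      (Extension.Bounds.lowerBound pr (cyclotomicRing pr) (2 ℕ.^ s) (1≤2^ s) F K extension d 1≤d gcd≡1 degenerate a)
    where
    open FixedField pr (2 ℕ.^ s) (1≤2^ s) F (subst (HasCharDeg F p) (double s) cd) using (K; extension)

open import Data.Nat using (_+_; _*_; _∸_; _^_; _≤_)

theorem4p1 : (F : FiniteField) (p s d : ℕ) →
    Prime p → 1 ≤ s → HasCharDeg F p (2 ^ s) →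
    1 ≤ d → gcd d (FiniteField.size F ∸ 1) ≡ 1 →
    ¬ DegenerateOver d p (2 ^ s) → DegenerateOver d p 1 →
    -- V_{F,d} ≤ [F:F_p]/2 = 2^(s-1)
    Σ (FiniteField.Carrier F)
      (λ a → ¬ valAtLeast (weil F p (2 ^ s) d a) ((p ∸ 1) * 2 ^ (s ∸ 1) + 1))
    ×
    -- and V_{F,d} ≥ 2^(s-1) (hence equality) if d is degenerate over
    -- the subfield of order √q = p^(2^(s-1))
    (DegenerateOver d p (2 ^ (s ∸ 1)) →
      (a : FiniteField.Carrier F) →
        valAtLeast (weil F p (2 ^ s) d a) ((p ∸ 1) * 2 ^ (s ∸ 1)))
theorem4p1 F p s d pr 1≤s cd 1≤d gcd≡1 ¬degenerate degenerate₁ =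
  Tower.upperBound pr s F d cd 1≤d gcd≡1 ¬degenerate degenerate₁ ,
  Tower.lowerBound pr s F d 1≤s cd 1≤d gcd≡1
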